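{- Let $s,t\geq 1$ be integers and let $p,q,l$ be three distinct primes with $p,q$ odd, $p\equiv 3 \pmod 4$, $\mathrm{ord}_{p^s}(l)=\phi(p^s)/2$, $\mathrm{ord}_{q^t}(l)=\phi(q^t)$ and $\gcd(\phi(p^s),\phi(q^t))=2$. Let $0\leq i\leq s-1$ and $0\leq j\leq t-1$. Then in the ring $\mathbb{F}_l[x]/\langle x^{p^sq^t}-1\rangle$: (i) If $q$ is a quadratic residue modulo $p$, then \[ \begin{aligned}\chi_{ij}^2=&\frac{p-3}{4}p^{s-i-1}\Big((q-2)q^{t-j-1}\chi_{ij}+\phi(q^{t-j})\sum_{j<m\leq t}\chi_{im}\Big)\\&+\frac{p+1}{4}p^{s-i-1}\Big((q-2)q^{t-j-1}\chi_{ij}^*+\phi(q^{t-j})\sum_{j<m\leq t}\chi_{im}^*\Big). \end{aligned}\] (ii) If $q$ is a quadratic nonresidue modulo $p$, then \[ \begin{aligned}\chi_{ij}^2=&\frac{p-3}{4}p^{s-i-1}\Big((q-2)q^{t-j-1}\chi_{ij}+\phi(q^{t-j})\Big(\sum_{\substack{j<m\leq t\\2\nmid m-j}}\chi_{im}^*+\sum_{\substack{j<m\leq t\\2\mid m-j}}\chi_{im}\Big)\Big)\\ &+\frac{p+1}{4}p^{s-i-1}\Big((q-2)q^{t-j-1}\chi_{ij}^*+\phi(q^{t-j})\Big(\sum_{\substack{j<m\leq t\\2\nmid m-j}}\chi_{im}+\sum_{\substack{j<m\leq t\\2\mid m-j}}\chi_{im}^*\Big)\Big). \end{aligned}\]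
   Context: Here $\phi$ is Euler's phi function (with $\phi(1)=1$) and $\mathrm{ord}_m(k)$ is the multiplicative order of $k$ modulo $m$. Put $n=p^sq^t$. Fix an integer $g$ that is a primitive root both modulo $p^s$ and modulo $q^t$. For an integer $\gamma$, $C_\gamma=\{\gamma l^r \bmod n: r\geq 0\}\subseteq \mathbb{Z}_n$ is the $l$-cyclotomic coset modulo $n$ containing $\gamma$. For $0\leq i\leq s$, $0\leq j\leq t$ set $C_{ij}=C_{p^iq^j}$ and $C_{ij}^*=C_{p^iq^jg}$; in particular $C_{sj}=C_{sj}^*$ and $C_{st}=C_0=\{0\}$. Define elements of $\mathbb{F}_l[x]/\langle x^{n}-1\rangle$ by $\chi_{ij}=\sum_{\alpha\in C_{ij}}x^\alpha$ and $\chi_{ij}^*=\sum_{\alpha\in C_{ij}^*}x^\alpha$; in particular $\chi_{sj}=\chi_{sj}^*$ and $\chi_{st}=1$. Integer coefficients are read in $\mathbb{F}_l$, and empty sums are $0$. -}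

module Defs where

open import Algebra.Bundles using (CommutativeMonoid; CommutativeRing)
open import Data.Fin.Base using (Fin; toℕ; fromℕ<)
open import Data.Fin.Properties using (pigeonhole; toℕ<n; toℕ-fromℕ<)
open import Data.Integer.Base as ℤ using (ℤ; +_; 1ℤ)
open import Data.Integer.Divisibility.Signed using (_∣_; _∣?_; ∣n⇒∣m*n; ∣m∣n⇒∣m+n; ∣m⇒∣-m; divides)
open import Data.Integer.DivMod using (_%ℕ_; _/ℕ_; n%ℕd<d; a≡a%ℕn+[a/ℕn]*n)
import Data.Integer.Properties as ℤₚ
open import Data.Integer.Solver using (module +-*-Solver)
open import Data.List.Base using (List; []; _∷_; map; filter; foldr; length; upTo; allFin)
open import Data.Nat.Base as ℕ using (ℕ; zero; suc; _<_; _≤_)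
open import Data.Nat.Coprimality using (coprime?)
open import Data.Nat.Induction using (<-rec)
open import Data.Nat.Divisibility using () renaming (_∣?_ to _∣ℕ?_)
import Data.Nat.Properties as ℕₚ
open import Data.Product.Base using (∃; _×_; _,_)
open import Level using (Level; _⊔_)
open import Relation.Binary.PropositionalEquality as ≡ using (_≡_)
open import Relation.Nullary using (¬_; Dec; yes; no)
open import Relation.Nullary.Decidable using (map′; ¬?)

private
  variable
    c ℓ : Level

------------------------------------------------------------------------
-- The quotient R/⟨a⟩ of a commutative ring by a principal ideal: the
-- elements are those of R, and only the equality changes.

module _ (R : CommutativeRing c ℓ) where

  open CommutativeRing R
  open import Algebra.Properties.Ring ring
    using (x[y-z]≈xy-xz; [y-z]x≈yx-zx; -‿distribˡ-*; -‿involutive; -‿+-comm)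
  open import Algebra.Properties.CommutativeSemigroup
    (CommutativeMonoid.commutativeSemigroup +-commutativeMonoid)
    using (interchange)
  open import Relation.Binary.Reasoning.Setoid setoid

  record Congruent (a x y : Carrier) : Set (c ⊔ ℓ) where
    constructor congruent
    field
      quotient : Carrier
      equality : quotient * a ≈ x - y

  private
    telescope : ∀ x y z → (x - y) + (y - z) ≈ x - z
    telescope x y z = begin
      (x - y) + (y - z)      ≈⟨ +-assoc x (- y) (y - z) ⟩
      x + (- y + (y - z))    ≈⟨ +-congˡ (+-assoc (- y) y (- z)) ⟨
      x + ((- y + y) - z)    ≈⟨ +-congˡ (+-congʳ (-‿inverseˡ y)) ⟩
      x + (0# - z)           ≈⟨ +-congˡ (+-identityˡ (- z)) ⟩
      x - z                  ∎

    flip : ∀ x y → - (x - y) ≈ y - x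
    flip x y = begin
      - (x - y)      ≈⟨ -‿+-comm x (- y) ⟨
      - x + - - y    ≈⟨ +-congˡ (-‿involutive y) ⟩
      - x + y        ≈⟨ +-comm (- x) y ⟩
      y - x          ∎

    module _ {a : Carrier} where

      ≈⇒≋ : ∀ {x y} → x ≈ y → Congruent a x y
      ≈⇒≋ {x} {y} x≈y = congruent 0# (begin
        0# * a  ≈⟨ zeroˡ a ⟩
        0#      ≈⟨ -‿inverseʳ y ⟨
        y - y   ≈⟨ +-congʳ x≈y ⟨
        x - y   ∎)

      ≋-sym : ∀ {x y} → Congruent a x y → Congruent a y x
      ≋-sym {x} {y} (congruent h ha≈x-y) = congruent (- h) (begin
        - h * a    ≈⟨ -‿distribˡ-* h a ⟨
        - (h * a)  ≈⟨ -‿cong ha≈x-y ⟩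
        - (x - y)  ≈⟨ flip x y ⟩
        y - x      ∎)

      ≋-trans : ∀ {x y z} → Congruent a x y → Congruent a y z → Congruent a x z
      ≋-trans {x} {y} {z} (congruent h eq) (congruent k eq′) = congruent (h + k) (begin
        (h + k) * a        ≈⟨ distribʳ a h k ⟩
        h * a + k * a      ≈⟨ +-cong eq eq′ ⟩
        (x - y) + (y - z)  ≈⟨ telescope x y z ⟩
        x - z              ∎)

      ≋-+-cong : ∀ {x y u v} → Congruent a x y → Congruent a u v → Congruent a (x + u) (y + v)
      ≋-+-cong {x} {y} {u} {v} (congruent h eq) (congruent k eq′) = congruent (h + k) (begin
        (h + k) * a            ≈⟨ distribʳ a h k ⟩
        h * a + k * a          ≈⟨ +-cong eq eq′ ⟩
        (x - y) + (u - v)      ≈⟨ interchange x (- y) u (- v) ⟩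
        (x + u) + (- y + - v)  ≈⟨ +-congˡ (-‿+-comm y v) ⟩
        (x + u) - (y + v)      ∎)

      ≋-neg-cong : ∀ {x y} → Congruent a x y → Congruent a (- x) (- y)
      ≋-neg-cong {x} {y} (congruent h eq) = congruent (- h) (begin
        - h * a    ≈⟨ -‿distribˡ-* h a ⟨
        - (h * a)  ≈⟨ -‿cong eq ⟩
        - (x - y)  ≈⟨ -‿+-comm x (- y) ⟨
        - x - - y  ∎)

      ≋-*-cong : ∀ {x y u v} → Congruent a x y → Congruent a u v → Congruent a (x * u) (y * v)
      ≋-*-cong {x} {y} {u} {v} (congruent h eq) (congruent k eq′) = congruent (h * u + y * k) (begin
        (h * u + y * k) * a                  ≈⟨ distribʳ a (h * u) (y * k) ⟩
        h * u * a + y * k * a                ≈⟨ +-cong rearrange (*-assoc y k a) ⟩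
        h * a * u + y * (k * a)              ≈⟨ +-cong (*-congʳ eq) (*-congˡ eq′) ⟩
        (x - y) * u + y * (u - v)            ≈⟨ +-cong ([y-z]x≈yx-zx u x y) (x[y-z]≈xy-xz y u v) ⟩
        (x * u - y * u) + (y * u - y * v)    ≈⟨ telescope (x * u) (y * u) (y * v) ⟩
        x * u - y * v                        ∎)
        where
        rearrange : h * u * a ≈ h * a * u
        rearrange = begin
          h * u * a    ≈⟨ *-assoc h u a ⟩
          h * (u * a)  ≈⟨ *-congˡ (*-comm u a) ⟩
          h * (a * u)  ≈⟨ *-assoc h a u ⟨
          h * a * u    ∎

  infixl 7 _/⟨_⟩

  _/⟨_⟩ : Carrier → CommutativeRing c (c ⊔ ℓ)
  _/⟨_⟩ a = record
    { Carrier = Carrier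
    ; _≈_     = Congruent a
    ; _+_     = _+_
    ; _*_     = _*_
    ; -_      = -_
    ; 0#      = 0#
    ; 1#      = 1#
    ; isCommutativeRing = record
      { isRing = record
        { +-isAbelianGroup = record
          { isGroup = record
            { isMonoid = record
              { isSemigroup = record
                { isMagma = record
                  { isEquivalence = record
                    { refl  = ≈⇒≋ refl
                    ; sym   = ≋-sym
                    ; trans = ≋-trans
                    }
                  ; ∙-cong = ≋-+-cong
                  }
                ; assoc = λ x y z → ≈⇒≋ (+-assoc x y z)
                }
              ; identity = (λ x → ≈⇒≋ (+-identityˡ x)) , (λ x → ≈⇒≋ (+-identityʳ x))
              }
            ; inverse = (λ x → ≈⇒≋ (-‿inverseˡ x)) , (λ x → ≈⇒≋ (-‿inverseʳ x))
            ; ⁻¹-cong = ≋-neg-cong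
            }
          ; comm = λ x y → ≈⇒≋ (+-comm x y)
          }
        ; *-cong     = ≋-*-cong
        ; *-assoc    = λ x y z → ≈⇒≋ (*-assoc x y z)
        ; *-identity = (λ x → ≈⇒≋ (*-identityˡ x)) , (λ x → ≈⇒≋ (*-identityʳ x))
        ; distrib    = (λ x y z → ≈⇒≋ (distribˡ x y z)) , (λ x y z → ≈⇒≋ (distribʳ x y z))
        }
      ; *-comm = λ x y → ≈⇒≋ (*-comm x y)
      }
    }

------------------------------------------------------------------------
-- Univariate polynomials: lists of coefficients, constant term first.
-- Trailing zeros are not normalised away, so equality compares the
-- coefficients of every degree.

module Polynomial (R : CommutativeRing c ℓ) where

  open CommutativeRing R
  open import Algebra.Properties.Ring ring using (-0#≈0#)

  Poly : Set c
  Poly = List Carrier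

  coeff : Poly → ℕ → Carrier
  coeff []      k       = 0#
  coeff (a ∷ f) zero    = a
  coeff (a ∷ f) (suc k) = coeff f k

  infix 4 _≈ₚ_

  record _≈ₚ_ (f g : Poly) : Set ℓ where
    constructor coeffwise
    field
      coeff-≈ : ∀ k → coeff f k ≈ coeff g k

  open _≈ₚ_ public

  infixl 6 _+ₚ_
  infixl 7 _*ₚ_
  infixr 7 _·ₚ_
  infix  8 -ₚ_

  _+ₚ_ : Poly → Poly → Poly
  []      +ₚ g       = g
  (a ∷ f) +ₚ []      = a ∷ f
  (a ∷ f) +ₚ (b ∷ g) = a + b ∷ f +ₚ g

  -ₚ_ : Poly → Poly
  -ₚ_ = map (-_)

  _·ₚ_ : Carrier → Poly → Poly
  a ·ₚ f = map (a *_) f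

  _*ₚ_ : Poly → Poly → Poly
  []      *ₚ g = []
  (a ∷ f) *ₚ g = a ·ₚ g +ₚ (0# ∷ f *ₚ g)

  constant : Carrier → Poly
  constant a = a ∷ []

  X^_ : ℕ → Poly
  X^ zero  = constant 1#
  X^ suc k = 0# ∷ X^ k

  coeff-+ : ∀ f g k → coeff (f +ₚ g) k ≈ coeff f k + coeff g k
  coeff-+ []      g       k       = sym (+-identityˡ (coeff g k))
  coeff-+ (a ∷ f) []      k       = sym (+-identityʳ (coeff (a ∷ f) k))
  coeff-+ (a ∷ f) (b ∷ g) zero    = refl
  coeff-+ (a ∷ f) (b ∷ g) (suc k) = coeff-+ f g k

  coeff-neg : ∀ f k → coeff (-ₚ f) k ≈ - coeff f k
  coeff-neg []      k       = sym -0#≈0#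
  coeff-neg (a ∷ f) zero    = refl
  coeff-neg (a ∷ f) (suc k) = coeff-neg f k

  coeff-· : ∀ a f k → coeff (a ·ₚ f) k ≈ a * coeff f k
  coeff-· a []      k       = sym (zeroʳ a)
  coeff-· a (b ∷ f) zero    = refl
  coeff-· a (b ∷ f) (suc k) = coeff-· a f k

  private

    ≈ₚ-refl : ∀ {f} → f ≈ₚ f
    ≈ₚ-refl = coeffwise λ _ → refl

    ≈ₚ-sym : ∀ {f g} → f ≈ₚ g → g ≈ₚ f
    ≈ₚ-sym f≈g = coeffwise λ k → sym (coeff-≈ f≈g k)

    ≈ₚ-trans : ∀ {f g h} → f ≈ₚ g → g ≈ₚ h → f ≈ₚ h
    ≈ₚ-trans f≈g g≈h = coeffwise λ k → trans (coeff-≈ f≈g k) (coeff-≈ g≈h k)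

    infixr 5 _∷-cong_
    _∷-cong_ : ∀ {a b f g} → a ≈ b → f ≈ₚ g → a ∷ f ≈ₚ b ∷ g
    a≈b ∷-cong f≈g = coeffwise λ { zero → a≈b ; (suc k) → coeff-≈ f≈g k }

    0∷[] : 0# ∷ [] ≈ₚ []
    0∷[] = coeffwise λ { zero → refl ; (suc k) → refl }

    +ₚ-cong : ∀ {f g u v} → f ≈ₚ g → u ≈ₚ v → f +ₚ u ≈ₚ g +ₚ v
    +ₚ-cong {f} {g} {u} {v} f≈g u≈v = coeffwise λ k →
      trans (coeff-+ f u k)
        (trans (+-cong (coeff-≈ f≈g k) (coeff-≈ u≈v k)) (sym (coeff-+ g v k)))

    +ₚ-assoc : ∀ f g h → (f +ₚ g) +ₚ h ≈ₚ f +ₚ (g +ₚ h)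
    +ₚ-assoc f g h = coeffwise λ k →
      trans (coeff-+ (f +ₚ g) h k)
        (trans (+-congʳ (coeff-+ f g k))
          (trans (+-assoc _ _ _)
            (trans (+-congˡ (sym (coeff-+ g h k))) (sym (coeff-+ f (g +ₚ h) k)))))

    +ₚ-comm : ∀ f g → f +ₚ g ≈ₚ g +ₚ f
    +ₚ-comm f g = coeffwise λ k →
      trans (coeff-+ f g k) (trans (+-comm _ _) (sym (coeff-+ g f k)))

    +ₚ-identityʳ : ∀ f → f +ₚ [] ≈ₚ f
    +ₚ-identityʳ f = +ₚ-comm f []

    +ₚ-swap : ∀ f g h → f +ₚ (g +ₚ h) ≈ₚ g +ₚ (f +ₚ h)
    +ₚ-swap f g h =
      ≈ₚ-trans (≈ₚ-sym (+ₚ-assoc f g h))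
        (≈ₚ-trans (+ₚ-cong (+ₚ-comm f g) ≈ₚ-refl) (+ₚ-assoc g f h))

    -ₚ-cong : ∀ {f g} → f ≈ₚ g → -ₚ f ≈ₚ -ₚ g
    -ₚ-cong {f} {g} f≈g = coeffwise λ k →
      trans (coeff-neg f k) (trans (-‿cong (coeff-≈ f≈g k)) (sym (coeff-neg g k)))

    -ₚ-inverseˡ : ∀ f → -ₚ f +ₚ f ≈ₚ []
    -ₚ-inverseˡ f = coeffwise λ k →
      trans (coeff-+ (-ₚ f) f k) (trans (+-congʳ (coeff-neg f k)) (-‿inverseˡ _))

    ·ₚ-congˡ : ∀ a {f g} → f ≈ₚ g → a ·ₚ f ≈ₚ a ·ₚ g
    ·ₚ-congˡ a {f} {g} f≈g = coeffwise λ k →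
      trans (coeff-· a f k) (trans (*-congˡ (coeff-≈ f≈g k)) (sym (coeff-· a g k)))

    ·ₚ-distribˡ : ∀ a f g → a ·ₚ (f +ₚ g) ≈ₚ a ·ₚ f +ₚ a ·ₚ g
    ·ₚ-distribˡ a f g = coeffwise λ k →
      trans (coeff-· a (f +ₚ g) k)
        (trans (*-congˡ (coeff-+ f g k))
          (trans (distribˡ a _ _)
            (trans (+-cong (sym (coeff-· a f k)) (sym (coeff-· a g k)))
              (sym (coeff-+ (a ·ₚ f) (a ·ₚ g) k)))))

    ·ₚ-distribʳ : ∀ a b f → (a + b) ·ₚ f ≈ₚ a ·ₚ f +ₚ b ·ₚ f
    ·ₚ-distribʳ a b f = coeffwise λ k →
      trans (coeff-· (a + b) f k)
        (trans (distribʳ _ a b)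
          (trans (+-cong (sym (coeff-· a f k)) (sym (coeff-· b f k)))
            (sym (coeff-+ (a ·ₚ f) (b ·ₚ f) k))))

    ·ₚ-assoc : ∀ a b f → (a * b) ·ₚ f ≈ₚ a ·ₚ b ·ₚ f
    ·ₚ-assoc a b f = coeffwise λ k →
      trans (coeff-· (a * b) f k)
        (trans (*-assoc a b _)
          (trans (*-congˡ (sym (coeff-· b f k))) (sym (coeff-· a (b ·ₚ f) k))))

    1·ₚ : ∀ f → 1# ·ₚ f ≈ₚ f
    1·ₚ f = coeffwise λ k → trans (coeff-· 1# f k) (*-identityˡ _)

    0·ₚ : ∀ f → 0# ·ₚ f ≈ₚ []
    0·ₚ f = coeffwise λ k → trans (coeff-· 0# f k) (zeroˡ _)

    interchangeₚ : ∀ f g u v → (f +ₚ g) +ₚ (u +ₚ v) ≈ₚ (f +ₚ u) +ₚ (g +ₚ v)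
    interchangeₚ f g u v =
      ≈ₚ-trans (+ₚ-assoc f g (u +ₚ v))
        (≈ₚ-trans (+ₚ-cong (≈ₚ-refl {f}) (+ₚ-swap g u v))
          (≈ₚ-sym (+ₚ-assoc f u (g +ₚ v))))

    0∷-+ : ∀ f g → 0# ∷ f +ₚ g ≈ₚ (0# ∷ f) +ₚ (0# ∷ g)
    0∷-+ f g = sym (+-identityˡ 0#) ∷-cong ≈ₚ-refl

    0∷-* : ∀ f g → (0# ∷ f) *ₚ g ≈ₚ 0# ∷ f *ₚ g
    0∷-* f g = +ₚ-cong {g = []} (0·ₚ g) ≈ₚ-refl

    ·ₚ-*ₚ : ∀ a f g → (a ·ₚ f) *ₚ g ≈ₚ a ·ₚ (f *ₚ g)
    ·ₚ-*ₚ a []      g = ≈ₚ-refl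
    ·ₚ-*ₚ a (b ∷ f) g =
      ≈ₚ-trans
        (+ₚ-cong (·ₚ-assoc a b g) (sym (zeroʳ a) ∷-cong ·ₚ-*ₚ a f g))
        (≈ₚ-sym (·ₚ-distribˡ a (b ·ₚ g) (0# ∷ f *ₚ g)))

    *ₚ-congˡ : ∀ f {g h} → g ≈ₚ h → f *ₚ g ≈ₚ f *ₚ h
    *ₚ-congˡ []      g≈h = ≈ₚ-refl
    *ₚ-congˡ (a ∷ f) g≈h = +ₚ-cong (·ₚ-congˡ a g≈h) (refl ∷-cong *ₚ-congˡ f g≈h)

    *ₚ-zeroʳ : ∀ f → f *ₚ [] ≈ₚ []
    *ₚ-zeroʳ []      = ≈ₚ-refl
    *ₚ-zeroʳ (a ∷ f) = ≈ₚ-trans (refl ∷-cong *ₚ-zeroʳ f) 0∷[]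

    *ₚ-∷ʳ : ∀ f b g → f *ₚ (b ∷ g) ≈ₚ b ·ₚ f +ₚ (0# ∷ f *ₚ g)
    *ₚ-∷ʳ []      b g = ≈ₚ-sym 0∷[]
    *ₚ-∷ʳ (a ∷ f) b g =
      +-congʳ (*-comm a b) ∷-cong
        ≈ₚ-trans (+ₚ-cong (≈ₚ-refl {a ·ₚ g}) (*ₚ-∷ʳ f b g))
          (+ₚ-swap (a ·ₚ g) (b ·ₚ f) (0# ∷ f *ₚ g))

    *ₚ-comm : ∀ f g → f *ₚ g ≈ₚ g *ₚ f
    *ₚ-comm []      g = ≈ₚ-sym (*ₚ-zeroʳ g)
    *ₚ-comm (a ∷ f) g =
      ≈ₚ-trans (+ₚ-cong (≈ₚ-refl {a ·ₚ g}) (refl ∷-cong *ₚ-comm f g))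
        (≈ₚ-sym (*ₚ-∷ʳ g a f))

    *ₚ-cong : ∀ {f g u v} → f ≈ₚ g → u ≈ₚ v → f *ₚ u ≈ₚ g *ₚ v
    *ₚ-cong {f} {g} {u} {v} f≈g u≈v =
      ≈ₚ-trans (*ₚ-congˡ f u≈v)
        (≈ₚ-trans (*ₚ-comm f v) (≈ₚ-trans (*ₚ-congˡ v f≈g) (*ₚ-comm v g)))

    *ₚ-distribʳ : ∀ h f g → (f +ₚ g) *ₚ h ≈ₚ f *ₚ h +ₚ g *ₚ h
    *ₚ-distribʳ h []      g       = ≈ₚ-refl
    *ₚ-distribʳ h (a ∷ f) []      = ≈ₚ-sym (+ₚ-identityʳ ((a ∷ f) *ₚ h))
    *ₚ-distribʳ h (a ∷ f) (b ∷ g) =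
      ≈ₚ-trans
        (+ₚ-cong (·ₚ-distribʳ a b h)
          (≈ₚ-trans (refl ∷-cong *ₚ-distribʳ h f g) (0∷-+ (f *ₚ h) (g *ₚ h))))
        (interchangeₚ (a ·ₚ h) (b ·ₚ h) (0# ∷ f *ₚ h) (0# ∷ g *ₚ h))

    *ₚ-distribˡ : ∀ h f g → h *ₚ (f +ₚ g) ≈ₚ h *ₚ f +ₚ h *ₚ g
    *ₚ-distribˡ h f g =
      ≈ₚ-trans (*ₚ-comm h (f +ₚ g))
        (≈ₚ-trans (*ₚ-distribʳ h f g) (+ₚ-cong (*ₚ-comm f h) (*ₚ-comm g h)))

    *ₚ-assoc : ∀ f g h → (f *ₚ g) *ₚ h ≈ₚ f *ₚ (g *ₚ h)
    *ₚ-assoc []      g h = ≈ₚ-refl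
    *ₚ-assoc (a ∷ f) g h =
      ≈ₚ-trans (*ₚ-distribʳ h (a ·ₚ g) (0# ∷ f *ₚ g))
        (+ₚ-cong (·ₚ-*ₚ a g h)
          (≈ₚ-trans (0∷-* (f *ₚ g) h) (refl ∷-cong *ₚ-assoc f g h)))

    *ₚ-identityˡ : ∀ f → constant 1# *ₚ f ≈ₚ f
    *ₚ-identityˡ f =
      ≈ₚ-trans (+ₚ-cong (1·ₚ f) 0∷[]) (+ₚ-identityʳ f)

  polynomialRing : CommutativeRing c ℓ
  polynomialRing = record
    { Carrier = Poly
    ; _≈_     = _≈ₚ_
    ; _+_     = _+ₚ_
    ; _*_     = _*ₚ_
    ; -_      = -ₚ_
    ; 0#      = []
    ; 1#      = constant 1#
    ; isCommutativeRing = record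
      { isRing = record
        { +-isAbelianGroup = record
          { isGroup = record
            { isMonoid = record
              { isSemigroup = record
                { isMagma = record
                  { isEquivalence = record
                    { refl = ≈ₚ-refl ; sym = ≈ₚ-sym ; trans = ≈ₚ-trans }
                  ; ∙-cong = +ₚ-cong
                  }
                ; assoc = +ₚ-assoc
                }
              ; identity = (λ _ → ≈ₚ-refl) , +ₚ-identityʳ
              }
            ; inverse = -ₚ-inverseˡ ,
                        (λ f → ≈ₚ-trans (+ₚ-comm f (-ₚ f)) (-ₚ-inverseˡ f))
            ; ⁻¹-cong = -ₚ-cong
            }
          ; comm = +ₚ-comm
          }
        ; *-cong     = *ₚ-cong
        ; *-assoc    = *ₚ-assoc
        ; *-identity = *ₚ-identityˡ ,
                       (λ f → ≈ₚ-trans (*ₚ-comm f (constant 1#)) (*ₚ-identityˡ f))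
        ; distrib    = *ₚ-distribˡ , *ₚ-distribʳ
        }
      ; *-comm = *ₚ-comm
      }
    }

------------------------------------------------------------------------
-- Congruences, Euler's function and multiplicative orders

infix 4 _≡_[mod_]

_≡_[mod_] : ℤ → ℤ → ℕ → Set
a ≡ b [mod m ] = + m ∣ a ℤ.- b

φ : ℕ → ℕ
φ m = length (filter (λ k → coprime? k m) (map suc (upTo m)))

-- HasOrder m a d says that ord_m(a) is defined and equal to d.
record HasOrder (m : ℕ) (a : ℤ) (d : ℕ) : Set where
  field
    positive : 0 < d
    power    : a ℤ.^ d ≡ 1ℤ [mod m ]
    minimal  : ∀ e → 0 < e → a ℤ.^ e ≡ 1ℤ [mod m ] → d ≤ e

IsPrimitiveRoot : ℤ → ℕ → Set
IsPrimitiveRoot a m = HasOrder m a (φ m)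

QuadraticResidue : ℤ → ℕ → Set
QuadraticResidue a m = ¬ (+ m ∣ a) × ∃ λ x → x ℤ.* x ≡ a [mod m ]

QuadraticNonresidue : ℤ → ℕ → Set
QuadraticNonresidue a m = ¬ (+ m ∣ a) × ¬ (∃ λ x → x ℤ.* x ≡ a [mod m ])

------------------------------------------------------------------------
-- Cyclotomic cosets.  An element α of ℤₙ is represented by its residue
-- in Fin n, so that α = γ lʳ mod n is the congruence below.

InCoset : (l n : ℕ) → ℤ → Fin n → Set
InCoset l n γ α = ∃ λ r → + toℕ α ≡ γ ℤ.* (+ l) ℤ.^ r [mod n ]

private

  ≡-mod-sym : ∀ {m} x y → x ≡ y [mod m ] → y ≡ x [mod m ]
  ≡-mod-sym {m} x y x≡y = ≡.subst (+ m ∣_) (lemma x y) (∣m⇒∣-m x≡y)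
    where
    lemma : ∀ x y → ℤ.- (x ℤ.- y) ≡ y ℤ.- x
    lemma = solve 2 (λ x y → :- (x :- y) := y :- x) ≡.refl
      where open +-*-Solver

  ≡-mod-trans : ∀ {m} x y z → x ≡ y [mod m ] → y ≡ z [mod m ] → x ≡ z [mod m ]
  ≡-mod-trans {m} x y z x≡y y≡z = ≡.subst (+ m ∣_) (lemma x y z) (∣m∣n⇒∣m+n x≡y y≡z)
    where
    lemma : ∀ x y z → (x ℤ.- y) ℤ.+ (y ℤ.- z) ≡ x ℤ.- z
    lemma = solve 3 (λ x y z → (x :- y) :+ (y :- z) := x :- z) ≡.refl
      where open +-*-Solver

  ≡-mod-*ˡ : ∀ {m} c x y → x ≡ y [mod m ] → c ℤ.* x ≡ c ℤ.* y [mod m ]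
  ≡-mod-*ˡ {m} c x y x≡y = ≡.subst (+ m ∣_) (lemma c x y) (∣n⇒∣m*n c x≡y)
    where
    lemma : ∀ c x y → c ℤ.* (x ℤ.- y) ≡ c ℤ.* x ℤ.- c ℤ.* y
    lemma = solve 3 (λ c x y → c :* (x :- y) := c :* x :- c :* y) ≡.refl
      where open +-*-Solver

  residue : ∀ {m} → ℤ → Fin (suc m)
  residue {m} x = fromℕ< (n%ℕd<d x (suc m))

  residue-≡ : ∀ {m} x → x ≡ + toℕ (residue {m} x) [mod suc m ]
  residue-≡ {m} x = divides (x /ℕ suc m) (begin
    x ℤ.- + toℕ (residue {m} x)          ≡⟨ ≡.cong (λ r → x ℤ.- + r) (toℕ-fromℕ< _) ⟩
    x ℤ.- + (x %ℕ suc m)                 ≡⟨ ≡.cong (ℤ._- + (x %ℕ suc m)) (a≡a%ℕn+[a/ℕn]*n x (suc m)) ⟩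
    (+ (x %ℕ suc m) ℤ.+ (x /ℕ suc m) ℤ.* + suc m) ℤ.- + (x %ℕ suc m)
      ≡⟨ lemma (+ (x %ℕ suc m)) ((x /ℕ suc m) ℤ.* + suc m) ⟩
    (x /ℕ suc m) ℤ.* + suc m             ∎)
    where
    open ≡.≡-Reasoning
    lemma : ∀ r y → (r ℤ.+ y) ℤ.- r ≡ y
    lemma = solve 2 (λ r y → (r :+ y) :- r := y) ≡.refl
      where open +-*-Solver

  module _ (l : ℕ) {m : ℕ} (γ : ℤ) where

    private
      n = suc m

      orbit : ℕ → ℤ
      orbit r = γ ℤ.* (+ l) ℤ.^ r

      orbit-shift : ∀ k r → (+ l) ℤ.^ k ℤ.* orbit r ≡ orbit (k ℕ.+ r)
      orbit-shift k r = begin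
        (+ l) ℤ.^ k ℤ.* (γ ℤ.* (+ l) ℤ.^ r)  ≡⟨ lemma ((+ l) ℤ.^ k) γ ((+ l) ℤ.^ r) ⟩
        γ ℤ.* ((+ l) ℤ.^ k ℤ.* (+ l) ℤ.^ r)  ≡⟨ ≡.cong (γ ℤ.*_) (ℤₚ.^-distribˡ-+-* (+ l) k r) ⟨
        orbit (k ℕ.+ r)                      ∎
        where
        open ≡.≡-Reasoning
        lemma : ∀ a b c → a ℤ.* (b ℤ.* c) ≡ b ℤ.* (a ℤ.* c)
        lemma = solve 3 (λ a b c → a :* (b :* c) := b :* (a :* c)) ≡.refl
          where open +-*-Solver

      repeats : ∃ λ i → ∃ λ j → i < j × j ≤ n × orbit j ≡ orbit i [mod n ]
      repeats with i , j , i<j , eq ← pigeonhole (ℕₚ.n<1+n n) (λ k → residue {m} (orbit (toℕ k))) =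
        toℕ i , toℕ j , i<j , ℕₚ.≤-pred (toℕ<n j) ,
        ≡-mod-trans (orbit (toℕ j)) (+ toℕ (residue {m} (orbit (toℕ i)))) (orbit (toℕ i))
          (≡.subst (λ k → orbit (toℕ j) ≡ + toℕ k [mod n ]) (≡.sym eq) (residue-≡ (orbit (toℕ j))))
          (≡-mod-sym (orbit (toℕ i)) (+ toℕ (residue {m} (orbit (toℕ i)))) (residue-≡ (orbit (toℕ i))))

      descend : ∀ {i j} r → j ≤ r → orbit j ≡ orbit i [mod n ] →
                orbit r ≡ orbit (r ℕ.∸ j ℕ.+ i) [mod n ]
      descend {i} {j} r j≤r eq =
        ≡.subst₂ (λ x y → x ≡ y [mod n ])
          (≡.trans (orbit-shift (r ℕ.∸ j) j) (≡.cong orbit (ℕₚ.m∸n+n≡m j≤r)))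
          (orbit-shift (r ℕ.∸ j) i)
          (≡-mod-*ˡ ((+ l) ℤ.^ (r ℕ.∸ j)) (orbit j) (orbit i) eq)

      module _ (α : Fin n) where

        Reducible : ℕ → Set
        Reducible r = + toℕ α ≡ orbit r [mod n ] →
                      ∃ λ r′ → r′ < n × + toℕ α ≡ orbit r′ [mod n ]

        step : (∃ λ i → ∃ λ j → i < j × j ≤ n × orbit j ≡ orbit i [mod n ]) →
               ∀ r → (∀ {k} → k < r → Reducible k) → Dec (r < n) → Reducible r
        step _                           r rec (yes r<n) α≡ = r , r<n , α≡
        step (i , j , i<j , j≤n , eq)    r rec (no  r≮n) α≡ =
          rec smaller (≡-mod-trans (+ toℕ α) (orbit r) (orbit (r ℕ.∸ j ℕ.+ i)) α≡
            (descend r j≤r eq))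
          where
          j≤r : j ≤ r
          j≤r = ℕₚ.≤-trans j≤n (ℕₚ.≮⇒≥ r≮n)

          smaller : r ℕ.∸ j ℕ.+ i < r
          smaller = ≡.subst (r ℕ.∸ j ℕ.+ i <_) (ℕₚ.m∸n+n≡m j≤r) (ℕₚ.+-monoʳ-< (r ℕ.∸ j) i<j)

    -- Two of the first n + 1 terms of γ, γ l, γ l², … agree modulo n, so
    -- every element of the coset already occurs with an exponent below n.
    reduce : ∀ α r → Reducible α r
    reduce α = <-rec (Reducible α) (λ r rec → step α repeats r rec (r ℕₚ.<? n))

inCoset? : ∀ l n γ (α : Fin n) → Dec (InCoset l n γ α)
inCoset? l (suc m) γ α =
  map′ (λ (r , _ , α≡) → r , α≡) (λ (r , α≡) → reduce l γ α r α≡)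
    (ℕₚ.anyUpTo? (λ r → + suc m ∣? + toℕ α ℤ.- γ ℤ.* (+ l) ℤ.^ r) (suc m))

------------------------------------------------------------------------
-- The ring 𝔽ₗ[x]/⟨xⁿ-1⟩ and its cyclotomic coset sums

ℤ/_ : ℕ → CommutativeRing _ _
ℤ/ m = ℤₚ.+-*-commutativeRing /⟨ + m ⟩

𝔽[X]/⟨X^_-1⟩ : (n l : ℕ) → CommutativeRing _ _
𝔽[X]/⟨X^ n -1⟩ l = polynomialRing /⟨ X^ n - 1# ⟩
  where
  open Polynomial (ℤ/ l)
  open CommutativeRing polynomialRing using (_-_; 1#)

module CosetSums (p q l s t : ℕ) (g : ℤ) where

  n : ℕ
  n = p ℕ.^ s ℕ.* q ℕ.^ t

  open CommutativeRing (𝔽[X]/⟨X^ n -1⟩ l) public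
    using (Carrier; _≈_; 0#)
    renaming (_+_ to infixl 6 _⊕_; _*_ to infixl 7 _⊗_)
  open Polynomial (ℤ/ l) using (constant; X^_)

  infixr 8 _·_

  -- 𝔽ₗ has carrier ℤ, so the natural number k is read in 𝔽ₗ as + k.
  _·_ : ℕ → Carrier → Carrier
  k · f = constant (+ k) ⊗ f

  ∑ : {A : Set} → List A → (A → Carrier) → Carrier
  ∑ xs f = foldr _⊕_ 0# (map f xs)

  cosetSum : ℤ → Carrier
  cosetSum γ = ∑ (filter (inCoset? l n γ) (allFin n)) (λ α → X^ toℕ α)

  χ χ* : ℕ → ℕ → Carrier
  χ  i j = cosetSum (+ (p ℕ.^ i ℕ.* q ℕ.^ j))
  χ* i j = cosetSum (+ (p ℕ.^ i ℕ.* q ℕ.^ j) ℤ.* g)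

  -- The indices j < m ≤ t, and those among them with m - j even or odd.
  above above-even above-odd : ℕ → List ℕ
  above      j = filter (j ℕₚ.<?_) (upTo (suc t))
  above-even j = filter (λ m → 2 ∣ℕ? (m ℕ.∸ j)) (above j)
  above-odd  j = filter (λ m → ¬? (2 ∣ℕ? (m ℕ.∸ j))) (above j)

{-# OPTIONS --safe #-}
module Submission where

-- Put s = i + a + 1 and t = j + b + 1. Modulo p the powers of l form a set P
-- with P ⊎ -P the units: ord(l) = φ(pˢ)/2 is odd, so -1 is no power of l and
-- -l is a primitive root modulo pˢ. As the orders of l modulo pˢ and qᵗ are
-- coprime, χ i m and χ* i m run over the p ^ i q ^ m u with q ∤ u and u ∈ P,
-- respectively -u ∈ P. Hence the coefficient of x ^ (p ^ i q ^ j c) in χᵢⱼ² is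
-- pᵃ qᵇ times the product of two counts: that of the u modulo p with u and
-- c - u in P, and that of the u modulo q with u and c - u units. The second is
-- q - 2 or q - 1 according as q ∤ c or q ∣ c. For the first, let α be its value
-- at c = 1. Comparing u + v = w with w - v = u in P³ shows that α also counts
-- the u ∈ P with u - 1 ∈ P, whence |P| = 2α + 1 and p = 4α + 3, and the first
-- count is α if c ∈ P, α + 1 if -c ∈ P and 0 if p ∣ c.

open import Defs
open import Algebra.Bundles using (CommutativeRing; CommutativeSemiring)
open import Data.Bool.Base using (if_then_else_)
open import Data.Empty using (⊥-elim)
open import Data.Fin.Base as Fin using (Fin; toℕ; fromℕ<; punchIn)
import Data.Fin.Properties as Finₚ
open import Data.Integer.Base as ℤ using (ℤ; 0ℤ; 1ℤ; -1ℤ)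
open import Data.Integer.Divisibility.Signed as ℤ∣ using (∣⇒∣ᵤ; ∣ᵤ⇒∣)
open import Data.Integer.DivMod using (_%ℕ_; _/ℕ_; n%ℕd<d; a≡a%ℕn+[a/ℕn]*n)
import Data.Integer.Properties as ℤₚ
import Data.Integer.Tactic.RingSolver as ℤ-Solver
open import Data.List.Base using (List; []; _∷_; map; filter; foldr; length; tabulate; applyUpTo; upTo; allFin)
open import Data.Nat.Base as ℕ using (ℕ; zero; suc; NonZero)
open import Data.Nat.Coprimality as Coprimality using (Coprime; coprime?; coprime-divisor; coprime-Bézout)
import Data.Nat.Divisibility as ℕ∣
import Data.Nat.DivMod as ℕ/
open import Data.Nat.GCD using (gcd; gcd-greatest; module Bézout)
open import Data.Nat.Primality using (Prime; prime⇒nonZero; prime⇒nonTrivial; prime⇒irreducible; prime[2]; euclidsLemma)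
import Data.Nat.Properties as ℕₚ
open import Data.Nat.Tactic.RingSolver using (solve-∀)
open import Data.Product using (∃; _×_; _,_; proj₁; proj₂)
open import Data.Sign.Base as Sign using (Sign)
open import Data.Sum using (_⊎_; inj₁; inj₂; [_,_]′)
open import Function using (_∘_; id)
open import Level using (Level; _⊔_)
open import Relation.Binary.PropositionalEquality as ≡ using (_≡_; _≢_; cong; cong₂; subst)
open import Relation.Nullary using (Dec; yes; no; ¬_; contradiction)
open import Relation.Nullary.Decidable using (does; map′; toSum; _×-dec_; _→-dec_; ¬?)
open import Relation.Unary using (Decidable)

-- All coefficients are computed in ℕ: both sides of the identity are images of ℕ-valued functions
-- of the exponent, so it suffices to prove an equality of natural numbers, before any reduction
-- modulo `l`. Sums over residues are needed in ℕ and in the quotient ring, hence over a general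
-- semiring. Of the quadratic residues only this is used: a group of units containing exactly one of
-- x and -x for each unit x. The count follows from that by elementary double counting, without
-- character sums. The factor pᵃqᵇ arises because c matters modulo p ^ (a + 1) q ^ (b + 1), which
-- holds pᵃqᵇ periods of length pq. The two cases differ in one sign. If q divides c, then p ^ i q ^
-- j c belongs to a coset of index m > j, with c = q ^ e u and e = m - j. Passing from u to c
-- exchanges P and -P exactly when q ^ e is not in P: never for a residue q, and for odd e when q is
-- a nonresidue.

-- Congruences between integers.

module Congruences where

  open import Data.Integer.Base using (+_; _+_; _*_; _-_; -_; _^_; ∣_∣)
  open ℤ∣ using (_∣_; divides; _∣?_; ∣-trans)

  infix 4 _≈_⟨_⟩ _≈?_⟨_⟩

  -- Congruence as a record, so that its sides can be inferred.
  _≈_⟨_⟩ : ℤ → ℤ → ℕ → Set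
  x ≈ y ⟨ m ⟩ = Congruent ℤₚ.+-*-commutativeRing (+ m) x y

  module Mod {m : ℕ} = CommutativeRing (ℤ/ m)

  fromMod : ∀ {m} x y → x ≡ y [mod m ] → x ≈ y ⟨ m ⟩
  fromMod x y (divides k eq) = congruent k (≡.sym eq)

  toMod : ∀ {m x y} → x ≈ y ⟨ m ⟩ → x ≡ y [mod m ]
  toMod (congruent k eq) = divides k (≡.sym eq)

  _≈?_⟨_⟩ : ∀ x y m → Dec (x ≈ y ⟨ m ⟩)
  x ≈? y ⟨ m ⟩ = map′ (fromMod x y) toMod (+ m ∣? x - y)

  ∣⇒≈0 : ∀ {m x} → + m ∣ x → x ≈ 0ℤ ⟨ m ⟩
  ∣⇒≈0 {m} {x} (divides k eq) = congruent k (≡.trans (≡.sym eq) (≡.sym (ℤₚ.+-identityʳ x)))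

  ≈0⇒∣ : ∀ {m x} → x ≈ 0ℤ ⟨ m ⟩ → + m ∣ x
  ≈0⇒∣ {m} {x} (congruent k eq) = divides k (≡.trans (≡.sym (ℤₚ.+-identityʳ x)) (≡.sym eq))

  ≈⇒-≈0 : ∀ {m x y} → x ≈ y ⟨ m ⟩ → x - y ≈ 0ℤ ⟨ m ⟩
  ≈⇒-≈0 x≈y = ∣⇒≈0 (toMod x≈y)

  -≈0⇒≈ : ∀ {m x y} → x - y ≈ 0ℤ ⟨ m ⟩ → x ≈ y ⟨ m ⟩
  -≈0⇒≈ x-y≈0 = fromMod _ _ (≈0⇒∣ x-y≈0)

  n*b+a≈a : ∀ n b a → + n * b + a ≈ a ⟨ n ⟩
  n*b+a≈a n b a = congruent b (identity (+ n) b a)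
    where
    identity : ∀ n b a → b * n ≡ n * b + a - a
    identity = ℤ-Solver.solve-∀

  coarsen : ∀ {m n x y} → m ℕ∣.∣ n → x ≈ y ⟨ n ⟩ → x ≈ y ⟨ m ⟩
  coarsen {m} {n} {x} {y} m∣n x≈y = fromMod x y (∣-trans (∣ᵤ⇒∣ m∣n) (toMod x≈y))

  ^-cong : ∀ {m x y} k → x ≈ y ⟨ m ⟩ → x ^ k ≈ y ^ k ⟨ m ⟩
  ^-cong zero    x≈y = Mod.refl
  ^-cong (suc k) x≈y = Mod.*-cong x≈y (^-cong k x≈y)

  ≈1-^ : ∀ {m x} k → x ≈ 1ℤ ⟨ m ⟩ → x ^ k ≈ 1ℤ ⟨ m ⟩
  ≈1-^ k x≈1 = Mod.trans (^-cong k x≈1) (Mod.reflexive (ℤₚ.^-zeroˡ k))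

  scale : ∀ {m x y} d → x ≈ y ⟨ m ⟩ → + d * x ≈ + d * y ⟨ d ℕ.* m ⟩
  scale {m} {x} {y} d (congruent k eq) = congruent k (begin
    k * + (d ℕ.* m)     ≡⟨ cong (k *_) (ℤₚ.pos-* d m) ⟩
    k * (+ d * + m)     ≡⟨ swap k (+ d) (+ m) ⟩
    + d * (k * + m)     ≡⟨ cong (+ d *_) eq ⟩
    + d * (x - y)       ≡⟨ distrib (+ d) x y ⟩
    + d * x - + d * y   ∎)
    where
    open ≡.≡-Reasoning
    swap : ∀ a b c → a * (b * c) ≡ b * (a * c)
    swap = ℤ-Solver.solve-∀
    distrib : ∀ a b c → a * (b - c) ≡ a * b - a * c
    distrib = ℤ-Solver.solve-∀

  unscale : ∀ {m x y} d .{{_ : NonZero d}} → + d * x ≈ + d * y ⟨ d ℕ.* m ⟩ → x ≈ y ⟨ m ⟩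
  unscale {m} {x} {y} d@(suc _) (congruent k eq) = congruent k (ℤₚ.*-cancelˡ-≡ (+ d) _ _ (begin
    + d * (k * + m)     ≡⟨ swap (+ d) k (+ m) ⟩
    k * (+ d * + m)     ≡⟨ cong (k *_) (ℤₚ.pos-* d m) ⟨
    k * + (d ℕ.* m)     ≡⟨ eq ⟩
    + d * x - + d * y   ≡⟨ distrib (+ d) x y ⟨
    + d * (x - y)       ∎))
    where
    open ≡.≡-Reasoning
    swap : ∀ a b c → a * (b * c) ≡ b * (a * c)
    swap = ℤ-Solver.solve-∀
    distrib : ∀ a b c → a * (b - c) ≡ a * b - a * c
    distrib = ℤ-Solver.solve-∀

  %ℕ-≈ : ∀ x n .{{_ : NonZero n}} → x ≈ + (x %ℕ n) ⟨ n ⟩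
  %ℕ-≈ x n = congruent (x /ℕ n) (≡.sym (begin
    x - + (x %ℕ n)                                      ≡⟨ cong (_- + (x %ℕ n)) (a≡a%ℕn+[a/ℕn]*n x n) ⟩
    (+ (x %ℕ n) + (x /ℕ n) * + n) - + (x %ℕ n)          ≡⟨ cancel (+ (x %ℕ n)) ((x /ℕ n) * + n) ⟩
    (x /ℕ n) * + n                                      ∎))
    where
    open ≡.≡-Reasoning
    cancel : ∀ a b → (a + b) - a ≡ b
    cancel = ℤ-Solver.solve-∀

  ≈⇒≡ : ∀ {n a b} → a ℕ.< n → b ℕ.< n → + a ≈ + b ⟨ n ⟩ → a ≡ b
  ≈⇒≡ {n} {a} {b} a<n b<n a≈b =
    ℤₚ.+-injective (ℤₚ.i-j≡0⇒i≡j (+ a) (+ b) (ℤₚ.∣i∣≡0⇒i≡0 (vanishes _ n∣ ∣a-b∣<n)))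
    where
    n∣ : n ℕ∣.∣ ∣ + a - + b ∣
    n∣ = ∣⇒∣ᵤ (toMod a≈b)

    ∣a-b∣<n : ∣ + a - + b ∣ ℕ.< n
    ∣a-b∣<n = subst (λ z → ∣ z ∣ ℕ.< n) (≡.sym (ℤₚ.[+m]-[+n]≡m⊖n a b))
      (ℕₚ.≤-<-trans (ℤₚ.∣m⊝n∣≤m⊔n a b) (ℕₚ.⊔-lub a<n b<n))

    vanishes : ∀ d → n ℕ∣.∣ d → d ℕ.< n → d ≡ 0
    vanishes zero    _   _   = ≡.refl
    vanishes (suc d) n∣d d<n = ⊥-elim (ℕ∣.>⇒∤ d<n n∣d)

-- Sums over complete residue systems in a commutative semiring.

module ResidueSums {c ℓ : Level} (S : CommutativeSemiring c ℓ) where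

  open Congruences
  open import Data.Integer.Base using (+_)
  open CommutativeSemiring S
  open import Algebra.Properties.Semiring.Sum semiring public
  open import Relation.Binary.Reasoning.Setoid setoid

  opaque

    -- The Iverson bracket, opaque so that comparing goals does not evaluate a decision procedure.
    ⟦_⟧ : ∀ {a} {A : Set a} → Dec A → Carrier
    ⟦ d ⟧ = if does d then 1# else 0#

    ⟦⟧-yes : ∀ {a} {A : Set a} (d : Dec A) → A → ⟦ d ⟧ ≡ 1#
    ⟦⟧-yes (yes _) _ = ≡.refl
    ⟦⟧-yes (no ¬a) a = contradiction a ¬a

    ⟦⟧-no : ∀ {a} {A : Set a} (d : Dec A) → ¬ A → ⟦ d ⟧ ≡ 0#
    ⟦⟧-no (yes a) ¬a = contradiction a ¬a
    ⟦⟧-no (no _)  _  = ≡.refl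

  ⟦⟧-cong : ∀ {a b} {A : Set a} {B : Set b} (d : Dec A) (e : Dec B) →
            (A → B) → (B → A) → ⟦ d ⟧ ≡ ⟦ e ⟧
  ⟦⟧-cong d@(yes a) e f g = ≡.trans (⟦⟧-yes d a) (≡.sym (⟦⟧-yes e (f a)))
  ⟦⟧-cong d@(no ¬a) e f g = ≡.trans (⟦⟧-no d ¬a) (≡.sym (⟦⟧-no e (¬a ∘ g)))

  opaque

    -- The summand is defined on all of ℤ, so that shifts, multiples and negatives of the variable
    -- are plain integer operations; `Periodic` says that only the residue matters.
    Σ : ℕ → (ℤ → Carrier) → Carrier
    Σ n F = sum {n} (λ k → F (+ toℕ k))

    Σ-cong : ∀ n {F G : ℤ → Carrier} → (∀ x → F x ≈ G x) → Σ n F ≈ Σ n G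
    Σ-cong n F≈G = sum-cong-≋ {n} (λ k → F≈G (+ toℕ k))

    Σ-+ : ∀ n (F G : ℤ → Carrier) → Σ n (λ x → F x + G x) ≈ Σ n F + Σ n G
    Σ-+ n F G = ∑-distrib-+ {n} _ _

    Σ-*ˡ : ∀ n a (F : ℤ → Carrier) → Σ n (λ x → a * F x) ≈ a * Σ n F
    Σ-*ˡ n a F = sym (*-distribˡ-sum {n} a _)

    Σ-*ʳ : ∀ n a (F : ℤ → Carrier) → Σ n (λ x → F x * a) ≈ Σ n F * a
    Σ-*ʳ n a F = sym (*-distribʳ-sum {n} a _)

    Σ-comm : ∀ m n (F : ℤ → ℤ → Carrier) → Σ m (λ x → Σ n (F x)) ≈ Σ n (λ y → Σ m (λ x → F x y))
    Σ-comm m n F = ∑-comm {m} {n} (λ i j → F (+ toℕ i) (+ toℕ j))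

    Σ-0 : ∀ n {F : ℤ → Carrier} → (∀ x → F x ≈ 0#) → Σ n F ≈ 0#
    Σ-0 n F≈0 = trans (Σ-cong n F≈0) (sum-replicate-zero n)

    Σ-def : ∀ n F → Σ n F ≡ sum {n} (λ k → F (+ toℕ k))
    Σ-def n F = ≡.refl

  sum-single : ∀ {n} (f : Fin n → Carrier) k → (∀ j → j ≢ k → f j ≈ 0#) → sum f ≈ f k
  sum-single {suc n} f k f≈0 = begin
    sum f                        ≈⟨ sum-remove {i = k} f ⟩
    f k + sum (f ∘ punchIn k)    ≈⟨ +-congˡ (sum-cong-≋ (λ j → f≈0 (punchIn k j) (Finₚ.punchInᵢ≢i k j))) ⟩
    f k + sum {n} (λ _ → 0#)     ≈⟨ +-congˡ (sum-replicate-zero n) ⟩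
    f k + 0#                     ≈⟨ +-identityʳ (f k) ⟩
    f k                          ∎

  Periodic : ℕ → (ℤ → Carrier) → Set _
  Periodic n F = ∀ {x y} → x ≈ y ⟨ n ⟩ → F x ≈ F y

  -- Only the representative of `x` among 0, ..., n - 1 contributes, and periodicity carries `F`
  -- from there to `x`. Expanding a value in this way turns a change of variable into an exchange of
  -- sums.
  Σ-δ : ∀ n .{{_ : NonZero n}} {F} → Periodic n F → ∀ x → Σ n (λ y → ⟦ y ≈? x ⟨ n ⟩ ⟧ * F y) ≈ F x
  Σ-δ n {F} per x = begin
    Σ n (λ y → ⟦ y ≈? x ⟨ n ⟩ ⟧ * F y) ≡⟨ Σ-def n _ ⟩
    sum {n} f                          ≈⟨ sum-single f r off ⟩
    ⟦ r′ ≈? x ⟨ n ⟩ ⟧ * F r′           ≈⟨ *-congʳ (reflexive (⟦⟧-yes (r′ ≈? x ⟨ n ⟩) (Mod.sym x≈r))) ⟩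
    1# * F r′                          ≈⟨ *-identityˡ (F r′) ⟩
    F r′                               ≈⟨ per (Mod.sym x≈r) ⟩
    F x                                ∎
    where
    f : Fin n → Carrier
    f k = ⟦ + toℕ k ≈? x ⟨ n ⟩ ⟧ * F (+ toℕ k)
    r : Fin n
    r = fromℕ< (n%ℕd<d x n)
    r′ = + toℕ r
    x≈r : x ≈ r′ ⟨ n ⟩
    x≈r = ≡.subst (λ k → x ≈ + k ⟨ n ⟩) (≡.sym (Finₚ.toℕ-fromℕ< (n%ℕd<d x n))) (%ℕ-≈ x n)
    off : ∀ k → k ≢ r → f k ≈ 0#
    off k k≢r = trans
      (*-congʳ (reflexive (⟦⟧-no (+ toℕ k ≈? x ⟨ n ⟩)
        (λ k≈x → k≢r (Finₚ.toℕ-injective (≈⇒≡ (Finₚ.toℕ<n k) (Finₚ.toℕ<n r) (Mod.trans k≈x x≈r)))))))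
      (zeroˡ _)

  Σ-≈? : ∀ n .{{_ : NonZero n}} x → Σ n (λ y → ⟦ y ≈? x ⟨ n ⟩ ⟧) ≈ 1#
  Σ-≈? n x = trans (Σ-cong n (λ y → sym (*-identityʳ _))) (Σ-δ n (λ _ → refl) x)

  -- Expand F (π x) over the residues and exchange the two sums.
  Σ-reindex : ∀ n .{{_ : NonZero n}} {F} → Periodic n F → (π π⁻¹ : ℤ → ℤ) →
              (∀ x y → y ≈ π x ⟨ n ⟩ → x ≈ π⁻¹ y ⟨ n ⟩) → (∀ x y → x ≈ π⁻¹ y ⟨ n ⟩ → y ≈ π x ⟨ n ⟩) →
              Σ n (F ∘ π) ≈ Σ n F
  Σ-reindex n {F} per π π⁻¹ to from = begin
    Σ n (F ∘ π)                                           ≈⟨ Σ-cong n (λ x → sym (Σ-δ n per (π x))) ⟩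
    Σ n (λ x → Σ n (λ y → ⟦ y ≈? π x ⟨ n ⟩ ⟧ * F y))      ≈⟨ Σ-comm n n (λ x y → ⟦ y ≈? π x ⟨ n ⟩ ⟧ * F y) ⟩
    Σ n (λ y → Σ n (λ x → ⟦ y ≈? π x ⟨ n ⟩ ⟧ * F y))
      ≈⟨ Σ-cong n (λ y → Σ-cong n (λ x → *-congʳ (reflexive (⟦⟧-cong _ (x ≈? π⁻¹ y ⟨ n ⟩) (to x y) (from x y))))) ⟩
    Σ n (λ y → Σ n (λ x → ⟦ x ≈? π⁻¹ y ⟨ n ⟩ ⟧ * F y))
      ≈⟨ Σ-cong n (λ y → Σ-δ n {λ _ → F y} (λ _ → refl) (π⁻¹ y)) ⟩
    Σ n F                                                 ∎

  Σ-shift : ∀ n .{{_ : NonZero n}} {F} → Periodic n F → ∀ a → Σ n (λ x → F (x ℤ.+ a)) ≈ Σ n F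
  Σ-shift n per a = Σ-reindex n per (ℤ._+ a) (ℤ._- a)
    (λ x y y≈ → Mod.trans (Mod.reflexive (cancel x a)) (Mod.+-congʳ {x = ℤ.- a} (Mod.sym y≈)))
    (λ x y x≈ → Mod.trans (Mod.reflexive (uncancel y a)) (Mod.+-congʳ {x = a} (Mod.sym x≈)))
    where
    cancel : ∀ x a → x ≡ x ℤ.+ a ℤ.- a
    cancel = ℤ-Solver.solve-∀
    uncancel : ∀ x a → x ≡ x ℤ.- a ℤ.+ a
    uncancel = ℤ-Solver.solve-∀

  Σ-scale : ∀ n .{{_ : NonZero n}} {F} → Periodic n F → ∀ a b → a ℤ.* b ≈ ℤ.1ℤ ⟨ n ⟩ →
            Σ n (λ x → F (a ℤ.* x)) ≈ Σ n F
  Σ-scale n per a b ab≈1 = Σ-reindex n per (a ℤ.*_) (b ℤ.*_)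
    (λ x y y≈ → Mod.trans (Mod.sym (absorb {b} {a} ba≈1 x)) (Mod.*-congˡ {x = b} (Mod.sym y≈)))
    (λ x y x≈ → Mod.trans (Mod.sym (absorb {a} {b} ab≈1 y)) (Mod.*-congˡ {x = a} (Mod.sym x≈)))
    where
    ba≈1 : b ℤ.* a ≈ ℤ.1ℤ ⟨ n ⟩
    ba≈1 = Mod.trans (Mod.reflexive (ℤₚ.*-comm b a)) ab≈1
    absorb : ∀ {a b} → a ℤ.* b ≈ ℤ.1ℤ ⟨ n ⟩ → ∀ x → a ℤ.* (b ℤ.* x) ≈ x ⟨ n ⟩
    absorb {a} {b} ab≈1 x = Mod.trans (Mod.reflexive (≡.sym (ℤₚ.*-assoc a b x)))
      (Mod.trans (Mod.*-congʳ {x = x} ab≈1) (Mod.*-identityˡ x))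

  Σ-neg : ∀ n .{{_ : NonZero n}} {F} → Periodic n F → Σ n (λ x → F (ℤ.- x)) ≈ Σ n F
  Σ-neg n {F} per = trans
    (Σ-cong n (λ x → reflexive (cong F (≡.sym (ℤₚ.-1*i≡-i x)))))
    (Σ-scale n per ℤ.-1ℤ ℤ.-1ℤ Mod.refl)

  sum-++ : ∀ m {n} (f : ℕ → Carrier) →
           sum {m ℕ.+ n} (f ∘ toℕ) ≈ sum {m} (f ∘ toℕ) + sum {n} (λ k → f (m ℕ.+ toℕ k))
  sum-++ zero    f = sym (+-identityˡ _)
  sum-++ (suc m) {n} f = trans (+-congˡ (sum-++ m {n} (f ∘ suc))) (sym (+-assoc _ _ _))

  opaque
    unfolding Σ

    Σ-blocks : ∀ m n (F : ℤ → Carrier) →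
               Σ (m ℕ.* n) F ≈ Σ m (λ b → Σ n (λ a → F (+ n ℤ.* b ℤ.+ a)))
    Σ-blocks m n F = trans (blocks m (F ∘ +_)) (sum-cong-≋ {m} λ b → sum-cong-≋ {n} λ a → reflexive (cong F
      (≡.trans (ℤₚ.pos-+ (toℕ b ℕ.* n) (toℕ a))
        (cong (ℤ._+ + toℕ a) (≡.trans (ℤₚ.pos-* (toℕ b) n) (ℤₚ.*-comm (+ toℕ b) (+ n)))))))
      where
      blocks : ∀ m (f : ℕ → Carrier) →
               sum {m ℕ.* n} (f ∘ toℕ) ≈ sum {m} (λ b → sum {n} (λ a → f (toℕ b ℕ.* n ℕ.+ toℕ a)))
      blocks zero    f = refl
      blocks (suc m) f = begin
        sum {n ℕ.+ m ℕ.* n} (f ∘ toℕ)                                  ≈⟨ sum-++ n {m ℕ.* n} f ⟩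
        sum {n} (f ∘ toℕ) + sum {m ℕ.* n} (λ k → f (n ℕ.+ toℕ k))      ≈⟨ +-congˡ (blocks m (f ∘ (n ℕ.+_))) ⟩
        sum {n} (f ∘ toℕ) + sum {m} (λ b → sum {n} (λ a → f (n ℕ.+ (toℕ b ℕ.* n ℕ.+ toℕ a))))
          ≈⟨ +-congˡ (sum-cong-≋ {m} λ b → sum-cong-≋ {n} λ a → reflexive (cong f (≡.sym (ℕₚ.+-assoc n (toℕ b ℕ.* n) (toℕ a))))) ⟩
        sum {n} (f ∘ toℕ) + sum {m} (λ b → sum {n} (λ a → f (n ℕ.+ toℕ b ℕ.* n ℕ.+ toℕ a)))  ∎
  
  -- Write the variable as `n * b + a`. Then `G` sees only `a`, and for fixed `a` the values
  -- `n * b + a` run through all residues modulo `m`, because `n` is invertible there.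
  Σ-CRT : ∀ m n .{{_ : NonZero m}} {F G} → Periodic m F → Periodic n G →
          ∀ n⁻¹ → + n ℤ.* n⁻¹ ≈ ℤ.1ℤ ⟨ m ⟩ →
          Σ (m ℕ.* n) (λ x → F x * G x) ≈ Σ m F * Σ n G
  Σ-CRT m n {F} {G} perF perG n⁻¹ nn⁻¹≈1 = begin
    Σ (m ℕ.* n) (λ x → F x * G x)
      ≈⟨ Σ-blocks m n (λ x → F x * G x) ⟩
    Σ m (λ b → Σ n (λ a → F (+ n ℤ.* b ℤ.+ a) * G (+ n ℤ.* b ℤ.+ a)))
      ≈⟨ Σ-cong m (λ b → Σ-cong n (λ a → *-congˡ (perG (n*b+a≈a n b a)))) ⟩
    Σ m (λ b → Σ n (λ a → F (+ n ℤ.* b ℤ.+ a) * G a))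
      ≈⟨ Σ-comm m n (λ b a → F (+ n ℤ.* b ℤ.+ a) * G a) ⟩
    Σ n (λ a → Σ m (λ b → F (+ n ℤ.* b ℤ.+ a) * G a))
      ≈⟨ Σ-cong n (λ a → Σ-*ʳ m (G a) (λ b → F (+ n ℤ.* b ℤ.+ a))) ⟩
    Σ n (λ a → Σ m (λ b → F (+ n ℤ.* b ℤ.+ a)) * G a)
      ≈⟨ Σ-cong n (λ a → *-congʳ (trans (Σ-scale m {λ x → F (x ℤ.+ a)} (λ e → perF (Mod.+-congʳ {x =
        a} e)) (+ n) n⁻¹ nn⁻¹≈1) (Σ-shift m perF a))) ⟩
    Σ n (λ a → Σ m F * G a)
      ≈⟨ Σ-*ˡ n (Σ m F) G ⟩
    Σ m F * Σ n G ∎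

  opaque
    unfolding ⟦_⟧

    ∑-filter : ∀ {A : Set} {P : A → Set} (P? : Decidable P) (f : A → Carrier) xs →
               foldr _+_ 0# (map f (filter P? xs)) ≈ foldr _+_ 0# (map (λ x → ⟦ P? x ⟧ * f x) xs)
    ∑-filter P? f []       = refl
    ∑-filter P? f (x ∷ xs) with P? x
    ... | yes _ = +-cong (sym (*-identityˡ _)) (∑-filter P? f xs)
    ... | no _  = trans (∑-filter P? f xs) (trans (sym (+-identityˡ _)) (+-congʳ (sym (zeroˡ _))))

  ∑-tabulate : ∀ {A : Set} {n} (h : Fin n → A) (f : A → Carrier) →
               foldr _+_ 0# (map f (tabulate h)) ≡ sum (f ∘ h)
  ∑-tabulate {n = zero}  h f = ≡.refl
  ∑-tabulate {n = suc n} h f = cong (_+_ (f (h Fin.zero))) (∑-tabulate (h ∘ Fin.suc) f)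

  ∑-applyUpTo : ∀ (h : ℕ → ℕ) (f : ℕ → Carrier) n →
                foldr _+_ 0# (map f (applyUpTo h n)) ≡ sum {n} (λ k → f (h (toℕ k)))
  ∑-applyUpTo h f zero    = ≡.refl
  ∑-applyUpTo h f (suc n) = cong (_+_ (f (h 0))) (∑-applyUpTo (h ∘ suc) f n)

-- Counting in ℕ, and sums of two elements of a half system.

module Counting where

  open Congruences
  open import Data.Fin.Base using (zero; suc)
  open ResidueSums ℕₚ.+-*-commutativeSemiring public
  open import Data.Nat.Base using (_+_; _*_; _≤_)
  open ≡ using (refl; sym; trans)
  open ≡.≡-Reasoning

  Σ-const : ∀ n c → Σ n (λ _ → c) ≡ n * c
  Σ-const n c = trans (Σ-def n (λ _ → c)) (constant n)
    where
    constant : ∀ n → sum {n} (λ _ → c) ≡ n * c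
    constant zero    = refl
    constant (suc n) = cong (c +_) (constant n)

  Σ-1 : ∀ n → Σ n (λ _ → 1) ≡ n
  Σ-1 n = trans (Σ-const n 1) (ℕₚ.*-identityʳ n)

  Σ-periodic : ∀ k n .{{_ : NonZero n}} {F} → Periodic n F → Σ (k * n) F ≡ k * Σ n F
  Σ-periodic k n {F} per = begin
    Σ (k * n) F                                      ≡⟨ Σ-blocks k n F ⟩
    Σ k (λ b → Σ n (λ a → F (ℤ.+ n ℤ.* b ℤ.+ a)))
      ≡⟨ Σ-cong k (λ b → Σ-cong n (λ a → per (n*b+a≈a n b a))) ⟩
    Σ k (λ _ → Σ n F)                                ≡⟨ Σ-const k (Σ n F) ⟩
    k * Σ n F                                        ∎

  sum-mono : ∀ {n} {f g : Fin n → ℕ} → (∀ k → f k ≤ g k) → sum f ≤ sum g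
  sum-mono {zero}  f≤g = ℕ.z≤n
  sum-mono {suc n} f≤g = ℕₚ.+-mono-≤ (f≤g zero) (sum-mono (f≤g ∘ suc))

  sum-≤-tight : ∀ {n} {f g : Fin n → ℕ} → (∀ k → f k ≤ g k) → sum f ≡ sum g → ∀ k → f k ≡ g k
  sum-≤-tight {suc n} {f} {g} f≤g eq = λ
    { zero    → head≡
    ; (suc k) → sum-≤-tight (f≤g ∘ suc)
                  (ℕₚ.+-cancelˡ-≡ (f zero) _ _ (trans eq (cong (_+ sum (g ∘ suc)) (sym head≡)))) k
    }
    where
    head≡ : f zero ≡ g zero
    head≡ = ℕₚ.≤-antisym (f≤g zero) (ℕₚ.+-cancelʳ-≤ (sum (f ∘ suc)) _ _
      (subst (g zero + sum (f ∘ suc) ≤_) (sym eq) (ℕₚ.+-monoʳ-≤ (g zero) (sum-mono (f≤g ∘ suc)))))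

  -- The properties of the quadratic residues modulo a prime p ≡ 3 (mod 4)
  -- that determine the number of ways to write c as a sum of two of them.
  record HalfSystem (p : ℕ) (P : ℤ → Set) : Set where
    field
      P?      : ∀ x → Dec (P x)
      P-resp  : ∀ {x y} → x ≈ y ⟨ p ⟩ → P x → P y
      P-1     : P 1ℤ
      P-*     : ∀ {x y} → P x → P y → P (x ℤ.* y)
      P-inv   : ∀ {x} → P x → ∃ λ y → P y × x ℤ.* y ≈ 1ℤ ⟨ p ⟩
      P-split : ∀ {x} → ¬ (x ≈ 0ℤ ⟨ p ⟩) → P x ⊎ P (ℤ.- x)
      P-asym  : ∀ {x} → P x → ¬ P (ℤ.- x)

    -- Zero is its own negative, which `P-asym` forbids to a member of `P`.
    P-≉0 : ∀ {x} → P x → ¬ (x ≈ 0ℤ ⟨ p ⟩)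
    P-≉0 {x} Px x≈0 = P-asym Px (P-resp (Mod.trans x≈0 (Mod.sym (Mod.-‿cong x≈0))) Px)

    P-cancelˡ : ∀ {x y} → P x → P (x ℤ.* y) → P y
    P-cancelˡ {x} {y} Px Pxy with z , Pz , xz≈1 ← P-inv Px =
      P-resp (Mod.trans (Mod.reflexive (rearrange x y z)) (Mod.trans (Mod.*-congʳ {x = y} xz≈1) (Mod.*-identityˡ y)))
        (P-* Pz Pxy)
      where
      rearrange : ∀ x y z → z ℤ.* (x ℤ.* y) ≡ (x ℤ.* z) ℤ.* y
      rearrange = ℤ-Solver.solve-∀

    module _ .{{_ : NonZero p}} where

      private
        π : ℤ → ℕ
        π x = ⟦ P? x ⟧

        π-1 : ∀ {x} → P x → π x ≡ 1
        π-1 {x} = ⟦⟧-yes (P? x)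

        π-0 : ∀ {x} → ¬ P x → π x ≡ 0
        π-0 {x} = ⟦⟧-no (P? x)

        π-resp : Periodic p π
        π-resp x≈y = ⟦⟧-cong _ _ (P-resp x≈y) (P-resp (Mod.sym x≈y))

        π-≡ : ∀ {x y} → x ≡ y → π x ≡ π y
        π-≡ = cong π

        π-split : ∀ {x} → ¬ (x ≈ 0ℤ ⟨ p ⟩) → π x + π (ℤ.- x) ≡ 1
        π-split x≉0 with P-split x≉0
        ... | inj₁ Px  = cong₂ _+_ (π-1 Px) (π-0 (P-asym Px))
        ... | inj₂ P-x = cong₂ _+_ (π-0 (λ Px → P-asym Px P-x)) (π-1 P-x)

        π-scale : ∀ {v} → P v → ∀ x → π (v ℤ.* x) ≡ π x
        π-scale Pv x = ⟦⟧-cong _ _ (P-cancelˡ Pv) (P-* Pv)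

        neg-swap : ∀ x y → ℤ.- (x ℤ.- y) ≡ y ℤ.- x
        neg-swap = ℤ-Solver.solve-∀

        H : ℕ
        H = Σ p π

      sums : ℤ → ℕ
      sums c = Σ p (λ x → π x * π (c ℤ.- x))

      private
        differences : ℤ → ℕ
        differences c = Σ p (λ x → π x * π (x ℤ.- c))

        -- Substituting `v * x` for `x` permutes the residues, and a factor `v` from `P` does not
        -- affect membership in `P`. The map `f c x` will be `c - x` or `x - c`.
        rescale : ∀ (f : ℤ → ℤ → ℤ) → (∀ {x y c} → x ≈ y ⟨ p ⟩ → f c x ≈ f c y ⟨ p ⟩) →
                  (∀ v c x → f (v ℤ.* c) (v ℤ.* x) ≡ v ℤ.* f c x) →
                  ∀ {v} → P v → ∀ c →
                  Σ p (λ x → π x * π (f (v ℤ.* c) x)) ≡ Σ p (λ x → π x * π (f c x))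
        rescale f f-cong f-hom {v} Pv c with w , _ , vw≈1 ← P-inv Pv = begin
          Σ p (λ x → π x * π (f (v ℤ.* c) x))
            ≡⟨ Σ-scale p (λ x≈y → cong₂ _*_ (π-resp x≈y) (π-resp (f-cong x≈y))) v w vw≈1 ⟨
          Σ p (λ x → π (v ℤ.* x) * π (f (v ℤ.* c) (v ℤ.* x)))
            ≡⟨ Σ-cong p (λ x → cong₂ _*_ (π-scale Pv x) (trans (π-≡ (f-hom v c x)) (π-scale Pv (f c x)))) ⟩
          Σ p (λ x → π x * π (f c x)) ∎

        sums-scale : ∀ {v} → P v → ∀ c → sums (v ℤ.* c) ≡ sums c
        sums-scale = rescale (λ c x → c ℤ.- x) (λ {_} {_} {c} x≈y → Mod.+-congˡ {x = c} (Mod.-‿cong x≈y)) distrib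
          where
          distrib : ∀ v c x → v ℤ.* c ℤ.- v ℤ.* x ≡ v ℤ.* (c ℤ.- x)
          distrib = ℤ-Solver.solve-∀

        differences-scale : ∀ {v} → P v → ∀ c → differences (v ℤ.* c) ≡ differences c
        differences-scale = rescale (λ c x → x ℤ.- c) (λ {_} {_} {c} x≈y → Mod.+-congʳ {x = ℤ.- c} x≈y) distrib
          where
          distrib : ∀ v c x → v ℤ.* x ℤ.- v ℤ.* c ≡ v ℤ.* (x ℤ.- c)
          distrib = ℤ-Solver.solve-∀

        on-P : ∀ (F : ℤ → ℕ) → (∀ {x} → P x → F x ≡ F 1ℤ) → Σ p (λ x → π x * F x) ≡ H * F 1ℤ
        on-P F const = trans (Σ-cong p pointwise) (Σ-*ʳ p (F 1ℤ) π)
          where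
          pointwise : ∀ x → π x * F x ≡ π x * F 1ℤ
          pointwise x with toSum (P? x)
          ... | inj₁ Px = cong (π x *_) (const Px)
          ... | inj₂ ¬Px = trans (cong (_* F x) (π-0 ¬Px)) (sym (cong (_* F 1ℤ) (π-0 ¬Px)))

        at-1 : ∀ (F : ℤ → ℕ) → (∀ {v} → P v → ∀ c → F (v ℤ.* c) ≡ F c) → ∀ {x} → P x → F x ≡ F 1ℤ
        at-1 F inv {x} Px = trans (cong F (sym (ℤₚ.*-identityʳ x))) (inv Px 1ℤ)

        -- Both sides count the triples (x, y, x - y) in P³.
        H*sums≡H*differences : H * sums 1ℤ ≡ H * differences 1ℤ
        H*sums≡H*differences = begin
          H * sums 1ℤ                                              ≡⟨ on-P sums (at-1 sums sums-scale) ⟨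
          Σ p (λ x → π x * sums x)                                 ≡⟨ Σ-cong p (λ x → Σ-*ˡ p (π x) _) ⟨
          Σ p (λ x → Σ p (λ y → π x * (π y * π (x ℤ.- y))))        ≡⟨ Σ-comm p p _ ⟩
          Σ p (λ y → Σ p (λ x → π x * (π y * π (x ℤ.- y))))
            ≡⟨ Σ-cong p (λ y → trans (Σ-cong p (λ x → swap (π x) (π y) _)) (Σ-*ˡ p (π y) _)) ⟩
          Σ p (λ y → π y * differences y)
            ≡⟨ on-P differences (at-1 differences differences-scale) ⟩
          H * differences 1ℤ                                       ∎
          where
          swap : ∀ a b c → a * (b * c) ≡ b * (a * c)
          swap = solve-∀

        -- Every residue is counted once: in `P`, in the negative of `P`, or as zero.
        H+H+1≡p : H + H + 1 ≡ p
        H+H+1≡p = begin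
          H + H + 1
            ≡⟨ cong₂ _+_ (cong (H +_) (sym (Σ-neg p π-resp))) (sym (Σ-≈? p 0ℤ)) ⟩
          H + Σ p (λ x → π (ℤ.- x)) + Σ p (λ x → ⟦ x ≈? 0ℤ ⟨ p ⟩ ⟧)
            ≡⟨ cong (_+ _) (sym (Σ-+ p π _)) ⟩
          Σ p (λ x → π x + π (ℤ.- x)) + Σ p (λ x → ⟦ x ≈? 0ℤ ⟨ p ⟩ ⟧)
            ≡⟨ sym (Σ-+ p _ _) ⟩
          Σ p (λ x → π x + π (ℤ.- x) + ⟦ x ≈? 0ℤ ⟨ p ⟩ ⟧)
            ≡⟨ Σ-cong p trichotomy ⟩
          Σ p (λ _ → 1)
            ≡⟨ Σ-1 p ⟩
          p ∎
          where
          trichotomy : ∀ x → π x + π (ℤ.- x) + ⟦ x ≈? 0ℤ ⟨ p ⟩ ⟧ ≡ 1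
          trichotomy x with x ≈? 0ℤ ⟨ p ⟩
          ... | yes x≈0 = cong₂ _+_ (cong₂ _+_ (π-0 (λ Px → P-≉0 Px x≈0)) (π-0 (λ P-x → P-≉0 P-x (Mod.-‿cong x≈0))))
            (⟦⟧-yes (yes x≈0) x≈0)
          ... | no x≉0 = cong₂ _+_ (π-split x≉0) (⟦⟧-no (no x≉0) x≉0)

        instance
          H≢0 : NonZero H
          -- If `H` were 0, then `p` would be 1, and modulo 1 the member 1 of `P` vanishes.
          H≢0 = ℕ.≢-nonZero λ H≡0 → P-≉0 P-1
            (subst (1ℤ ≈ 0ℤ ⟨_⟩) (trans (sym (cong (λ h → h + h + 1) H≡0)) H+H+1≡p) (congruent 1ℤ refl))

        sums≡differences : sums 1ℤ ≡ differences 1ℤ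
        sums≡differences = ℕₚ.*-cancelˡ-≡ _ _ H H*sums≡H*differences

        -- A member `x` of `P` other than 1 has exactly one of `x - 1` and `1 - x` in `P`; the last
        -- bracket supplies the exception `x = 1`.
        H≡2a+1 : H ≡ differences 1ℤ + sums 1ℤ + 1
        H≡2a+1 = begin
          H
            ≡⟨ Σ-cong p cases ⟩
          Σ p (λ x → π x * π (x ℤ.- 1ℤ) + π x * π (1ℤ ℤ.- x) + ⟦ x ≈? 1ℤ ⟨ p ⟩ ⟧)
            ≡⟨ Σ-+ p _ _ ⟩
          Σ p (λ x → π x * π (x ℤ.- 1ℤ) + π x * π (1ℤ ℤ.- x)) + Σ p (λ x → ⟦ x ≈? 1ℤ ⟨ p ⟩ ⟧)
            ≡⟨ cong₂ _+_ (Σ-+ p _ _) (Σ-≈? p 1ℤ) ⟩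
          differences 1ℤ + sums 1ℤ + 1 ∎
          where
          cases : ∀ x → π x ≡ π x * π (x ℤ.- 1ℤ) + π x * π (1ℤ ℤ.- x) + ⟦ x ≈? 1ℤ ⟨ p ⟩ ⟧
          cases x with x ≈? 1ℤ ⟨ p ⟩
          ... | yes x≈1 = begin
            π x          ≡⟨ π-1 (P-resp (Mod.sym x≈1) P-1) ⟩
            1            ≡⟨ cong₂ _+_ (cong₂ _+_ (ℕₚ.*-zeroʳ (π x)) (ℕₚ.*-zeroʳ (π x))) (⟦⟧-yes (yes x≈1) x≈1) ⟨
            π x * 0 + π x * 0 + ⟦ yes x≈1 ⟧
              ≡⟨ cong (_+ ⟦ yes x≈1 ⟧) (cong₂ _+_ (cong (π x *_) (π-0 (λ Q → P-≉0 Q (≈⇒-≈0 x≈1))))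
                   (cong (π x *_) (π-0 (λ Q → P-≉0 Q (≈⇒-≈0 (Mod.sym x≈1)))))) ⟨
            π x * π (x ℤ.- 1ℤ) + π x * π (1ℤ ℤ.- x) + ⟦ yes x≈1 ⟧ ∎
          ... | no x≉1 = sym (begin
            π x * π (x ℤ.- 1ℤ) + π x * π (1ℤ ℤ.- x) + ⟦ no x≉1 ⟧    ≡⟨ cong (_ +_) (⟦⟧-no (no x≉1) x≉1) ⟩
            π x * π (x ℤ.- 1ℤ) + π x * π (1ℤ ℤ.- x) + 0             ≡⟨ ℕₚ.+-identityʳ _ ⟩
            π x * π (x ℤ.- 1ℤ) + π x * π (1ℤ ℤ.- x)                 ≡⟨ ℕₚ.*-distribˡ-+ (π x) _ _ ⟨
            π x * (π (x ℤ.- 1ℤ) + π (1ℤ ℤ.- x))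
              ≡⟨ cong (λ z → π x * (π (x ℤ.- 1ℤ) + z)) (π-≡ (sym (neg-swap x 1ℤ))) ⟩
            π x * (π (x ℤ.- 1ℤ) + π (ℤ.- (x ℤ.- 1ℤ)))               ≡⟨ cong (π x *_) (π-split (x≉1 ∘ -≈0⇒≈)) ⟩
            π x * 1                                                 ≡⟨ ℕₚ.*-identityʳ (π x) ⟩
            π x                                                     ∎)

        -- For `x` in `P` the number `x + 1` is nonzero, as -1 is not in `P`, so exactly one of
        -- `x + 1` and `-1 - x` lies in `P`. No `x` is exceptional here, which is why `sums -1ℤ`
        -- exceeds `sums 1ℤ` by one.
        H≡differences+sums : H ≡ differences 1ℤ + sums -1ℤ
        H≡differences+sums = begin
          H
            ≡⟨ Σ-cong p cases ⟩
          Σ p (λ x → π x * π (x ℤ.+ 1ℤ) + π x * π (-1ℤ ℤ.- x))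
            ≡⟨ Σ-+ p _ _ ⟩
          Σ p (λ x → π x * π (x ℤ.+ 1ℤ)) + sums -1ℤ
            ≡⟨ cong (_+ sums -1ℤ) (Σ-cong p shifted) ⟩
          Σ p (λ x → π (x ℤ.+ 1ℤ) * π (x ℤ.+ 1ℤ ℤ.- 1ℤ)) + sums -1ℤ
            ≡⟨ cong (_+ sums -1ℤ) (Σ-shift p (λ x≈y → cong₂ _*_ (π-resp x≈y) (π-resp (Mod.+-congʳ {x = -1ℤ} x≈y))) 1ℤ) ⟩
          differences 1ℤ + sums -1ℤ ∎
          where
          shifted : ∀ x → π x * π (x ℤ.+ 1ℤ) ≡ π (x ℤ.+ 1ℤ) * π (x ℤ.+ 1ℤ ℤ.- 1ℤ)
          shifted x = trans (ℕₚ.*-comm (π x) _) (cong (π (x ℤ.+ 1ℤ) *_) (π-≡ (identity x)))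
            where
            identity : ∀ x → x ≡ x ℤ.+ 1ℤ ℤ.- 1ℤ
            identity = ℤ-Solver.solve-∀

          opposite : ∀ x → -1ℤ ℤ.- x ≡ ℤ.- (x ℤ.+ 1ℤ)
          opposite = ℤ-Solver.solve-∀

          cases : ∀ x → π x ≡ π x * π (x ℤ.+ 1ℤ) + π x * π (-1ℤ ℤ.- x)
          cases x with toSum (P? x)
          ... | inj₂ ¬Px =
            trans (π-0 ¬Px) (sym (cong₂ _+_ (cong (_* π (x ℤ.+ 1ℤ)) (π-0 ¬Px)) (cong (_* π (-1ℤ ℤ.- x)) (π-0 ¬Px))))
          ... | inj₁ Px = sym (begin
            π x * π (x ℤ.+ 1ℤ) + π x * π (-1ℤ ℤ.- x)        ≡⟨ ℕₚ.*-distribˡ-+ (π x) _ _ ⟨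
            π x * (π (x ℤ.+ 1ℤ) + π (-1ℤ ℤ.- x))
              ≡⟨ cong (λ z → π x * (π (x ℤ.+ 1ℤ) + z)) (π-≡ (opposite x)) ⟩
            π x * (π (x ℤ.+ 1ℤ) + π (ℤ.- (x ℤ.+ 1ℤ)))       ≡⟨ cong (π x *_) (π-split x+1≉0) ⟩
            π x * 1                                         ≡⟨ ℕₚ.*-identityʳ (π x) ⟩
            π x                                             ∎)
            where
            x+1≉0 : ¬ (x ℤ.+ 1ℤ ≈ 0ℤ ⟨ p ⟩)
            x+1≉0 x+1≈0 = P-asym P-1 (P-resp (-≈0⇒≈ x+1≈0) Px)

      p≡4a+3 : p ≡ 4 * sums 1ℤ + 3
      p≡4a+3 = begin
        p                                        ≡⟨ H+H+1≡p ⟨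
        H + H + 1
          ≡⟨ cong (λ h → h + h + 1) (trans H≡2a+1 (cong (λ b → b + sums 1ℤ + 1) (sym sums≡differences))) ⟩
        (a + a + 1) + (a + a + 1) + 1            ≡⟨ identity a ⟩
        4 * a + 3                                ∎
        where
        a = sums 1ℤ
        identity : ∀ a → (a + a + 1) + (a + a + 1) + 1 ≡ 4 * a + 3
        identity = solve-∀

      private
        sums[-1]≡a+1 : sums -1ℤ ≡ suc (sums 1ℤ)
        sums[-1]≡a+1 = ℕₚ.+-cancelˡ-≡ (differences 1ℤ) _ _ (begin
          differences 1ℤ + sums -1ℤ        ≡⟨ H≡differences+sums ⟨
          H                                ≡⟨ H≡2a+1 ⟩
          differences 1ℤ + sums 1ℤ + 1     ≡⟨ identity (differences 1ℤ) (sums 1ℤ) ⟩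
          differences 1ℤ + suc (sums 1ℤ)   ∎)
          where
          identity : ∀ b a → b + a + 1 ≡ b + suc a
          identity b a = trans (ℕₚ.+-assoc b a 1) (cong (b +_) (ℕₚ.+-comm a 1))

      -- Since `sums` is invariant under multiplication of `c` by `P`, only the values at 0, 1 and
      -- -1 matter. At 0 a summand would need both `x` and `-x` in `P`.
      sums-formula : ∀ c → sums c ≡ sums 1ℤ * π c + suc (sums 1ℤ) * π (ℤ.- c)
      sums-formula c with c ≈? 0ℤ ⟨ p ⟩
      ... | yes c≈0 = begin
        sums c                                       ≡⟨ Σ-0 p none ⟩
        0                                            ≡⟨ cong₂ _+_ (ℕₚ.*-zeroʳ a) (ℕₚ.*-zeroʳ (suc a)) ⟨
        a * 0 + suc a * 0
          ≡⟨ cong₂ (λ u v → a * u + suc a * v) (π-0 (λ Pc → P-≉0 Pc c≈0)) (π-0 (λ P-c → P-≉0 P-c (Mod.-‿cong c≈0))) ⟨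
        a * π c + suc a * π (ℤ.- c)                  ∎
        where
        a = sums 1ℤ
        none : ∀ x → π x * π (c ℤ.- x) ≡ 0
        none x with toSum (P? x)
        ... | inj₂ ¬Px = cong (_* π (c ℤ.- x)) (π-0 ¬Px)
        ... | inj₁ Px = trans (cong (π x *_) (π-0 (P-asym Px ∘ P-resp
                (Mod.trans (Mod.+-congʳ {x = ℤ.- x} c≈0) (Mod.+-identityˡ (ℤ.- x)))))) (ℕₚ.*-zeroʳ (π x))
      ... | no c≉0 with P-split c≉0
      ...   | inj₁ Pc = begin
        sums c                                 ≡⟨ at-1 sums sums-scale Pc ⟩
        a                                      ≡⟨ identity a ⟩
        a * 1 + suc a * 0
          ≡⟨ cong₂ (λ u v → a * u + suc a * v) (π-1 Pc) (π-0 (P-asym Pc)) ⟨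
        a * π c + suc a * π (ℤ.- c)            ∎
        where
        a = sums 1ℤ
        identity : ∀ a → a ≡ a * 1 + suc a * 0
        identity = solve-∀
      ...   | inj₂ P-c = begin
        sums c                                 ≡⟨ cong sums (double-neg c) ⟩
        sums (ℤ.- c ℤ.* -1ℤ)                   ≡⟨ sums-scale P-c -1ℤ ⟩
        sums -1ℤ                               ≡⟨ sums[-1]≡a+1 ⟩
        suc a                                  ≡⟨ identity a ⟩
        a * 0 + suc a * 1
          ≡⟨ cong₂ (λ u v → a * u + suc a * v) (π-0 (λ Pc → P-asym Pc P-c)) (π-1 P-c) ⟨
        a * π c + suc a * π (ℤ.- c)            ∎
        where
        a = sums 1ℤ
        double-neg : ∀ c → c ≡ ℤ.- c ℤ.* -1ℤ
        double-neg = ℤ-Solver.solve-∀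
        identity : ∀ a → suc a ≡ a * 0 + suc a * 1
        identity = solve-∀

-- Multiplicative orders, and primitive roots modulo prime powers.

module Orders where

  open Congruences
  open Counting
  open import Data.Nat.Base using (_+_; _*_; _^_; _∸_; _≤_; _<_; pred)
  open ℕ∣ using (_∣_; ∣-trans; m∣m*n; ∣1⇒≡1; divides)
  open ≡ using (refl; sym; trans)

  coprime-* : ∀ {a b c} → Coprime a b → Coprime a c → Coprime a (b * c)
  coprime-* a⊥b a⊥c (d∣a , d∣bc) =
    a⊥c (d∣a , coprime-divisor (λ (e∣d , e∣b) → a⊥b (∣-trans e∣d d∣a , e∣b)) d∣bc)

  coprime-^ : ∀ {a b} → Coprime a b → ∀ k → Coprime a (b ^ k)
  coprime-^ a⊥b zero    (_ , d∣1) = ∣1⇒≡1 d∣1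
  coprime-^ a⊥b (suc k) = coprime-* a⊥b (coprime-^ a⊥b k)

  prime-coprime : ∀ {r a} → Prime r → ¬ (r ∣ a) → Coprime a r
  prime-coprime r-prime r∤a (d∣a , d∣r) with prime⇒irreducible r-prime d∣r
  ... | inj₁ d≡1 = d≡1
  ... | inj₂ refl = contradiction d∣a r∤a

  prime∤1 : ∀ {r} → Prime r → ¬ (1ℤ ≈ 0ℤ ⟨ r ⟩)
  prime∤1 r-prime 1≈0 = ℕₚ.<⇒≢ (ℕ.nonTrivial⇒n>1 _ {{prime⇒nonTrivial r-prime}}) (sym (∣1⇒≡1 (∣⇒∣ᵤ (≈0⇒∣ 1≈0))))

  ^-+ : ∀ x j k → x ℤ.^ (j + k) ≡ x ℤ.^ j ℤ.* x ℤ.^ k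
  ^-+ = ℤₚ.^-distribˡ-+-*

  module _ {m : ℕ} {a : ℤ} {d : ℕ} (a-order : HasOrder m a d) where

    open HasOrder a-order

    order-power : a ℤ.^ d ≈ 1ℤ ⟨ m ⟩
    order-power = fromMod _ _ power

    power-* : ∀ k → a ℤ.^ (d * k) ≈ 1ℤ ⟨ m ⟩
    power-* k = Mod.trans (Mod.reflexive (sym (ℤₚ.^-*-assoc a d k))) (≈1-^ k order-power)

    -- Exponents are natural numbers, so the inverse of `a ^ k` is taken with exponent `k * pred d`;
    -- the two exponents add up to `d * k`.
    power-inverse : ∀ k → a ℤ.^ k ℤ.* a ℤ.^ (k * pred d) ≈ 1ℤ ⟨ m ⟩
    power-inverse k = Mod.trans
      (Mod.reflexive (trans (sym (^-+ a k (k * pred d))) (cong (a ℤ.^_) exponent)))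
      (power-* k)
      where
      exponent : k + k * pred d ≡ d * k
      exponent = trans (sym (ℕₚ.*-suc k (pred d)))
        (trans (cong (k *_) (ℕₚ.suc-pred d {{ℕ.>-nonZero positive}})) (ℕₚ.*-comm k d))

    power-cancel : ∀ k {x y} → a ℤ.^ k ℤ.* x ≈ a ℤ.^ k ℤ.* y ⟨ m ⟩ → x ≈ y ⟨ m ⟩
    power-cancel k {x} {y} eq =
      Mod.trans (Mod.sym (absorb x)) (Mod.trans (Mod.*-congˡ {x = a ℤ.^ (k * pred d)} eq) (absorb y))
      where
      rearrange : ∀ u v x → u ℤ.* (v ℤ.* x) ≡ (v ℤ.* u) ℤ.* x
      rearrange = ℤ-Solver.solve-∀
      absorb : ∀ x → a ℤ.^ (k * pred d) ℤ.* (a ℤ.^ k ℤ.* x) ≈ x ⟨ m ⟩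
      absorb x = Mod.trans (Mod.reflexive (rearrange (a ℤ.^ (k * pred d)) (a ℤ.^ k) x))
        (Mod.trans (Mod.*-congʳ {x = x} (power-inverse k)) (Mod.*-identityˡ x))

    power-∸ : ∀ {j k} → j ≤ k → a ℤ.^ j ≈ a ℤ.^ k ⟨ m ⟩ → a ℤ.^ (k ∸ j) ≈ 1ℤ ⟨ m ⟩
    power-∸ {j} {k} j≤k eq = power-cancel j (Mod.trans
      (Mod.reflexive (trans (sym (^-+ a j (k ∸ j))) (cong (a ℤ.^_) (ℕₚ.m+[n∸m]≡n j≤k))))
      (Mod.trans (Mod.sym eq) (Mod.reflexive (sym (ℤₚ.*-identityʳ (a ℤ.^ j))))))

    below-order : ∀ {k} → k < d → a ℤ.^ k ≈ 1ℤ ⟨ m ⟩ → k ≡ 0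
    below-order {zero}  _   _  = refl
    below-order {suc k} k<d eq = contradiction (minimal (suc k) ℕ.z<s (toMod eq)) (ℕₚ.<⇒≱ k<d)

    order-∣ : ∀ k → a ℤ.^ k ≈ 1ℤ ⟨ m ⟩ → d ∣ k
    order-∣ k eq = divides (k ℕ./ d) (trans (ℕ/.m≡m%n+[m/n]*n k d) (cong (_+ k ℕ./ d * d) r≡0))
      where
      instance
        d≢0 : NonZero d
        d≢0 = ℕ.>-nonZero positive
      r≡0 : k ℕ.% d ≡ 0
      r≡0 = below-order (ℕ/.m%n<n k d) (Mod.trans (Mod.reflexive (sym (ℤₚ.*-identityˡ _)))
        (Mod.trans (Mod.*-congʳ {x = a ℤ.^ (k ℕ.% d)} (Mod.sym (power-* (k ℕ./ d))))
          (Mod.trans (Mod.reflexive (trans (sym (^-+ a (d * (k ℕ./ d)) (k ℕ.% d))) (cong (a ℤ.^_) split))) eq)))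
        where
        split : d * (k ℕ./ d) + k ℕ.% d ≡ k
        split = trans (cong (_+ k ℕ.% d) (ℕₚ.*-comm d (k ℕ./ d)))
          (trans (ℕₚ.+-comm _ (k ℕ.% d)) (sym (ℕ/.m≡m%n+[m/n]*n k d)))

    power-≤-injective : ∀ {j k} → j ≤ k → k < d → a ℤ.^ j ≈ a ℤ.^ k ⟨ m ⟩ → k ≤ j
    power-≤-injective {j} {k} j≤k k<d eq =
      ℕₚ.m∸n≡0⇒m≤n (below-order (ℕₚ.≤-<-trans (ℕₚ.m∸n≤m k j) k<d) (power-∸ j≤k eq))

    power-injective : ∀ {j k} → j < d → k < d → a ℤ.^ j ≈ a ℤ.^ k ⟨ m ⟩ → j ≡ k
    power-injective {j} {k} j<d k<d eq with ℕₚ.≤-total j k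
    ... | inj₁ j≤k = ℕₚ.≤-antisym j≤k (power-≤-injective j≤k k<d eq)
    ... | inj₂ k≤j = ℕₚ.≤-antisym (power-≤-injective k≤j j<d (Mod.sym eq)) k≤j

  length-filter-applyUpTo : ∀ {A : Set} {P : A → Set} (P? : Decidable P) (h : ℕ → ℕ) (f : ℕ → A) n →
    length (filter P? (map f (applyUpTo h n))) ≡ sum {n} (λ k → ⟦ P? (f (h (toℕ k))) ⟧)
  length-filter-applyUpTo P? h f zero    = refl
  length-filter-applyUpTo P? h f (suc n) with P? (f (h 0)) | length-filter-applyUpTo P? (h ∘ suc) f n
  ... | yes Pa | ih = cong₂ _+_ (sym (⟦⟧-yes (yes Pa) Pa)) ih
  ... | no ¬Pa | ih = cong₂ _+_ (sym (⟦⟧-no (no ¬Pa) ¬Pa)) ih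

  unit? : ∀ r x → Dec (¬ (x ≈ 0ℤ ⟨ r ⟩))
  unit? r x = ¬? (x ≈? 0ℤ ⟨ r ⟩)

  unit-periodic : ∀ r → Periodic r (λ x → ⟦ unit? r x ⟧)
  unit-periodic r x≈y = ⟦⟧-cong _ _ (λ x≉0 y≈0 → x≉0 (Mod.trans x≈y y≈0))
    (λ y≉0 x≈0 → y≉0 (Mod.trans (Mod.sym x≈y) x≈0))

  ⟦¬?⟧ : ∀ {A : Set} (d : Dec A) → ⟦ ¬? d ⟧ + ⟦ d ⟧ ≡ 1
  ⟦¬?⟧ d@(yes a) = cong₂ _+_ (⟦⟧-no (¬? d) (λ ¬a → ¬a a)) (⟦⟧-yes d a)
  ⟦¬?⟧ d@(no ¬a) = cong₂ _+_ (⟦⟧-yes (¬? d) ¬a) (⟦⟧-no d ¬a)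

  Σ-unit : ∀ r .{{_ : NonZero r}} → Σ r (λ x → ⟦ unit? r x ⟧) + 1 ≡ r
  Σ-unit r = trans (cong (Σ r (λ x → ⟦ unit? r x ⟧) +_) (sym (Σ-≈? r 0ℤ))) (trans (sym (Σ-+ r _ _))
    (trans (Σ-cong r (λ x → ⟦¬?⟧ (x ≈? 0ℤ ⟨ r ⟩))) (Σ-1 r)))

  module _ {r : ℕ} (r-prime : Prime r) (e : ℕ) where

    private
      instance
        r≢0 : NonZero r
        r≢0 = prime⇒nonZero r-prime
        rᵉ≢0 : NonZero (r ^ suc e)
        rᵉ≢0 = ℕₚ.m^n≢0 r (suc e)

      r∣rᵉ : r ∣ r ^ suc e
      r∣rᵉ = m∣m*n (r ^ e)

      -- `φ` counts in 1, ..., m whereas `Σ` runs over 0, ..., m - 1, hence the shift by one. Being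
      -- coprime to a power of the prime `r` means being nonzero modulo `r`.
      φ-as-sum : φ (r ^ suc e) ≡ Σ (r ^ suc e) (λ x → ⟦ unit? r x ⟧)
      φ-as-sum = begin
        φ (r ^ suc e)
          ≡⟨ length-filter-applyUpTo (λ k → coprime? k (r ^ suc e)) (λ k → k) suc (r ^ suc e) ⟩
        sum {r ^ suc e} (λ k → ⟦ coprime? (suc (toℕ k)) (r ^ suc e) ⟧)
          ≡⟨ sum-cong-≋ {r ^ suc e} (λ k → ⟦⟧-cong _ _ (to (toℕ k)) (from (toℕ k))) ⟩
        sum {r ^ suc e} (λ k → ⟦ unit? r (ℤ.+ toℕ k ℤ.+ 1ℤ) ⟧)         ≡⟨ Σ-def (r ^ suc e) _ ⟨
        Σ (r ^ suc e) (λ x → ⟦ unit? r (x ℤ.+ 1ℤ) ⟧)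
          ≡⟨ Σ-shift (r ^ suc e) (unit-periodic r ∘ coarsen r∣rᵉ) 1ℤ ⟩
        Σ (r ^ suc e) (λ x → ⟦ unit? r x ⟧)                            ∎
        where
        open ≡.≡-Reasoning
        suc≡ : ∀ k → ℤ.+ k ℤ.+ 1ℤ ≡ ℤ.+ suc k
        suc≡ k = cong ℤ.+_ (ℕₚ.+-comm k 1)
        to : ∀ k → Coprime (suc k) (r ^ suc e) → ¬ (ℤ.+ k ℤ.+ 1ℤ ≈ 0ℤ ⟨ r ⟩)
        to k k⊥ k≈0 = prime∤1 r-prime (∣⇒≈0 (subst (λ z → ℤ.+ r ℤ∣.∣ ℤ.+ z)
          (k⊥ (∣⇒∣ᵤ (≈0⇒∣ (Mod.trans (Mod.reflexive (sym (suc≡ k))) k≈0)) , r∣rᵉ)) ℤ∣.∣-refl))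
        from : ∀ k → ¬ (ℤ.+ k ℤ.+ 1ℤ ≈ 0ℤ ⟨ r ⟩) → Coprime (suc k) (r ^ suc e)
        from k k≉0 = coprime-^ (prime-coprime r-prime
          (λ r∣k → k≉0 (Mod.trans (Mod.reflexive (suc≡ k)) (∣⇒≈0 (∣ᵤ⇒∣ r∣k))))) (suc e)

    φ-prime-power : φ (r ^ suc e) ≡ r ^ e * (r ∸ 1)
    φ-prime-power = trans φ-as-sum (trans (cong (λ m → Σ m (λ x → ⟦ unit? r x ⟧)) (ℕₚ.*-comm r (r ^ e)))
      (trans (Σ-periodic (r ^ e) r (unit-periodic r)) (cong (r ^ e *_)
        (sym (trans (cong (_∸ 1) (sym (Σ-unit r))) (ℕₚ.m+n∸n≡m _ 1))))))

    -- The φ(rᵉ) powers of a are distinct units, so they are all of them.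
    primitive-root-generates : ∀ {a} → IsPrimitiveRoot a (r ^ suc e) →
                               ∀ {u} → ¬ (u ≈ 0ℤ ⟨ r ⟩) → ∃ λ k → u ≈ a ℤ.^ k ⟨ r ^ suc e ⟩
    primitive-root-generates {a} a-order {u} u≉0 = generated
      where
      open ≡.≡-Reasoning

      m = r ^ suc e
      d = φ m

      hits : ℤ → ℕ
      hits x = Σ d (λ k → ⟦ x ≈? a ℤ.^ ℤ.∣ k ∣ ⟨ m ⟩ ⟧)

      hits-cases : ∀ x → ((∃ λ k → x ≈ a ℤ.^ k ⟨ m ⟩) × hits x ≡ 1) ⊎ hits x ≡ 0
      hits-cases x with Finₚ.any? (λ (k : Fin d) → x ≈? a ℤ.^ toℕ k ⟨ m ⟩)
      ... | yes (k , x≈aᵏ) = inj₁ ((toℕ k , x≈aᵏ) , trans (Σ-def d _)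
        (trans (sum-single (λ j → ⟦ x ≈? a ℤ.^ toℕ j ⟨ m ⟩ ⟧) k λ j j≢k → ⟦⟧-no _ λ x≈aʲ →
            j≢k (Finₚ.toℕ-injective (power-injective a-order (Finₚ.toℕ<n j) (Finₚ.toℕ<n k) (Mod.trans (Mod.sym x≈aʲ) x≈aᵏ))))
          (⟦⟧-yes _ x≈aᵏ)))
      ... | no none =
        inj₂ (trans (Σ-def d _) (trans (sum-cong-≋ {d} (λ k → ⟦⟧-no _ (λ x≈ → none (k , x≈)))) (sum-replicate-zero d)))

      power≉0 : ∀ k → ¬ (a ℤ.^ k ≈ 0ℤ ⟨ r ⟩)
      power≉0 k aᵏ≈0 = prime∤1 r-prime (Mod.trans (Mod.sym (coarsen r∣rᵉ (power-inverse a-order k)))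
        (Mod.trans (Mod.*-congʳ {x = a ℤ.^ (k * pred d)} aᵏ≈0) (Mod.zeroˡ (a ℤ.^ (k * pred d)))))

      hits≤unit : ∀ x → hits x ≤ ⟦ unit? r x ⟧
      hits≤unit x with hits-cases x
      ... | inj₂ hits≡0 = subst (_≤ ⟦ unit? r x ⟧) (sym hits≡0) ℕ.z≤n
      ... | inj₁ ((k , x≈aᵏ) , hits≡1) = ℕₚ.≤-reflexive (trans hits≡1
        (sym (⟦⟧-yes (unit? r x) (λ x≈0 → power≉0 k (Mod.trans (Mod.sym (coarsen r∣rᵉ x≈aᵏ)) x≈0)))))

      -- Each of the `d` exponents hits exactly one residue, so both totals are `d`. With the
      -- pointwise bound `hits≤unit`, equal totals force equality at every residue.
      totals : Σ m hits ≡ Σ m (λ x → ⟦ unit? r x ⟧)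
      totals = begin
        Σ m hits                                                        ≡⟨ Σ-comm m d _ ⟩
        Σ d (λ k → Σ m (λ x → ⟦ x ≈? a ℤ.^ ℤ.∣ k ∣ ⟨ m ⟩ ⟧))
          ≡⟨ Σ-cong d (λ k → Σ-≈? m (a ℤ.^ ℤ.∣ k ∣)) ⟩
        Σ d (λ _ → 1)                                                   ≡⟨ Σ-1 d ⟩
        d                                                               ≡⟨ φ-as-sum ⟩
        Σ m (λ x → ⟦ unit? r x ⟧)                                       ∎

      x : Fin m
      x = fromℕ< (n%ℕd<d u m)

      u≈x : u ≈ ℤ.+ toℕ x ⟨ m ⟩
      u≈x = subst (λ k → u ≈ ℤ.+ k ⟨ m ⟩) (sym (Finₚ.toℕ-fromℕ< (n%ℕd<d u m))) (%ℕ-≈ u m)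

      hits≡1 : hits (ℤ.+ toℕ x) ≡ 1
      hits≡1 = trans
        (sum-≤-tight (λ k → hits≤unit (ℤ.+ toℕ k)) (trans (sym (Σ-def m hits)) (trans totals (Σ-def m _))) x)
        (⟦⟧-yes _ (λ x≈0 → u≉0 (Mod.trans (coarsen r∣rᵉ u≈x) x≈0)))

      generated : ∃ λ k → u ≈ a ℤ.^ k ⟨ m ⟩
      generated with hits-cases (ℤ.+ toℕ x)
      ... | inj₁ ((k , x≈aᵏ) , _) = k , Mod.trans u≈x x≈aᵏ
      ... | inj₂ hits≡0 = contradiction (trans (sym hits≡0) hits≡1) λ ()

-- Inverses, simultaneous congruences, parity and signs of powers.

module Remainders where

  open Congruences
  open Orders
  open import Data.Nat.Base using (_+_; _*_; _^_; _∸_; _≤_; _/_; _%_)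
  open ℕ∣ using (_∣_; ∣-trans; n∣m*n; divides; ∣⇒≤; *-monoʳ-∣)
  open ≡ using (refl; sym; trans)

  coprime-inverse : ∀ {m n} → Coprime m n → ∃ λ x → ℤ.+ m ℤ.* x ≈ 1ℤ ⟨ n ⟩
  coprime-inverse {m} {n} m⊥n with coprime-Bézout m⊥n
  ... | Bézout.+- x y eq = ℤ.+ x , congruent (ℤ.+ y) (begin
    ℤ.+ y ℤ.* ℤ.+ n                            ≡⟨ cancel (ℤ.+ y ℤ.* ℤ.+ n) ⟩
    1ℤ ℤ.+ ℤ.+ y ℤ.* ℤ.+ n ℤ.- 1ℤ              ≡⟨ cong (λ z → 1ℤ ℤ.+ z ℤ.- 1ℤ) (ℤₚ.pos-* y n) ⟨
    ℤ.+ (1 + y * n) ℤ.- 1ℤ                     ≡⟨ cong (λ z → ℤ.+ z ℤ.- 1ℤ) (trans eq (ℕₚ.*-comm x m)) ⟩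
    ℤ.+ (m * x) ℤ.- 1ℤ                         ≡⟨ cong (ℤ._- 1ℤ) (ℤₚ.pos-* m x) ⟩
    ℤ.+ m ℤ.* ℤ.+ x ℤ.- 1ℤ                     ∎)
    where
    open ≡.≡-Reasoning
    cancel : ∀ z → z ≡ 1ℤ ℤ.+ z ℤ.- 1ℤ
    cancel = ℤ-Solver.solve-∀
  ... | Bézout.-+ x y eq = ℤ.- (ℤ.+ x) , congruent (ℤ.- (ℤ.+ y)) (begin
    ℤ.- (ℤ.+ y) ℤ.* ℤ.+ n                      ≡⟨ ℤₚ.neg-distribˡ-* (ℤ.+ y) (ℤ.+ n) ⟨
    ℤ.- (ℤ.+ y ℤ.* ℤ.+ n)                      ≡⟨ cong ℤ.-_ (ℤₚ.pos-* y n) ⟨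
    ℤ.- (ℤ.+ (y * n))                          ≡⟨ cong (λ z → ℤ.- (ℤ.+ z)) eq ⟨
    ℤ.- (1ℤ ℤ.+ ℤ.+ (x * m))                   ≡⟨ cong (λ z → ℤ.- (1ℤ ℤ.+ z)) (ℤₚ.pos-* x m) ⟩
    ℤ.- (1ℤ ℤ.+ ℤ.+ x ℤ.* ℤ.+ m)               ≡⟨ rearrange (ℤ.+ x) (ℤ.+ m) ⟩
    ℤ.+ m ℤ.* (ℤ.- (ℤ.+ x)) ℤ.- 1ℤ             ∎)
    where
    open ≡.≡-Reasoning
    rearrange : ∀ x m → ℤ.- (1ℤ ℤ.+ x ℤ.* m) ≡ m ℤ.* (ℤ.- x) ℤ.- 1ℤ
    rearrange = ℤ-Solver.solve-∀

  -- The solution is `i + h * c`, where `c` represents the quotient of `j - i` by `h` modulo `k`. It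
  -- is a natural number because it will be an exponent of `l`.
  chinese-remainder : ∀ {h k} .{{_ : NonZero k}} → Coprime h k → ∀ i j →
                      ∃ λ r → ℤ.+ r ≈ ℤ.+ i ⟨ h ⟩ × ℤ.+ r ≈ ℤ.+ j ⟨ k ⟩
  chinese-remainder {h} {k} h⊥k i j with x , hx≈1 ← coprime-inverse h⊥k =
    i + h * c , mod-h , mod-k
    where
    z : ℤ
    z = x ℤ.* (ℤ.+ j ℤ.- ℤ.+ i)

    c : ℕ
    c = z %ℕ k

    cast : ℤ.+ (i + h * c) ≡ ℤ.+ i ℤ.+ ℤ.+ h ℤ.* ℤ.+ c
    cast = cong (ℤ._+_ (ℤ.+ i)) (ℤₚ.pos-* h c)

    mod-h : ℤ.+ (i + h * c) ≈ ℤ.+ i ⟨ h ⟩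
    mod-h = Mod.trans (Mod.reflexive cast) (congruent (ℤ.+ c) (identity (ℤ.+ c) (ℤ.+ h) (ℤ.+ i)))
      where
      identity : ∀ c h i → c ℤ.* h ≡ i ℤ.+ h ℤ.* c ℤ.- i
      identity = ℤ-Solver.solve-∀

    mod-k : ℤ.+ (i + h * c) ≈ ℤ.+ j ⟨ k ⟩
    mod-k = begin
      ℤ.+ (i + h * c)                                         ≡⟨ cast ⟩
      ℤ.+ i ℤ.+ ℤ.+ h ℤ.* ℤ.+ c
        ≈⟨ Mod.+-congˡ {x = ℤ.+ i} (Mod.*-congˡ {x = ℤ.+ h} (Mod.sym (%ℕ-≈ z k))) ⟩
      ℤ.+ i ℤ.+ ℤ.+ h ℤ.* (x ℤ.* (ℤ.+ j ℤ.- ℤ.+ i))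
        ≡⟨ cong (ℤ._+_ (ℤ.+ i)) (ℤₚ.*-assoc (ℤ.+ h) x _) ⟨
      ℤ.+ i ℤ.+ (ℤ.+ h ℤ.* x) ℤ.* (ℤ.+ j ℤ.- ℤ.+ i)
        ≈⟨ Mod.+-congˡ {x = ℤ.+ i} (Mod.*-congʳ {x = ℤ.+ j ℤ.- ℤ.+ i} hx≈1) ⟩
      ℤ.+ i ℤ.+ 1ℤ ℤ.* (ℤ.+ j ℤ.- ℤ.+ i)                      ≡⟨ identity (ℤ.+ i) (ℤ.+ j) ⟩
      ℤ.+ j                                                   ∎
      where
      open import Relation.Binary.Reasoning.Setoid (Mod.setoid {k})
      identity : ∀ i j → i ℤ.+ 1ℤ ℤ.* (j ℤ.- i) ≡ j
      identity = ℤ-Solver.solve-∀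

  ≈-combine : ∀ {m n x y} → Coprime m n → x ≈ y ⟨ m ⟩ → x ≈ y ⟨ n ⟩ → x ≈ y ⟨ m * n ⟩
  ≈-combine {m} {n} {x} {y} m⊥n x≈y⟨m⟩ x≈y⟨n⟩ = fromMod x y (∣ᵤ⇒∣ (combine (∣⇒∣ᵤ (toMod x≈y⟨m⟩)) (∣⇒∣ᵤ (toMod x≈y⟨n⟩))))
    where
    combine : ∀ {z} → m ∣ z → n ∣ z → m * n ∣ z
    combine {z} (divides c z≡cm) n∣z = subst (m * n ∣_) (trans (ℕₚ.*-comm m c) (sym z≡cm))
      (*-monoʳ-∣ m (coprime-divisor (Coprimality.sym m⊥n) (subst (n ∣_) (trans z≡cm (ℕₚ.*-comm c m)) n∣z)))

  power-resp-≈ : ∀ {m a d} → HasOrder m a d → ∀ {i j} → ℤ.+ i ≈ ℤ.+ j ⟨ d ⟩ → a ℤ.^ i ≈ a ℤ.^ j ⟨ m ⟩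
  power-resp-≈ {m} {a} {d} ord {i} {j} i≈j =
    [ (λ i≤j → Mod.sym (ordered i≤j (Mod.sym i≈j))) , (λ j≤i → ordered j≤i i≈j) ]′ (ℕₚ.≤-total i j)
    where
    ordered : ∀ {i j} → i ≤ j → ℤ.+ j ≈ ℤ.+ i ⟨ d ⟩ → a ℤ.^ j ≈ a ℤ.^ i ⟨ m ⟩
    ordered {i} {j} i≤j j≈i =
      shifted (subst (d ∣_) (cong ℤ.∣_∣ (trans (ℤₚ.[+m]-[+n]≡m⊖n j i) (ℤₚ.⊖-≥ i≤j))) (∣⇒∣ᵤ (toMod j≈i)))
      where
      shifted : d ∣ j ∸ i → a ℤ.^ j ≈ a ℤ.^ i ⟨ m ⟩
      shifted (divides c eq) =
        Mod.trans (Mod.reflexive (trans (cong (a ℤ.^_) (sym (ℕₚ.m+[n∸m]≡n i≤j))) (^-+ a i (j ∸ i))))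
        (Mod.trans (Mod.*-congˡ {x =
          a ℤ.^ i} (Mod.trans (Mod.reflexive (cong (a ℤ.^_) (trans eq (ℕₚ.*-comm c d)))) (power-* ord c)))
          (Mod.*-identityʳ (a ℤ.^ i)))

  neg-^-even : ∀ x k → (ℤ.- x) ℤ.^ (2 * k) ≡ x ℤ.^ (2 * k)
  neg-^-even x k = trans (sym (ℤₚ.^-*-assoc (ℤ.- x) 2 k))
    (trans (cong (ℤ._^ k) (square x)) (ℤₚ.^-*-assoc x 2 k))
    where
    square : ∀ x → (ℤ.- x) ℤ.* ((ℤ.- x) ℤ.* 1ℤ) ≡ x ℤ.* (x ℤ.* 1ℤ)
    square = ℤ-Solver.solve-∀

  neg-^-odd : ∀ x k → (ℤ.- x) ℤ.^ suc (2 * k) ≡ ℤ.- (x ℤ.^ suc (2 * k))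
  neg-^-odd x k = trans (cong (ℤ.- x ℤ.*_) (neg-^-even x k)) (sym (ℤₚ.neg-distribˡ-* x _))

  neg-^ : ∀ x k → (ℤ.- x) ℤ.^ k ≡ x ℤ.^ k ⊎ (ℤ.- x) ℤ.^ k ≡ ℤ.- (x ℤ.^ k)
  neg-^ x zero = inj₁ refl
  neg-^ x (suc k) with neg-^ x k
  ... | inj₁ eq = inj₂ (trans (cong (ℤ.- x ℤ.*_) eq) (sym (ℤₚ.neg-distribˡ-* x _)))
  ... | inj₂ eq = inj₁ (trans (cong (ℤ.- x ℤ.*_) eq) (double-neg x (x ℤ.^ k)))
    where
    double-neg : ∀ x y → ℤ.- x ℤ.* ℤ.- y ≡ x ℤ.* y
    double-neg = ℤ-Solver.solve-∀

  Odd : ℕ → Set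
  Odd m = ∃ λ v → m ≡ suc (2 * v)

  odd-* : ∀ {m m′} → Odd m → Odd m′ → Odd (m * m′)
  odd-* (u , refl) (v , refl) = u + v + 2 * (u * v) , identity u v
    where
    identity : ∀ u v → suc (2 * u) * suc (2 * v) ≡ suc (2 * (u + v + 2 * (u * v)))
    identity = solve-∀

  odd-^ : ∀ {m} → Odd m → ∀ e → Odd (m ^ e)
  odd-^ m-odd zero    = 0 , refl
  odd-^ m-odd (suc e) = odd-* m-odd (odd-^ m-odd e)

  odd⇒2∤ : ∀ {m} → Odd m → ¬ (2 ∣ m)
  odd⇒2∤ (v , refl) (divides c eq) = ℕₚ.even≢odd c v (trans (ℕₚ.*-comm 2 c) (sym eq))

  -- With `p = 4 * w + 3`, the factor `p - 1` is twice the odd number `2 * w + 1`, and `p ^ e` is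
  -- odd as well.
  half-φ-odd : ∀ {p Φ} e → p % 4 ≡ 3 → Φ ≡ p ^ e * (p ∸ 1) → Odd (Φ / 2) × Φ ≡ 2 * (Φ / 2)
  half-φ-odd {p} {Φ} e p%4≡3 Φ≡ =
    subst Odd (sym half≡) (odd-* (odd-^ (suc (2 * w) , p-form) e) (w , refl)) , trans Φ≡2*odd (cong (2 *_) (sym half≡))
    where
    w odd : ℕ
    w = p / 4
    odd = p ^ e * suc (2 * w)

    p-form : p ≡ suc (2 * suc (2 * w))
    p-form = trans (ℕ/.m≡m%n+[m/n]*n p 4) (trans (cong (_+ w * 4) p%4≡3) (identity w))
      where
      identity : ∀ w → 3 + w * 4 ≡ suc (2 * suc (2 * w))
      identity = solve-∀

    Φ≡2*odd : Φ ≡ 2 * odd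
    Φ≡2*odd = trans Φ≡ (trans (cong (p ^ e *_) (cong (_∸ 1) p-form)) (identity (p ^ e) (suc (2 * w))))
      where
      identity : ∀ x y → x * (2 * y) ≡ 2 * (x * y)
      identity = solve-∀

    half≡ : Φ / 2 ≡ odd
    half≡ = trans (cong (_/ 2) (trans Φ≡2*odd (ℕₚ.*-comm 2 odd))) (ℕ/.m*n/n≡m odd 2)

  -- A common divisor of `h` and `k` divides the gcd 2, and it is not 2 because `h` is odd.
  odd-coprime : ∀ {h k} → Odd h → gcd (2 * h) k ≡ 2 → Coprime h k
  odd-coprime {h} {k} h-odd gcd≡2 {d} (d∣h , d∣k)
    with prime⇒irreducible prime[2] (subst (d ∣_) gcd≡2 (gcd-greatest (∣-trans d∣h (n∣m*n 2)) d∣k))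
  ... | inj₁ d≡1 = d≡1
  ... | inj₂ refl = contradiction d∣h (odd⇒2∤ h-odd)

  1≉-1 : ∀ {p} → p % 4 ≡ 3 → ¬ (1ℤ ≈ -1ℤ ⟨ p ⟩)
  1≉-1 {p} p%4≡3 1≈-1 = impossible p p%4≡3 (∣⇒≤ (∣⇒∣ᵤ (toMod 1≈-1)))
    where
    impossible : ∀ p → p % 4 ≡ 3 → ¬ (p ≤ 2)
    impossible 0 ()
    impossible 1 ()
    impossible 2 ()
    impossible (suc (suc (suc p))) _ (ℕ.s≤s (ℕ.s≤s ()))

-- Sums of two units, and the product of the two counts.

module Convolution where

  open Congruences
  open Counting
  open Orders
  open import Data.Nat.Base using (_+_; _*_; _∸_; _≤_; _<_; s≤s)
  open ℕ∣ using (divides)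
  open ≡ using (refl; sym; trans)
  open ≡.≡-Reasoning

  Σ-multiples : ∀ m d .{{_ : NonZero d}} (F : ℤ → ℕ) → (∀ x → ¬ (x ≈ 0ℤ ⟨ d ⟩) → F x ≡ 0) →
                Σ (m * d) F ≡ Σ m (λ y → F (ℤ.+ d ℤ.* y))
  Σ-multiples m d@(suc _) F F≡0 = trans (Σ-blocks m d F) (Σ-cong m λ b →
    trans (Σ-def d (λ r → F (ℤ.+ d ℤ.* b ℤ.+ r))) (trans
      (sum-single (λ r → F (ℤ.+ d ℤ.* b ℤ.+ ℤ.+ toℕ r)) Fin.zero (λ r r≢0 → F≡0 _ (λ eq → r≢0 (Finₚ.toℕ-injective
        (≈⇒≡ (Finₚ.toℕ<n r) (Finₚ.toℕ<n {suc _} Fin.zero) (Mod.trans (Mod.sym (n*b+a≈a d b (ℤ.+ toℕ r))) eq))))))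
      (cong F (ℤₚ.+-identityʳ (ℤ.+ d ℤ.* b)))))

  -- `X e` plays the role of the difference of `Y e` and `Y (suc e)`, stated without subtraction;
  -- the last term keeps all of `Y k`.
  sum-telescope : ∀ (X Y : ℕ → ℕ) k → (∀ e → e < k → X e + Y (suc e) ≡ Y e) → X k ≡ Y k →
                  sum {suc k} (X ∘ toℕ) ≡ Y 0
  sum-telescope X Y zero    step last = trans (ℕₚ.+-identityʳ (X 0)) last
  sum-telescope X Y (suc k) step last = trans
    (cong (X 0 +_) (sum-telescope (X ∘ suc) (Y ∘ suc) k (λ e e<k → step (suc e) (s≤s e<k)) last))
    (step 0 ℕ.z<s)

  module _ (q : ℕ) .{{_ : NonZero q}} where

    private
      υ ζ : ℤ → ℕ
      υ x = ⟦ unit? q x ⟧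
      ζ x = ⟦ x ≈? 0ℤ ⟨ q ⟩ ⟧

    unit-sums : ℤ → ℕ
    unit-sums c = Σ q (λ x → υ x * υ (c ℤ.- x))

    private
      υ+ζ : ∀ x → υ x + ζ x ≡ 1
      υ+ζ x = ⟦¬?⟧ (x ≈? 0ℤ ⟨ q ⟩)

      -- (1 - u)(1 - v) + u + v = 1 + uv, and both x and c - x vanish iff x and c do.
      pointwise : ∀ c x → υ x * υ (c ℤ.- x) + (ζ x + ⟦ x ≈? c ⟨ q ⟩ ⟧) ≡ 1 + ζ x * ζ c
      pointwise c x = begin
        υ x * υ (c ℤ.- x) + (ζ x + ⟦ x ≈? c ⟨ q ⟩ ⟧)
          ≡⟨ cong (λ z → υ x * υ (c ℤ.- x) + (ζ x + z))
               (⟦⟧-cong _ (c ℤ.- x ≈? 0ℤ ⟨ q ⟩) (≈⇒-≈0 ∘ Mod.sym) (Mod.sym ∘ -≈0⇒≈)) ⟩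
        υ x * υ (c ℤ.- x) + (ζ x + ζ (c ℤ.- x))   ≡⟨ complement (υ x) _ (ζ x) _ (υ+ζ x) (υ+ζ (c ℤ.- x)) ⟩
        1 + ζ x * ζ (c ℤ.- x)                     ≡⟨ cong (1 +_) (both (toSum (x ≈? 0ℤ ⟨ q ⟩))) ⟩
        1 + ζ x * ζ c                             ∎
        where
        complement : ∀ a b u v → a + u ≡ 1 → b + v ≡ 1 → a * b + (u + v) ≡ 1 + u * v
        -- Adding `a * v + u * b` to both sides makes `(a + u) * (b + v)` appear, which is 1.
        complement a b u v a+u b+v = ℕₚ.+-cancelʳ-≡ (a * v + u * b) _ _ (begin
          a * b + (u + v) + (a * v + u * b)
            ≡⟨ cong (λ z → a * b + z + (a * v + u * b)) (cong₂ _+_ (sym (trans (cong (u *_) b+v) (ℕₚ.*-identityʳ u))) (sym (trans (cong (_* v) a+u) (ℕₚ.*-identityˡ v)))) ⟩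
          a * b + (u * (b + v) + (a + u) * v) + (a * v + u * b)    ≡⟨ expand a b u v ⟩
          (a + u) * (b + v) + u * v + (a * v + u * b)
            ≡⟨ cong (λ z → z + u * v + (a * v + u * b)) (cong₂ _*_ a+u b+v) ⟩
          1 + u * v + (a * v + u * b)           ∎)
          where
          expand : ∀ a b u v → a * b + (u * (b + v) + (a + u) * v) + (a * v + u * b) ≡ (a + u) * (b + v) + u * v + (a * v + u * b)
          expand = solve-∀
        both : (x ≈ 0ℤ ⟨ q ⟩) ⊎ ¬ (x ≈ 0ℤ ⟨ q ⟩) → ζ x * ζ (c ℤ.- x) ≡ ζ x * ζ c
        both (inj₂ x≉0) = trans (cong (_* ζ (c ℤ.- x)) (⟦⟧-no _ x≉0)) (sym (cong (_* ζ c) (⟦⟧-no _ x≉0)))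
        both (inj₁ x≈0) =
          cong (ζ x *_) (⟦⟧-cong _ _ (λ eq → Mod.trans (-≈0⇒≈ eq) x≈0) (λ c≈0 → ≈⇒-≈0 (Mod.trans c≈0 (Mod.sym x≈0))))

      -- Of the `q` residues `x`, those with `x = 0` or `x = c` are excluded; these two coincide
      -- exactly when `c` vanishes, and `ζ c` corrects for that.
      unit-sums+2 : ∀ c → unit-sums c + 2 ≡ q + ζ c
      unit-sums+2 c = begin
        unit-sums c + 2
          ≡⟨ cong (unit-sums c +_) (cong₂ _+_ (Σ-≈? q 0ℤ) (Σ-≈? q c)) ⟨
        unit-sums c + (Σ q ζ + Σ q (λ x → ⟦ x ≈? c ⟨ q ⟩ ⟧))
          ≡⟨ cong (unit-sums c +_) (Σ-+ q ζ _) ⟨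
        unit-sums c + Σ q (λ x → ζ x + ⟦ x ≈? c ⟨ q ⟩ ⟧)
          ≡⟨ Σ-+ q _ _ ⟨
        Σ q (λ x → υ x * υ (c ℤ.- x) + (ζ x + ⟦ x ≈? c ⟨ q ⟩ ⟧))
          ≡⟨ Σ-cong q (pointwise c) ⟩
        Σ q (λ x → 1 + ζ x * ζ c)
          ≡⟨ Σ-+ q _ _ ⟩
        Σ q (λ _ → 1) + Σ q (λ x → ζ x * ζ c)
          ≡⟨ cong₂ _+_ (Σ-1 q) (trans (Σ-*ʳ q (ζ c) ζ) (trans (cong (_* ζ c) (Σ-≈? q 0ℤ)) (ℕₚ.*-identityˡ (ζ c)))) ⟩
        q + ζ c ∎

    unit-sums-formula : 2 ≤ q → ∀ c → unit-sums c ≡ (q ∸ 2) * υ c + (q ∸ 1) * ζ c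
    unit-sums-formula 2≤q c = ℕₚ.+-cancelʳ-≡ 2 _ _ (trans (unit-sums+2 c) (sym (cases (toSum (c ≈? 0ℤ ⟨ q ⟩)))))
      where
      cases : (c ≈ 0ℤ ⟨ q ⟩) ⊎ ¬ (c ≈ 0ℤ ⟨ q ⟩) → (q ∸ 2) * υ c + (q ∸ 1) * ζ c + 2 ≡ q + ζ c
      cases (inj₁ c≈0) = begin
        (q ∸ 2) * υ c + (q ∸ 1) * ζ c + 2
          ≡⟨ cong₂ (λ u z → (q ∸ 2) * u + (q ∸ 1) * z + 2) (⟦⟧-no (unit? q c) (λ c≉0 → c≉0 c≈0)) ζ≡1 ⟩
        (q ∸ 2) * 0 + (q ∸ 1) * 1 + 2
          ≡⟨ cong (_+ 2) (cong₂ _+_ (ℕₚ.*-zeroʳ (q ∸ 2)) (ℕₚ.*-identityʳ (q ∸ 1))) ⟩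
        q ∸ 1 + 2                           ≡⟨ ℕₚ.+-assoc (q ∸ 1) 1 1 ⟨
        q ∸ 1 + 1 + 1                       ≡⟨ cong (_+ 1) (ℕₚ.m∸n+n≡m (ℕₚ.≤-trans (ℕₚ.n≤1+n 1) 2≤q)) ⟩
        q + 1                               ≡⟨ cong (q +_) ζ≡1 ⟨
        q + ζ c                             ∎
        where
        ζ≡1 : ζ c ≡ 1
        ζ≡1 = ⟦⟧-yes (c ≈? 0ℤ ⟨ q ⟩) c≈0
      cases (inj₂ c≉0) = begin
        (q ∸ 2) * υ c + (q ∸ 1) * ζ c + 2
          ≡⟨ cong₂ (λ u z → (q ∸ 2) * u + (q ∸ 1) * z + 2) (⟦⟧-yes (unit? q c) c≉0) ζ≡0 ⟩
        (q ∸ 2) * 1 + (q ∸ 1) * 0 + 2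
          ≡⟨ cong (_+ 2) (cong₂ _+_ (ℕₚ.*-identityʳ (q ∸ 2)) (ℕₚ.*-zeroʳ (q ∸ 1))) ⟩
        q ∸ 2 + 0 + 2                       ≡⟨ cong (_+ 2) (ℕₚ.+-identityʳ (q ∸ 2)) ⟩
        q ∸ 2 + 2                           ≡⟨ ℕₚ.m∸n+n≡m 2≤q ⟩
        q                                   ≡⟨ ℕₚ.+-identityʳ q ⟨
        q + 0                               ≡⟨ cong (q +_) ζ≡0 ⟨
        q + ζ c                             ∎
        where
        ζ≡0 : ζ c ≡ 0
        ζ≡0 = ⟦⟧-no (c ≈? 0ℤ ⟨ q ⟩) c≉0

  module _ {p q : ℕ} .{{_ : NonZero p}} .{{_ : NonZero q}} {P : ℤ → Set} (residues : HalfSystem p P)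
           (q⁻¹ : ℤ) (qq⁻¹≈1 : ℤ.+ q ℤ.* q⁻¹ ≈ 1ℤ ⟨ p ⟩) where

    open HalfSystem residues

    -- The two conditions involving `P` depend on `x` modulo `p` only, the two involving units on
    -- `x` modulo `q` only. So there are `m` equal periods, and each splits as a product by Chinese
    -- remainders.
    residue-unit-sums : ∀ m c →
      Σ (m * (p * q)) (λ x → (⟦ P? x ⟧ * ⟦ unit? q x ⟧) * (⟦ P? (c ℤ.- x) ⟧ * ⟦ unit? q (c ℤ.- x) ⟧)) ≡
      m * (sums c * unit-sums q c)
    residue-unit-sums m c = begin
      Σ (m * (p * q)) (λ x → (⟦ P? x ⟧ * ⟦ unit? q x ⟧) * (⟦ P? (c ℤ.- x) ⟧ * ⟦ unit? q (c ℤ.- x) ⟧))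
        ≡⟨ Σ-cong (m * (p * q)) (λ x → interchange ⟦ P? x ⟧ _ _ _) ⟩
      Σ (m * (p * q)) (λ x → F x * G x)
        ≡⟨ Σ-periodic m (p * q) {{ℕₚ.m*n≢0 p q}} (λ x≈y → cong₂ _*_ (F-per (coarsen (divides q (ℕₚ.*-comm p q)) x≈y)) (G-per (coarsen (divides p refl) x≈y))) ⟩
      m * Σ (p * q) (λ x → F x * G x)
        ≡⟨ cong (m *_) (Σ-CRT p q F-per G-per q⁻¹ qq⁻¹≈1) ⟩
      m * (sums c * unit-sums q c) ∎
      where
      F G : ℤ → ℕ
      F x = ⟦ P? x ⟧ * ⟦ P? (c ℤ.- x) ⟧
      G x = ⟦ unit? q x ⟧ * ⟦ unit? q (c ℤ.- x) ⟧
      P-per : Periodic p (λ x → ⟦ P? x ⟧)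
      P-per x≈y = ⟦⟧-cong _ _ (P-resp x≈y) (P-resp (Mod.sym x≈y))
      F-per : Periodic p F
      F-per {x} {y} x≈y = cong₂ _*_ (P-per x≈y) (P-per (Mod.+-congˡ {x = c} (Mod.-‿cong x≈y)))
      G-per : Periodic q G
      G-per {x} {y} x≈y = cong₂ _*_ (unit-periodic q x≈y) (unit-periodic q (Mod.+-congˡ {x = c} (Mod.-‿cong x≈y)))
      interchange : ∀ a b c d → (a * b) * (c * d) ≡ (a * c) * (b * d)
      interchange = solve-∀

-- Ring elements given by natural coefficients on the residues modulo n.

module Expansion where

  open Congruences
  private module ℕΣ = Counting

  -- The structure of K[x]/⟨xⁿ - 1⟩ that the computation needs: the image ν of
  -- ℕ and the powers e of x, whose exponents may be taken modulo n.
  record CyclicRing {c ℓ} (R : CommutativeRing c ℓ) (n : ℕ) : Set (c ⊔ ℓ) where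
    open CommutativeRing R hiding (zero)
    field
      ν      : ℕ → Carrier
      ν-0    : ν 0 ≈ 0#
      ν-1    : ν 1 ≈ 1#
      ν-+    : ∀ a b → ν (a ℕ.+ b) ≈ ν a + ν b
      ν-*    : ∀ a b → ν (a ℕ.* b) ≈ ν a * ν b
      e      : ℤ → Carrier
      e-+    : ∀ x y → e (x ℤ.+ y) ≈ e x * e y
      e-cong : ∀ {x y} → x ≈ y ⟨ n ⟩ → e x ≈ e y

  module Expand {c ℓ : Level} {R : CommutativeRing c ℓ} {n : ℕ} .{{_ : NonZero n}} (C : CyclicRing R n) where

    open CommutativeRing R hiding (zero)
    open CyclicRing C
    open ResidueSums commutativeSemiring
    open import Relation.Binary.Reasoning.Setoid setoid
    open import Algebra.Properties.CommutativeSemigroup *-commutativeSemigroup using (interchange)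

    ν-≡ : ∀ {a b} → a ≡ b → ν a ≈ ν b
    ν-≡ = reflexive ∘ cong ν

    ν-⟦⟧ : ∀ {a} {A : Set a} (d : Dec A) → ν ℕΣ.⟦ d ⟧ ≈ ⟦ d ⟧
    ν-⟦⟧ d@(yes a) = trans (ν-≡ (ℕΣ.⟦⟧-yes d a)) (trans ν-1 (reflexive (≡.sym (⟦⟧-yes d a))))
    ν-⟦⟧ d@(no ¬a) = trans (ν-≡ (ℕΣ.⟦⟧-no d ¬a)) (trans ν-0 (reflexive (≡.sym (⟦⟧-no d ¬a))))

    ν-sum : ∀ {k} (f : Fin k → ℕ) → ν (ℕΣ.sum f) ≈ sum (ν ∘ f)
    ν-sum {zero}  f = ν-0
    ν-sum {suc k} f = trans (ν-+ (f Fin.zero) _) (+-congˡ (ν-sum (f ∘ Fin.suc)))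

    ν-Σ : ∀ k (f : ℤ → ℕ) → ν (ℕΣ.Σ k f) ≈ Σ k (ν ∘ f)
    ν-Σ k f = trans (ν-≡ (ℕΣ.Σ-def k f)) (trans (ν-sum {k} _) (reflexive (≡.sym (Σ-def k (ν ∘ f)))))

    -- The ring element whose coefficient at exponent `x` is `f x`. Writing both sides of an
    -- identity as values of `Ψ` reduces it to an equality of functions into ℕ.
    Ψ : (ℤ → ℕ) → Carrier
    Ψ f = Σ n (λ x → ν (f x) * e x)

    Ψ-cong : ∀ {f g} → (∀ x → f x ≡ g x) → Ψ f ≈ Ψ g
    Ψ-cong f≡g = Σ-cong n (λ x → *-congʳ (ν-≡ (f≡g x)))

    Ψ-0 : Ψ (λ _ → 0) ≈ 0#
    Ψ-0 = Σ-0 n (λ x → trans (*-congʳ ν-0) (zeroˡ (e x)))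

    Ψ-+ : ∀ f g → Ψ (λ x → f x ℕ.+ g x) ≈ Ψ f + Ψ g
    Ψ-+ f g = trans (Σ-cong n (λ x → trans (*-congʳ (ν-+ (f x) (g x))) (distribʳ (e x) _ _))) (Σ-+ n _ _)

    Ψ-· : ∀ k f → Ψ (λ x → k ℕ.* f x) ≈ ν k * Ψ f
    Ψ-· k f = trans (Σ-cong n (λ x → trans (*-congʳ (ν-* k (f x))) (*-assoc (ν k) _ (e x)))) (Σ-*ˡ n (ν k) _)

    Ψ-sum : ∀ {k} (f : Fin k → ℤ → ℕ) → Ψ (λ x → ℕΣ.sum (λ m → f m x)) ≈ sum (λ m → Ψ (f m))
    Ψ-sum {zero}  f = Ψ-0
    Ψ-sum {suc k} f = trans (Ψ-+ (f Fin.zero) _) (+-congˡ (Ψ-sum (f ∘ Fin.suc)))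

    -- Put `z = y + x`. For each `x` the sum over `y` becomes a sum over `z` by a shift, which takes
    -- the argument of `g` outside the standard representatives; hence its periodicity.
    Ψ-* : ∀ f {g} → (∀ {x y} → x ≈ y ⟨ n ⟩ → g x ≡ g y) →
          Ψ f * Ψ g ≈ Ψ (λ z → ℕΣ.Σ n (λ x → f x ℕ.* g (z ℤ.- x)))
    Ψ-* f {g} g-per = begin
      Ψ f * Ψ g
        ≈⟨ Σ-*ʳ n (Ψ g) _ ⟨
      Σ n (λ x → ν (f x) * e x * Ψ g)
        ≈⟨ Σ-cong n (λ x → Σ-*ˡ n (ν (f x) * e x) _) ⟨
      Σ n (λ x → Σ n (λ y → ν (f x) * e x * (ν (g y) * e y)))
        ≈⟨ Σ-cong n (λ x → Σ-cong n (λ y → product x y)) ⟩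
      Σ n (λ x → Σ n (λ y → term x (y ℤ.+ x)))
        ≈⟨ Σ-cong n (λ x → Σ-shift n (term-per x) x) ⟩
      Σ n (λ x → Σ n (λ z → term x z))
        ≈⟨ Σ-comm n n term ⟩
      Σ n (λ z → Σ n (λ x → term x z))
        ≈⟨ Σ-cong n (λ z → trans (Σ-*ʳ n (e z) _) (*-congʳ (sym (ν-Σ n _)))) ⟩
      Ψ (λ z → ℕΣ.Σ n (λ x → f x ℕ.* g (z ℤ.- x))) ∎
      where
      term : ℤ → ℤ → Carrier
      term x z = ν (f x ℕ.* g (z ℤ.- x)) * e z

      term-per : ∀ x → Periodic n (term x)
      term-per x {y} {z} y≈z = *-cong (ν-≡ (cong (f x ℕ.*_) (g-per (Mod.+-congʳ {x = ℤ.- x} y≈z)))) (e-cong y≈z)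

      product : ∀ x y → ν (f x) * e x * (ν (g y) * e y) ≈ term x (y ℤ.+ x)
      product x y = begin
        ν (f x) * e x * (ν (g y) * e y)       ≈⟨ interchange (ν (f x)) (e x) (ν (g y)) (e y) ⟩
        ν (f x) * ν (g y) * (e x * e y)
          ≈⟨ *-cong (ν-* (f x) (g y)) (trans (e-+ y x) (*-comm (e y) (e x))) ⟨
        ν (f x ℕ.* g y) * e (y ℤ.+ x)         ≈⟨ *-congʳ (ν-≡ (cong (λ w → f x ℕ.* g w) (cancel x y))) ⟩
        term x (y ℤ.+ x)                      ∎
        where
        cancel : ∀ x y → y ≡ y ℤ.+ x ℤ.- x
        cancel = ℤ-Solver.solve-∀

    Ψ-residues : ∀ {P : Fin n → Set} (P? : Decidable P) (x : Fin n → Carrier) (f : ℤ → ℕ) →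
                 (∀ k → x k ≈ e (ℤ.+ toℕ k)) → (∀ k → f (ℤ.+ toℕ k) ≡ ℕΣ.⟦ P? k ⟧) →
                 foldr _+_ 0# (map x (filter P? (allFin n))) ≈ Ψ f
    Ψ-residues P? x f x≈e f≡ = begin
      foldr _+_ 0# (map x (filter P? (allFin n)))                  ≈⟨ ∑-filter P? x (allFin n) ⟩
      foldr _+_ 0# (map (λ k → ⟦ P? k ⟧ * x k) (allFin n))         ≡⟨ ∑-tabulate id (λ k → ⟦ P? k ⟧ * x k) ⟩
      sum (λ k → ⟦ P? k ⟧ * x k)
        ≈⟨ sum-cong-≋ (λ k → *-cong (trans (sym (ν-⟦⟧ (P? k))) (ν-≡ (≡.sym (f≡ k)))) (x≈e k)) ⟩
      sum {n} (λ k → ν (f (ℤ.+ toℕ k)) * e (ℤ.+ toℕ k))            ≡⟨ Σ-def n _ ⟨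
      Ψ f                                                          ∎

    Ψ-⟦⟧ : ∀ {A : Set} (d : Dec A) f → ⟦ d ⟧ * Ψ f ≈ Ψ (λ x → ℕΣ.⟦ d ⟧ ℕ.* f x)
    Ψ-⟦⟧ d f = trans (*-congʳ (sym (ν-⟦⟧ d))) (sym (Ψ-· ℕΣ.⟦ d ⟧ f))

    Ψ-filter : ∀ {P : ℕ → Set} (P? : Decidable P) k (X : ℕ → Carrier) (f : ℕ → ℤ → ℕ) → (∀ m → X m ≈ Ψ (f m)) →
               foldr _+_ 0# (map X (filter P? (upTo k))) ≈ Ψ (λ x → ℕΣ.sum {k} (λ m → ℕΣ.⟦ P? (toℕ m) ⟧ ℕ.* f (toℕ m) x))
    Ψ-filter P? k X f X≈ = begin
      foldr _+_ 0# (map X (filter P? (upTo k)))                ≈⟨ ∑-filter P? X (upTo k) ⟩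
      foldr _+_ 0# (map (λ m → ⟦ P? m ⟧ * X m) (upTo k))       ≡⟨ ∑-applyUpTo id (λ m → ⟦ P? m ⟧ * X m) k ⟩
      sum {k} (λ m → ⟦ P? (toℕ m) ⟧ * X (toℕ m))
        ≈⟨ sum-cong-≋ {k} (λ m → trans (*-congˡ (X≈ (toℕ m))) (Ψ-⟦⟧ (P? (toℕ m)) (f (toℕ m)))) ⟩
      sum {k} (λ m → Ψ (λ x → ℕΣ.⟦ P? (toℕ m) ⟧ ℕ.* f (toℕ m) x))
        ≈⟨ Ψ-sum {k} _ ⟨
      Ψ (λ x → ℕΣ.sum {k} (λ m → ℕΣ.⟦ P? (toℕ m) ⟧ ℕ.* f (toℕ m) x)) ∎

    -- Meant for the nonresidue case, where `m` with `m - j` odd and even refer to different cosets: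
    -- the two filtered lists are recombined into one sum over `m`.
    Ψ-partition : ∀ {P Q : ℕ → Set} (P? : Decidable P) (Q? : Decidable Q) k (X Y : ℕ → Carrier) (f g : ℕ → ℤ → ℕ) →
                  (∀ m → X m ≈ Ψ (f m)) → (∀ m → Y m ≈ Ψ (g m)) →
                  foldr _+_ 0# (map X (filter (λ m → ¬? (Q? m)) (filter P? (upTo k)))) +
                  foldr _+_ 0# (map Y (filter Q? (filter P? (upTo k)))) ≈
                  Ψ (λ x → ℕΣ.sum {k} (λ m → ℕΣ.⟦ P? (toℕ m) ⟧ ℕ.*
                    (ℕΣ.⟦ ¬? (Q? (toℕ m)) ⟧ ℕ.* f (toℕ m) x ℕ.+ ℕΣ.⟦ Q? (toℕ m) ⟧ ℕ.* g (toℕ m) x)))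
    Ψ-partition P? Q? k X Y f g X≈ Y≈ = trans
      (+-cong (twice (λ m → ¬? (Q? m)) X f X≈) (twice Q? Y g Y≈))
      (trans (sym (Ψ-+ _ _)) (Ψ-cong (λ x → ≡.trans (≡.sym (ℕΣ.∑-distrib-+ {k} _ _))
        (ℕΣ.sum-cong-≋ {k} (λ m → ≡.sym (ℕₚ.*-distribˡ-+ ℕΣ.⟦ P? (toℕ m) ⟧ _ _))))))
      where
      twice : ∀ {Q : ℕ → Set} (Q? : Decidable Q) (X : ℕ → Carrier) (f : ℕ → ℤ → ℕ) → (∀ m → X m ≈ Ψ (f m)) →
              foldr _+_ 0# (map X (filter Q? (filter P? (upTo k)))) ≈
              Ψ (λ x → ℕΣ.sum {k} (λ m → ℕΣ.⟦ P? (toℕ m) ⟧ ℕ.* (ℕΣ.⟦ Q? (toℕ m) ⟧ ℕ.* f (toℕ m) x)))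
      twice Q? X f X≈ = trans (∑-filter Q? X (filter P? (upTo k)))
        (Ψ-filter P? k _ _ (λ m → trans (*-congˡ (X≈ m)) (Ψ-⟦⟧ (Q? m) (f m))))

    Ψ-square : ∀ A A′ B C {X⁺ X⁻ S⁺ S⁻} (f⁺ f⁻ s⁺ s⁻ : ℤ → ℕ) →
               X⁺ ≈ Ψ f⁺ → X⁻ ≈ Ψ f⁻ → S⁺ ≈ Ψ s⁺ → S⁻ ≈ Ψ s⁻ →
               (∀ {x y} → x ≈ y ⟨ n ⟩ → f⁺ x ≡ f⁺ y) →
               (∀ z → ℕΣ.Σ n (λ x → f⁺ x ℕ.* f⁺ (z ℤ.- x)) ≡
                      A ℕ.* (B ℕ.* f⁺ z ℕ.+ C ℕ.* s⁺ z) ℕ.+ A′ ℕ.* (B ℕ.* f⁻ z ℕ.+ C ℕ.* s⁻ z)) →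
               X⁺ * X⁺ ≈ ν A * (ν B * X⁺ + ν C * S⁺) + ν A′ * (ν B * X⁻ + ν C * S⁻)
    Ψ-square A A′ B C {X⁺} {X⁻} {S⁺} {S⁻} f⁺ f⁻ s⁺ s⁻ X⁺≈ X⁻≈ S⁺≈ S⁻≈ f⁺-per formula = begin
      X⁺ * X⁺
        ≈⟨ *-cong X⁺≈ X⁺≈ ⟩
      Ψ f⁺ * Ψ f⁺
        ≈⟨ Ψ-* f⁺ f⁺-per ⟩
      Ψ (λ z → ℕΣ.Σ n (λ x → f⁺ x ℕ.* f⁺ (z ℤ.- x)))
        ≈⟨ Ψ-cong formula ⟩
      Ψ (λ z → A ℕ.* (B ℕ.* f⁺ z ℕ.+ C ℕ.* s⁺ z) ℕ.+ A′ ℕ.* (B ℕ.* f⁻ z ℕ.+ C ℕ.* s⁻ z))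
        ≈⟨ Ψ-+ _ _ ⟩
      Ψ (λ z → A ℕ.* (B ℕ.* f⁺ z ℕ.+ C ℕ.* s⁺ z)) + Ψ (λ z → A′ ℕ.* (B ℕ.* f⁻ z ℕ.+ C ℕ.* s⁻ z))
        ≈⟨ +-cong (combination A f⁺ s⁺ X⁺≈ S⁺≈) (combination A′ f⁻ s⁻ X⁻≈ S⁻≈) ⟩
      ν A * (ν B * X⁺ + ν C * S⁺) + ν A′ * (ν B * X⁻ + ν C * S⁻) ∎
      where
      combination : ∀ A {X S} f s → X ≈ Ψ f → S ≈ Ψ s →
                    Ψ (λ z → A ℕ.* (B ℕ.* f z ℕ.+ C ℕ.* s z)) ≈ ν A * (ν B * X + ν C * S)
      combination A f s X≈ S≈ = trans (Ψ-· A _) (*-congˡ (trans (Ψ-+ _ _)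
        (+-cong (trans (Ψ-· B f) (*-congˡ (sym X≈))) (trans (Ψ-· C s) (*-congˡ (sym S≈))))))

-- The quotient by xⁿ - 1 as a cyclic ring.

module Cyclic where

  open Congruences
  open Expansion

  ≈⇒Congruent : ∀ {c ℓ} (R : CommutativeRing c ℓ) {a x y} → CommutativeRing._≈_ R x y → Congruent R a x y
  ≈⇒Congruent R {a} {x} {y} x≈y = congruent 0# (trans (zeroˡ a) (trans (sym (-‿inverseʳ y)) (+-congʳ (sym x≈y))))
    where open CommutativeRing R

  module _ {c ℓ : Level} (K : CommutativeRing c ℓ) where

    open CommutativeRing K
    open Polynomial K

    X^-+ : ∀ a b → X^ (a ℕ.+ b) ≈ₚ X^ a *ₚ X^ b
    X^-+ zero    b = P.sym (P.*-identityˡ (X^ b))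
      where module P = CommutativeRing polynomialRing
    X^-+ (suc a) b = coeffwise λ k → trans (shift k) (sym (trans (coeff-+ (0# ·ₚ X^ b) (0# ∷ X^ a *ₚ X^ b) k)
      (trans (+-congʳ (trans (coeff-· 0# (X^ b) k) (zeroˡ _))) (+-identityˡ _))))
      where
      shift : ∀ k → coeff (0# ∷ X^ (a ℕ.+ b)) k ≈ coeff (0# ∷ X^ a *ₚ X^ b) k
      shift zero    = refl
      shift (suc k) = coeff-≈ (X^-+ a b) k

  module _ (n l : ℕ) .{{_ : NonZero n}} where

    private
      module K = CommutativeRing (ℤ/ l)
      module Poly = CommutativeRing (Polynomial.polynomialRing (ℤ/ l))
      module Q = CommutativeRing (𝔽[X]/⟨X^ n -1⟩ l)
    open Polynomial (ℤ/ l)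

    private
      lift : ∀ {x y} → x ≈ₚ y → x Q.≈ y
      lift = ≈⇒Congruent polynomialRing

      Xⁿ≈1 : X^ n Q.≈ Q.1#
      Xⁿ≈1 = congruent Poly.1# (Poly.*-identityˡ _)

      drop : ∀ r k → X^ (r ℕ.+ k ℕ.* n) Q.≈ X^ r
      drop r zero    = Q.reflexive (cong X^_ (ℕₚ.+-identityʳ r))
      drop r (suc k) = Q.trans (Q.reflexive (cong X^_ rearrange))
        (Q.trans (lift (X^-+ (ℤ/ l) n (r ℕ.+ k ℕ.* n)))
          (Q.trans (Q.*-cong Xⁿ≈1 (drop r k)) (Q.*-identityˡ (X^ r))))
        where
        rearrange : r ℕ.+ (n ℕ.+ k ℕ.* n) ≡ n ℕ.+ (r ℕ.+ k ℕ.* n)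
        rearrange =
          ≡.trans (≡.sym (ℕₚ.+-assoc r n _)) (≡.trans (cong (ℕ._+ k ℕ.* n) (ℕₚ.+-comm r n)) (ℕₚ.+-assoc n r _))

      X^-% : ∀ k → X^ k Q.≈ X^ (k ℕ.% n)
      X^-% k = Q.trans (Q.reflexive (cong X^_ (ℕ/.m≡m%n+[m/n]*n k n))) (drop (k ℕ.% n) (k ℕ./ n))

      %-cong : ∀ {x y} → x ≈ y ⟨ n ⟩ → x %ℕ n ≡ y %ℕ n
      %-cong {x} {y} x≈y = ≈⇒≡ (n%ℕd<d x n) (n%ℕd<d y n) (Mod.trans (Mod.sym (%ℕ-≈ x n)) (Mod.trans x≈y (%ℕ-≈ y n)))

    X^-residue : ∀ k → X^ k Q.≈ X^ ((ℤ.+ k) %ℕ n)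
    X^-residue = X^-%

    cyclicRing : CyclicRing (𝔽[X]/⟨X^ n -1⟩ l) n
    cyclicRing = record
      { ν      = λ k → constant (ℤ.+ k)
      ; ν-0    = lift (coeffwise λ { zero → K.refl ; (suc _) → K.refl })
      ; ν-1    = Q.refl
      ; ν-+    = λ a b → Q.refl
      ; ν-*    = λ a b → lift (coeffwise λ
          { zero    → K.reflexive (≡.trans (ℤₚ.pos-* a b) (≡.sym (ℤₚ.+-identityʳ _)))
          ; (suc _) → K.refl })
      -- Exponents may be negative integers, so the power of x is taken at the remainder.
      ; e      = λ x → X^ (x %ℕ n)
      ; e-+    = λ x y → Q.trans (Q.reflexive (cong X^_ (%-cong (Mod.+-cong (%ℕ-≈ x n) (%ℕ-≈ y n)))))
          (Q.trans (Q.sym (X^-% (x %ℕ n ℕ.+ y %ℕ n))) (lift (X^-+ (ℤ/ l) (x %ℕ n) (y %ℕ n))))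
      ; e-cong = λ x≈y → Q.reflexive (cong X^_ (%-cong x≈y))
      }

module _ (p q l s t : ℕ) (g : ℤ) (i j : ℕ) where

  open import Data.Nat.Base using (_*_; _∸_; _^_; _/_)
  open CosetSums p q l s t g

  -- The common shape of both formulas. The arguments `u`, `v`, `w` stand for `s - i - 1`,
  -- `t - j - 1` and φ(q ^ (t - j)); `S⁺` and `S⁻` are the two sums over `m`.
  Square : ℕ → ℕ → ℕ → Carrier → Carrier → Set
  Square u v w S⁺ S⁻ = χ i j ⊗ χ i j ≈
    ((p ∸ 3) / 4 * p ^ u) · (((q ∸ 2) * q ^ v) · χ i j ⊕ w · S⁺) ⊕
    (suc p / 4 * p ^ u) · (((q ∸ 2) * q ^ v) · χ* i j ⊕ w · S⁻)

-- The cosets modulo n and their convolution.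

module CosetSquares where

  open Congruences using (_≈_⟨_⟩)
  open import Data.Nat.Base using (_+_; _*_; _^_)

  -- Here `h` is φ(pˢ)/2 and `k` is φ(qᵗ), the two orders of `l`. They are kept as variables, with
  -- what is needed of φ passed as hypotheses.
  module Squares {i j a b p q h k l : ℕ} {g : ℤ}
    (p-prime : Prime p) (q-prime : Prime q) (p≢q : p ≢ q)
    (h-odd : Remainders.Odd h) (h⊥k : Coprime h k) (1≉-1⟨p⟩ : ¬ (1ℤ ≈ -1ℤ ⟨ p ⟩))
    (l-order-p : HasOrder (p ^ suc (i + a)) (ℤ.+ l) h)
    (l-order-q : HasOrder (q ^ suc (j + b)) (ℤ.+ l) k)
    (g-order-p : HasOrder (p ^ suc (i + a)) g (2 * h))
    (g-order-q : HasOrder (q ^ suc (j + b)) g k)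
    (generates-p : ∀ {x} → HasOrder (p ^ suc (i + a)) x (2 * h) →
                   ∀ {u} → ¬ (u ≈ 0ℤ ⟨ p ⟩) → ∃ λ r → u ≈ x ℤ.^ r ⟨ p ^ suc (i + a) ⟩)
    (generates-q : ∀ {x} → HasOrder (q ^ suc (j + b)) x k →
                   ∀ {u} → ¬ (u ≈ 0ℤ ⟨ q ⟩) → ∃ λ r → u ≈ x ℤ.^ r ⟨ q ^ suc (j + b) ⟩)
    where
    open Congruences
    open Counting
    open Convolution
    open Orders
    open Remainders
    open Expansion
    open Cyclic
    open import Data.Nat.Base using (_∸_; _≤_; _<_; pred; _/_; _%_)
    open ℕ∣ using (_∣_; _∣?_; ∣-trans; ∣-refl; m∣m*n; n∣m*n; divides)
    open ≡ using (refl; sym; trans)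

    pˢ qᵗ n : ℕ
    pˢ = p ^ suc (i + a)
    qᵗ = q ^ suc (j + b)
    n = pˢ * qᵗ

    L : ℤ
    L = ℤ.+ l

    instance
      p≢0 : NonZero p
      p≢0 = prime⇒nonZero p-prime
      q≢0 : NonZero q
      q≢0 = prime⇒nonZero q-prime
      k≢0 : NonZero k
      k≢0 = ℕ.>-nonZero (HasOrder.positive l-order-q)
      h≢0 : NonZero h
      h≢0 = ℕ.>-nonZero (HasOrder.positive l-order-p)

    p∣pˢ : p ∣ pˢ
    p∣pˢ = m∣m*n (p ^ (i + a))

    q∣qᵗ : q ∣ qᵗ
    q∣qᵗ = m∣m*n (q ^ (j + b))

    2∤h : ¬ (2 ∣ h)
    2∤h = odd⇒2∤ h-odd

    neg-^h : ∀ x → (ℤ.- x) ℤ.^ h ≡ ℤ.- (x ℤ.^ h)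
    neg-^h x = trans (cong ((ℤ.- x) ℤ.^_) (proj₂ h-odd))
      (trans (neg-^-odd x (proj₁ h-odd)) (cong (λ e → ℤ.- (x ℤ.^ e)) (sym (proj₂ h-odd))))

    -- If `(-l) ^ e = 1`, squaring gives `l ^ (2 * e) = 1`, so `h` divides `2 * e` and, being odd,
    -- divides `e`. The case `e = h` is excluded because `(-l) ^ h = - l ^ h = -1`; hence `e` is at
    -- least `2 * h`.
    -L-primitive : HasOrder pˢ (ℤ.- L) (2 * h)
    -L-primitive = record
      { positive = ℕₚ.<-≤-trans (HasOrder.positive l-order-p) (ℕₚ.m≤m+n h _)
      ; power    = toMod (Mod.trans (Mod.reflexive (trans (neg-^-even L h) (cong (L ℤ.^_) (ℕₚ.*-comm 2 h)))) (power-* l-order-p 2))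
      ; minimal  = λ e e>0 eq → least e e>0 (fromMod _ _ eq)
      }
      where
      bound : ∀ {e} → 0 < e → (ℤ.- L) ℤ.^ e ≈ 1ℤ ⟨ pˢ ⟩ → h ∣ e → 2 * h ≤ e
      bound e>0 eq (divides zero refl)          = contradiction e>0 ℕₚ.n≮0
      bound e>0 eq (divides (suc (suc f)) refl) = ℕₚ.*-monoˡ-≤ h (ℕ.s≤s (ℕ.s≤s (ℕ.z≤n {f})))
      bound e>0 eq (divides 1 refl)             = contradiction (coarsen p∣pˢ 1≈-1) 1≉-1⟨p⟩
        where
        [-L]ʰ≡-Lʰ : (ℤ.- L) ℤ.^ (1 * h) ≡ ℤ.- (L ℤ.^ h)
        [-L]ʰ≡-Lʰ = trans (cong ((ℤ.- L) ℤ.^_) (ℕₚ.*-identityˡ h)) (neg-^h L)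
        1≈-1 : 1ℤ ≈ -1ℤ ⟨ pˢ ⟩
        1≈-1 = Mod.trans (Mod.sym eq) (Mod.trans (Mod.reflexive [-L]ʰ≡-Lʰ) (Mod.-‿cong (order-power l-order-p)))

      least : ∀ e → 0 < e → (ℤ.- L) ℤ.^ e ≈ 1ℤ ⟨ pˢ ⟩ → 2 * h ≤ e
      least e e>0 eq = bound e>0 eq
        (coprime-divisor {n = 2} {o = e} (prime-coprime prime[2] 2∤h) (order-∣ l-order-p (2 * e) square≈1))
        where
        exponents : (ℤ.- L) ℤ.^ (2 * e) ≡ ((ℤ.- L) ℤ.^ e) ℤ.^ 2
        exponents = trans (cong ((ℤ.- L) ℤ.^_) (ℕₚ.*-comm 2 e)) (sym (ℤₚ.^-*-assoc (ℤ.- L) e 2))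
        square≈1 : L ℤ.^ (2 * e) ≈ 1ℤ ⟨ pˢ ⟩
        square≈1 = Mod.trans (Mod.reflexive (trans (sym (neg-^-even L e)) exponents)) (≈1-^ 2 eq)

    ±power : ∀ {u} → ¬ (u ≈ 0ℤ ⟨ p ⟩) → (∃ λ r → u ≈ L ℤ.^ r ⟨ pˢ ⟩) ⊎ (∃ λ r → u ≈ ℤ.- (L ℤ.^ r) ⟨ pˢ ⟩)
    ±power {u} u≉0 = classify (generates-p -L-primitive u≉0)
      where
      classify : (∃ λ r → u ≈ (ℤ.- L) ℤ.^ r ⟨ pˢ ⟩) → (∃ λ r → u ≈ L ℤ.^ r ⟨ pˢ ⟩) ⊎ (∃ λ r → u ≈ ℤ.- (L ℤ.^ r) ⟨ pˢ ⟩)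
      classify (r , u≈) = [ (λ eq → inj₁ (r , Mod.trans u≈ (Mod.reflexive eq)))
                          , (λ eq → inj₂ (r , Mod.trans u≈ (Mod.reflexive eq))) ]′ (neg-^ L r)

    -- Tested modulo `p` only, although powers of `l` modulo `pˢ` are wanted. Nothing is lost:
    -- modulo `pˢ` every unit is a power of `l` or the negative of one, and the residue modulo `p`
    -- tells which.
    P : ℤ → Set
    P x = ∃ λ r → x ≈ L ℤ.^ r ⟨ p ⟩

    P-power-inverse : ∀ r → L ℤ.^ r ℤ.* L ℤ.^ (r * pred h) ≈ 1ℤ ⟨ p ⟩
    P-power-inverse r = coarsen p∣pˢ (power-inverse l-order-p r)

    neg-neg : ∀ x → ℤ.- (ℤ.- x) ≡ x
    neg-neg = ℤₚ.neg-involutive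

    power-≉0 : ∀ {m r} x x′ → Prime r → r ∣ m → x ℤ.* x′ ≈ 1ℤ ⟨ m ⟩ → ¬ (x ≈ 0ℤ ⟨ r ⟩)
    power-≉0 x x′ r-prime r∣m xx′≈1 x≈0 = prime∤1 r-prime (Mod.trans (Mod.sym (coarsen r∣m xx′≈1))
      (Mod.trans (Mod.*-congʳ {x = x′} x≈0) (Mod.zeroˡ x′)))

    -- An odd power of -1 is -1, whereas the h-th power of every power of l is 1.
    P-residues : HalfSystem p P
    P-residues = record
      { P? = P?
      ; P-resp = λ x≈y (r , x≈) → r , Mod.trans (Mod.sym x≈y) x≈
      ; P-1 = 0 , Mod.refl
      ; P-* = λ (r , x≈) (r′ , y≈) → r + r′ , Mod.trans (Mod.*-cong x≈ y≈) (Mod.reflexive (sym (^-+ L r r′)))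
      ; P-inv = λ (r , x≈) → L ℤ.^ (r * pred h) , (r * pred h , Mod.refl) ,
          Mod.trans (Mod.*-congʳ {x = L ℤ.^ (r * pred h)} x≈) (P-power-inverse r)
      ; P-split = split
      ; P-asym = asym
      }
      where
      split : ∀ {x} → ¬ (x ≈ 0ℤ ⟨ p ⟩) → P x ⊎ P (ℤ.- x)
      split x≉0 with ±power x≉0
      ... | inj₁ (r , x≈) = inj₁ (r , coarsen p∣pˢ x≈)
      ... | inj₂ (r , x≈) = inj₂ (r , Mod.trans (Mod.-‿cong (coarsen p∣pˢ x≈)) (Mod.reflexive (neg-neg _)))

      P^h≈1 : ∀ {x} → P x → x ℤ.^ h ≈ 1ℤ ⟨ p ⟩
      P^h≈1 (r , x≈) = Mod.trans (^-cong h x≈) (Mod.trans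
        (Mod.reflexive (trans (ℤₚ.^-*-assoc L r h) (cong (L ℤ.^_) (ℕₚ.*-comm r h))))
        (coarsen p∣pˢ (power-* l-order-p r)))

      asym : ∀ {x} → P x → ¬ P (ℤ.- x)
      asym {x} Px P-x =
        1≉-1⟨p⟩ (Mod.trans (Mod.sym (P^h≈1 P-x)) (Mod.trans (Mod.reflexive (neg-^h x)) (Mod.-‿cong (P^h≈1 Px))))

      P? : ∀ x → Dec (P x)
      P? x with x ≈? 0ℤ ⟨ p ⟩
      ... | yes x≈0 =
        no λ (r , x≈) → power-≉0 (L ℤ.^ r) (L ℤ.^ (r * pred h)) p-prime ∣-refl (P-power-inverse r) (Mod.trans (Mod.sym x≈) x≈0)
      ... | no x≉0 with split x≉0
      ...   | inj₁ Px = yes Px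
      ...   | inj₂ P-x = no λ Px → asym Px P-x

    open HalfSystem P-residues

    P-square : ∀ {x} → ¬ (x ≈ 0ℤ ⟨ p ⟩) → P (x ℤ.* x)
    P-square {x} x≉0 with P-split x≉0
    ... | inj₁ Px = P-* Px Px
    ... | inj₂ P-x = P-resp (Mod.reflexive (identity x)) (P-* P-x P-x)
      where
      identity : ∀ x → ℤ.- x ℤ.* ℤ.- x ≡ x ℤ.* x
      identity = ℤ-Solver.solve-∀

    residue⇒P : QuadraticResidue (ℤ.+ q) p → P (ℤ.+ q)
    residue⇒P (p∤q , x , x²≡q) = P-resp x²≈q (P-square x≉0)
      where
      x²≈q : x ℤ.* x ≈ ℤ.+ q ⟨ p ⟩
      x²≈q = fromMod _ _ x²≡q
      x≉0 : ¬ (x ≈ 0ℤ ⟨ p ⟩)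
      x≉0 x≈0 = p∤q (≈0⇒∣ (Mod.trans (Mod.sym x²≈q) (Mod.trans (Mod.*-congʳ {x = x} x≈0) (Mod.zeroˡ x))))

    -- Since h is odd, l is itself a square modulo p.
    nonresidue⇒P : QuadraticNonresidue (ℤ.+ q) p → P (ℤ.- (ℤ.+ q))
    nonresidue⇒P (p∤q , not-square) with P-split (p∤q ∘ ≈0⇒∣)
    ... | inj₂ P-q = P-q
    ... | inj₁ (r , q≈) = contradiction (root , toMod root²≈q) not-square
      where
      v = proj₁ h-odd
      -- Since `h + 1 = 2 * suc v`, this is `l` to the power `r * (h + 1) / 2`, whose square is
      -- `l ^ (r + h * r) = l ^ r`.
      root = L ℤ.^ (suc v * r)
      exponents : suc v * r + suc v * r ≡ r + h * r
      exponents = trans (identity v r) (cong (λ h → r + h * r) (sym (proj₂ h-odd)))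
        where
        identity : ∀ v r → suc v * r + suc v * r ≡ r + suc (2 * v) * r
        identity = solve-∀
      root²≈q : root ℤ.* root ≈ ℤ.+ q ⟨ p ⟩
      root²≈q = Mod.trans (Mod.reflexive (trans (sym (^-+ L (suc v * r) (suc v * r)))
          (trans (cong (L ℤ.^_) exponents) (^-+ L r (h * r)))))
        (Mod.trans (Mod.*-congˡ {x = L ℤ.^ r} (coarsen p∣pˢ (power-* l-order-p r)))
          (Mod.trans (Mod.*-identityʳ (L ℤ.^ r)) (Mod.sym q≈)))

    p⊥q : Coprime p q
    p⊥q =
      prime-coprime q-prime λ q∣p → [ (λ q≡1 → prime∤1 q-prime (subst (1ℤ ≈ 0ℤ ⟨_⟩) (sym q≡1) (congruent 1ℤ refl))) , (λ q≡p → p≢q (sym q≡p)) ]′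
      (prime⇒irreducible p-prime q∣p)

    pˢ⊥qᵗ : Coprime pˢ qᵗ
    pˢ⊥qᵗ = coprime-^ (Coprimality.sym (coprime-^ (Coprimality.sym p⊥q) (suc (i + a)))) (suc (j + b))

    prime-≉0-* : ∀ {r} → Prime r → ∀ x y → ¬ (x ≈ 0ℤ ⟨ r ⟩) → ¬ (y ≈ 0ℤ ⟨ r ⟩) → ¬ (x ℤ.* y ≈ 0ℤ ⟨ r ⟩)
    prime-≉0-* {r} r-prime x y x≉0 y≉0 xy≈0
      with euclidsLemma ℤ.∣ x ∣ ℤ.∣ y ∣ r-prime (subst (r ∣_) (ℤₚ.abs-* x y) (∣⇒∣ᵤ (≈0⇒∣ xy≈0)))
    ... | inj₁ r∣x = x≉0 (∣⇒≈0 (∣ᵤ⇒∣ r∣x))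
    ... | inj₂ r∣y = y≉0 (∣⇒≈0 (∣ᵤ⇒∣ r∣y))

    -- The exponents of `l` representing `u` modulo `pˢ` and modulo `qᵗ` matter only modulo `h` and
    -- `k`; these are coprime, so one exponent serves for both.
    l-generates : ∀ {u} → P u → ¬ (u ≈ 0ℤ ⟨ q ⟩) → ∃ λ r → u ≈ L ℤ.^ r ⟨ n ⟩
    l-generates {u} Pu u≉0 =
      [ (λ (r , u≈) → combine r u≈ (generates-q l-order-q u≉0)) , impossible ]′ (±power (P-≉0 Pu))
      where
      combine : ∀ r → u ≈ L ℤ.^ r ⟨ pˢ ⟩ → (∃ λ r′ → u ≈ L ℤ.^ r′ ⟨ qᵗ ⟩) → ∃ λ c → u ≈ L ℤ.^ c ⟨ n ⟩
      combine r u≈ (r′ , u≈′) = conclude (chinese-remainder h⊥k r r′)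
        where
        conclude : (∃ λ c → ℤ.+ c ≈ ℤ.+ r ⟨ h ⟩ × ℤ.+ c ≈ ℤ.+ r′ ⟨ k ⟩) → ∃ λ c → u ≈ L ℤ.^ c ⟨ n ⟩
        conclude (c , c≈r , c≈r′) = c , ≈-combine pˢ⊥qᵗ
          (Mod.trans u≈ (Mod.sym (power-resp-≈ l-order-p c≈r)))
          (Mod.trans u≈′ (Mod.sym (power-resp-≈ l-order-q c≈r′)))

      impossible : (∃ λ r → u ≈ ℤ.- (L ℤ.^ r) ⟨ pˢ ⟩) → ∃ λ c → u ≈ L ℤ.^ c ⟨ n ⟩
      impossible (r , u≈) =
        contradiction (r , Mod.trans (Mod.-‿cong (coarsen p∣pˢ u≈)) (Mod.reflexive (neg-neg _))) (P-asym Pu)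

    L≉0 : ∀ r → ¬ (L ℤ.^ r ≈ 0ℤ ⟨ q ⟩)
    L≉0 r = power-≉0 (L ℤ.^ r) (L ℤ.^ (r * pred k)) q-prime q∣qᵗ (power-inverse l-order-q r)

    -- The orders of `g` modulo `pˢ` and `qᵗ` are `2 * h` and `k`, so `g ^ (2 * h * k)` is 1 modulo
    -- `n`.
    g⁻¹ : ℤ
    g⁻¹ = g ℤ.^ pred (2 * h * k)

    g*g⁻¹≈1 : g ℤ.* g⁻¹ ≈ 1ℤ ⟨ n ⟩
    g*g⁻¹≈1 =
      Mod.trans (Mod.reflexive (cong (g ℤ.^_) (ℕₚ.suc-pred (2 * h * k) {{ℕₚ.m*n≢0 (2 * h) k {{ℕ.>-nonZero (HasOrder.positive g-order-p)}}}})))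
      (≈-combine pˢ⊥qᵗ (power-* g-order-p k) (Mod.trans (Mod.reflexive (cong (g ℤ.^_) (ℕₚ.*-comm (2 * h) k))) (power-* g-order-q (2 * h))))

    p∣n : p ∣ n
    p∣n = ∣-trans p∣pˢ (m∣m*n qᵗ)

    q∣n : q ∣ n
    q∣n = ∣-trans q∣qᵗ (n∣m*n pˢ)

    g≉0⟨q⟩ : ¬ (g ≈ 0ℤ ⟨ q ⟩)
    g≉0⟨q⟩ = power-≉0 g g⁻¹ q-prime q∣n g*g⁻¹≈1

    g⁻¹*g≈1 : g⁻¹ ℤ.* g ≈ 1ℤ ⟨ n ⟩
    g⁻¹*g≈1 = Mod.trans (Mod.reflexive (ℤₚ.*-comm g⁻¹ g)) g*g⁻¹≈1

    -- A power of `l` has `h`-th power 1 modulo `pˢ`, whereas `g` has order `2 * h`; so `g` is the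
    -- negative of a power of `l`.
    P-g : P (ℤ.- g)
    P-g = [ impossible , (λ (r , g≈) → r , Mod.trans (Mod.-‿cong (coarsen p∣pˢ g≈)) (Mod.reflexive (neg-neg _))) ]′
      (±power (power-≉0 g g⁻¹ p-prime p∣n g*g⁻¹≈1))
      where
      h<2h : h < 2 * h
      h<2h = subst (h <_) (cong (h +_) (sym (ℕₚ.+-identityʳ h))) (ℕₚ.m<m+n h (HasOrder.positive l-order-p))

      impossible : (∃ λ r → g ≈ L ℤ.^ r ⟨ pˢ ⟩) → P (ℤ.- g)
      impossible (r , g≈) =
        contradiction (HasOrder.minimal g-order-p h (HasOrder.positive l-order-p) (toMod gʰ≈1)) (ℕₚ.<⇒≱ h<2h)
        where
        gʰ≈1 : g ℤ.^ h ≈ 1ℤ ⟨ pˢ ⟩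
        gʰ≈1 = Mod.trans (^-cong h g≈) (Mod.trans
          (Mod.reflexive (trans (ℤₚ.^-*-assoc L r h) (cong (L ℤ.^_) (ℕₚ.*-comm r h))))
          (power-* l-order-p r))

    infixr 8 _⊙_

    _⊙_ : Sign → ℤ → ℤ
    Sign.+ ⊙ x = x
    Sign.- ⊙ x = ℤ.- x

    ⊙-*-comm : ∀ σ x y → σ ⊙ (x ℤ.* y) ≡ x ℤ.* σ ⊙ y
    ⊙-*-comm Sign.+ x y = refl
    ⊙-*-comm Sign.- x y = ℤₚ.neg-distribʳ-* x y

    ⊙-cong : ∀ {m} σ {x y} → x ≈ y ⟨ m ⟩ → σ ⊙ x ≈ σ ⊙ y ⟨ m ⟩
    ⊙-cong Sign.+ x≈y = x≈y
    ⊙-cong Sign.- x≈y = Mod.-‿cong x≈y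

    -- The sign + selects the cosets of `χ`, the sign - those of `χ*`. Because `-g` lies in `P`, the
    -- sign is also the one that carries the cofactor `u` into `P`.
    rep : Sign → ℕ → ℤ
    rep Sign.+ m = ℤ.+ (p ^ i * q ^ m)
    rep Sign.- m = ℤ.+ (p ^ i * q ^ m) ℤ.* g

    Coset : ℤ → ℤ → Set
    Coset κ x = ∃ λ r → x ≈ κ ℤ.* L ℤ.^ r ⟨ n ⟩

    Classified : Sign → ℤ → Set
    Classified σ u = ¬ (u ≈ 0ℤ ⟨ q ⟩) × P (σ ⊙ u)

    coset⇒classified : ∀ σ m {x} → Coset (rep σ m) x → ∃ λ u → Classified σ u × x ≈ ℤ.+ (p ^ i * q ^ m) ℤ.* u ⟨ n ⟩
    coset⇒classified Sign.+ m (r , x≈) = L ℤ.^ r , (L≉0 r , r , Mod.refl) , x≈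
    coset⇒classified Sign.- m (r , x≈) = g ℤ.* L ℤ.^ r ,
      (prime-≉0-* q-prime g (L ℤ.^ r) g≉0⟨q⟩ (L≉0 r) ,
        P-resp (Mod.reflexive (sym (ℤₚ.neg-distribˡ-* g (L ℤ.^ r)))) (P-* P-g (r , Mod.refl))) ,
      Mod.trans x≈ (Mod.reflexive (ℤₚ.*-assoc (ℤ.+ (p ^ i * q ^ m)) g (L ℤ.^ r)))

    classified⇒coset : ∀ σ m {x} u → Classified σ u → x ≈ ℤ.+ (p ^ i * q ^ m) ℤ.* u ⟨ n ⟩ → Coset (rep σ m) x
    classified⇒coset Sign.+ m {x} u (u≉0 , Pu) x≈ = conclude (l-generates Pu u≉0)
      where
      conclude : (∃ λ r → u ≈ L ℤ.^ r ⟨ n ⟩) → Coset (rep Sign.+ m) x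
      conclude (r , u≈) = r , Mod.trans x≈ (Mod.*-congˡ {x = ℤ.+ (p ^ i * q ^ m)} {u} {L ℤ.^ r} u≈)
    classified⇒coset Sign.- m {x} u (u≉0 , P-u) x≈ = conclude (l-generates Pw w≉0⟨q⟩)
      where
      w : ℤ
      -- Then `u = g * w`, and since `-g` and `-u` lie in `P`, so does `w`; it is therefore a power
      -- of `l`.
      w = g⁻¹ ℤ.* u
      gw≈u : g ℤ.* w ≈ u ⟨ n ⟩
      gw≈u =
        Mod.trans (Mod.reflexive (sym (ℤₚ.*-assoc g g⁻¹ u))) (Mod.trans (Mod.*-congʳ {x = u} g*g⁻¹≈1) (Mod.*-identityˡ u))
      w≉0⟨q⟩ : ¬ (w ≈ 0ℤ ⟨ q ⟩)
      w≉0⟨q⟩ = prime-≉0-* q-prime g⁻¹ u (power-≉0 g⁻¹ g q-prime q∣n g⁻¹*g≈1) u≉0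
      Pw : P w
      Pw =
        P-cancelˡ {ℤ.- g} {w} P-g (P-resp (Mod.trans (Mod.-‿cong (coarsen p∣n (Mod.sym gw≈u))) (Mod.reflexive (ℤₚ.neg-distribˡ-* g w))) P-u)
      conclude : (∃ λ r → w ≈ L ℤ.^ r ⟨ n ⟩) → Coset (rep Sign.- m) x
      conclude (r , w≈) = r , Mod.trans x≈ (Mod.trans
        (Mod.*-congˡ {x =
          ℤ.+ (p ^ i * q ^ m)} {u} {g ℤ.* L ℤ.^ r} (Mod.trans (Mod.sym gw≈u) (Mod.*-congˡ {x = g} {w} {L ℤ.^ r} w≈)))
        (Mod.reflexive (sym (ℤₚ.*-assoc (ℤ.+ (p ^ i * q ^ m)) g (L ℤ.^ r)))))

    -- The cosets involved consist of multiples of `D`, so an exponent `D * c` modulo `n = D * M`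
    -- amounts to `c` modulo `M`.
    D M : ℕ
    D = p ^ i * q ^ j
    M = p ^ suc a * q ^ suc b

    n≡D*M : n ≡ D * M
    n≡D*M = trans (cong₂ _*_ (split p i a) (split q j b)) (interchange (p ^ i) (p ^ suc a) (q ^ j) (q ^ suc b))
      where
      split : ∀ r i a → r ^ suc (i + a) ≡ r ^ i * r ^ suc a
      split r i a = trans (cong (r ^_) (sym (ℕₚ.+-suc i a))) (ℕₚ.^-distribˡ-+-* r i (suc a))
      interchange : ∀ x y u v → (x * y) * (u * v) ≡ (x * u) * (y * v)
      interchange = solve-∀

    instance
      D≢0 : NonZero D
      D≢0 = ℕₚ.m*n≢0 (p ^ i) (q ^ j) {{ℕₚ.m^n≢0 p i}} {{ℕₚ.m^n≢0 q j}}

    D-split : ∀ e u → ℤ.+ (p ^ i * q ^ (j + e)) ℤ.* u ≡ ℤ.+ D ℤ.* (ℤ.+ (q ^ e) ℤ.* u)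
    D-split e u =
      trans (cong (ℤ._* u) (trans (cong ℤ.+_ exponents) (ℤₚ.pos-* D (q ^ e)))) (ℤₚ.*-assoc (ℤ.+ D) (ℤ.+ (q ^ e)) u)
      where
      exponents : p ^ i * q ^ (j + e) ≡ D * q ^ e
      exponents = trans (cong (p ^ i *_) (ℕₚ.^-distribˡ-+-* q j e)) (sym (ℕₚ.*-assoc (p ^ i) (q ^ j) (q ^ e)))

    coset⇒multiple : ∀ σ e {x} → Coset (rep σ (j + e)) x → x ≈ 0ℤ ⟨ D ⟩
    coset⇒multiple σ e {x} κ∋x = conclude (coset⇒classified σ (j + e) κ∋x)
      where
      identity : ∀ d z → z ℤ.* d ≡ d ℤ.* z ℤ.- 0ℤ
      identity = ℤ-Solver.solve-∀
      conclude : (∃ λ u → Classified σ u × x ≈ ℤ.+ (p ^ i * q ^ (j + e)) ℤ.* u ⟨ n ⟩) → x ≈ 0ℤ ⟨ D ⟩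
      conclude (u , _ , x≈) = Mod.trans (coarsen (divides M (trans n≡D*M (ℕₚ.*-comm D M))) x≈)
        (Mod.trans (Mod.reflexive (D-split e u)) (congruent (ℤ.+ (q ^ e) ℤ.* u) (identity (ℤ.+ D) (ℤ.+ (q ^ e) ℤ.* u))))

    -- The condition on c that p ^ i q ^ j c has q-part q ^ (j + e) in ℤ/n,
    -- where q-parts are capped at q ^ suc (j + b).
    Exact : ℕ → ℤ → Set
    Exact e c = c ≈ 0ℤ ⟨ q ^ e ⟩ × (e < suc b → ¬ (c ≈ 0ℤ ⟨ q ^ suc e ⟩))

    exact? : ∀ e c → Dec (Exact e c)
    exact? e c = (c ≈? 0ℤ ⟨ q ^ e ⟩) ×-dec ((e ℕₚ.<? suc b) →-dec ¬? (c ≈? 0ℤ ⟨ q ^ suc e ⟩))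

    q^≉0⟨p⟩ : ∀ e → ¬ (ℤ.+ (q ^ e) ≈ 0ℤ ⟨ p ⟩)
    q^≉0⟨p⟩ e qᵉ≈0 =
      prime∤1 p-prime (subst (1ℤ ≈ 0ℤ ⟨_⟩) (sym (coprime-^ p⊥q e (∣-refl , ∣⇒∣ᵤ (≈0⇒∣ qᵉ≈0)))) (congruent 1ℤ refl))

    pˢ≉0⟨q⟩ : ¬ (ℤ.+ pˢ ≈ 0ℤ ⟨ q ⟩)
    pˢ≉0⟨q⟩ pˢ≈0 = prime∤1 q-prime (subst (1ℤ ≈ 0ℤ ⟨_⟩)
      (sym (coprime-^ (Coprimality.sym p⊥q) (suc (i + a)) (∣-refl , ∣⇒∣ᵤ (≈0⇒∣ pˢ≈0)))) (congruent 1ℤ refl))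

    P-q²ᵉ : ∀ e → P (ℤ.+ (q ^ e) ℤ.* ℤ.+ (q ^ e))
    P-q²ᵉ e = P-square (q^≉0⟨p⟩ e)

    q²ᵉ-out : ∀ σ e u → σ ⊙ (ℤ.+ (q ^ e) ℤ.* (ℤ.+ (q ^ e) ℤ.* u)) ≡ (ℤ.+ (q ^ e) ℤ.* ℤ.+ (q ^ e)) ℤ.* σ ⊙ u
    q²ᵉ-out σ e u =
      trans (cong (σ ⊙_) (sym (ℤₚ.*-assoc (ℤ.+ (q ^ e)) (ℤ.+ (q ^ e)) u))) (⊙-*-comm σ (ℤ.+ (q ^ e) ℤ.* ℤ.+ (q ^ e)) u)

    qᵉ*≈0 : ∀ e u → ℤ.+ (q ^ e) ℤ.* u ≈ 0ℤ ⟨ q ^ e ⟩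
    qᵉ*≈0 e u = congruent u (identity u (ℤ.+ (q ^ e)))
      where
      identity : ∀ u z → u ℤ.* z ≡ z ℤ.* u ℤ.- 0ℤ
      identity = ℤ-Solver.solve-∀

    q*qᵉ≡ : ∀ e → q ^ suc e ≡ q ^ e * q
    q*qᵉ≡ e = ℕₚ.*-comm q (q ^ e)

    q^-∣ : ∀ {d e} → d ≤ e → q ^ d ∣ q ^ e
    q^-∣ {d} {e} d≤e =
      divides (q ^ (e ∸ d)) (trans (cong (q ^_) (sym (ℕₚ.m∸n+n≡m d≤e))) (ℕₚ.^-distribˡ-+-* q (e ∸ d) d))

    -- Modulo `M` one has `c = q ^ e * u`, and the sign condition concerns `u`. It is expressed
    -- through `c` without division: `q ^ e * c` is `q ^ e * q ^ e * u`, and the square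
    -- `q ^ e * q ^ e` lies in `P`.
    coset⇒exact : ∀ σ {e} → e ≤ suc b → ∀ c → Coset (rep σ (j + e)) (ℤ.+ D ℤ.* c) →
                  Exact e c × P (σ ⊙ (ℤ.+ (q ^ e) ℤ.* c))
    coset⇒exact σ {e} e≤ c κ∋ = conclude (coset⇒classified σ (j + e) κ∋)
      where
      p∣M : p ∣ M
      p∣M = ∣-trans (m∣m*n (p ^ a)) (m∣m*n (q ^ suc b))

      q^∣M : ∀ {e} → e ≤ suc b → q ^ e ∣ M
      q^∣M e≤ = ∣-trans (q^-∣ e≤) (n∣m*n (p ^ suc a))

      conclude : (∃ λ u → Classified σ u × ℤ.+ D ℤ.* c ≈ ℤ.+ (p ^ i * q ^ (j + e)) ℤ.* u ⟨ n ⟩) →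
                 Exact e c × P (σ ⊙ (ℤ.+ (q ^ e) ℤ.* c))
      conclude (u , (u≉0 , Pu) , Dc≈) = (Mod.trans (coarsen (q^∣M e≤) c≈) (qᵉ*≈0 e u) , not-more) ,
        P-resp (Mod.trans (Mod.reflexive (sym (q²ᵉ-out σ e u)))
                  (⊙-cong σ (Mod.*-congˡ {x = ℤ.+ (q ^ e)} {ℤ.+ (q ^ e) ℤ.* u} {c} (Mod.sym (coarsen p∣M c≈)))))
          (P-* (P-q²ᵉ e) Pu)
        where
        c≈ : c ≈ ℤ.+ (q ^ e) ℤ.* u ⟨ M ⟩
        c≈ = unscale D (subst (ℤ.+ D ℤ.* c ≈ ℤ.+ D ℤ.* (ℤ.+ (q ^ e) ℤ.* u) ⟨_⟩) n≡D*M
          (Mod.trans Dc≈ (Mod.reflexive (D-split e u))))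

        not-more : e < suc b → ¬ (c ≈ 0ℤ ⟨ q ^ suc e ⟩)
        not-more e< c≈0 = u≉0 (unscale (q ^ e) {{ℕₚ.m^n≢0 q e}}
          (subst (ℤ.+ (q ^ e) ℤ.* u ≈ ℤ.+ (q ^ e) ℤ.* 0ℤ ⟨_⟩) (q*qᵉ≡ e)
            (Mod.trans (Mod.sym (coarsen (q^∣M e<) c≈)) (Mod.trans c≈0 (Mod.reflexive (sym (ℤₚ.*-zeroʳ (ℤ.+ (q ^ e)))))))))

    exact⇒coset : ∀ σ {e} → e ≤ suc b → ∀ c → Exact e c → P (σ ⊙ (ℤ.+ (q ^ e) ℤ.* c)) →
                  Coset (rep σ (j + e)) (ℤ.+ D ℤ.* c)
    exact⇒coset σ {e} e≤ c (congruent u uqᵉ≡c , not-more) Pc = by-cases (u ≈? 0ℤ ⟨ q ⟩)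
      where
      c≡ : c ≡ ℤ.+ (q ^ e) ℤ.* u
      c≡ = trans (trans (sym (ℤₚ.+-identityʳ c)) (sym uqᵉ≡c)) (ℤₚ.*-comm u (ℤ.+ (q ^ e)))

      Dc≡ : ℤ.+ D ℤ.* c ≡ ℤ.+ (p ^ i * q ^ (j + e)) ℤ.* u
      Dc≡ = trans (cong (ℤ.+ D ℤ.*_) c≡) (sym (D-split e u))

      Pu : P (σ ⊙ u)
      Pu =
        P-cancelˡ {ℤ.+ (q ^ e) ℤ.* ℤ.+ (q ^ e)} {σ ⊙ u} (P-q²ᵉ e) (P-resp (Mod.reflexive (trans (cong (λ c → σ ⊙ (ℤ.+ (q ^ e) ℤ.* c)) c≡) (q²ᵉ-out σ e u))) Pc)

      -- When the q-part is capped, u can be corrected to a unit modulo q.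
      capped : u ≈ 0ℤ ⟨ q ⟩ → e ≡ suc b → Coset (rep σ (j + e)) (ℤ.+ D ℤ.* c)
      capped u≈0 refl = classified⇒coset σ (j + suc b) (u ℤ.+ ℤ.+ pˢ) (u+pˢ≉0 , P-resp (⊙-cong σ (Mod.sym u+pˢ≈u)) Pu)
        (Mod.trans (Mod.reflexive Dc≡) (Mod.sym (congruent (ℤ.+ (p ^ i)) multiple)))
        where
        u+pˢ≉0 : ¬ (u ℤ.+ ℤ.+ pˢ ≈ 0ℤ ⟨ q ⟩)
        u+pˢ≉0 eq =
          pˢ≉0⟨q⟩ (Mod.trans (Mod.sym (Mod.trans (Mod.+-congʳ {x = ℤ.+ pˢ} u≈0) (Mod.+-identityˡ (ℤ.+ pˢ)))) eq)
        u+pˢ≈u : u ℤ.+ ℤ.+ pˢ ≈ u ⟨ p ⟩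
        u+pˢ≈u = Mod.trans (Mod.+-congˡ {x = u} (∣⇒≈0 (∣ᵤ⇒∣ p∣pˢ))) (Mod.+-identityʳ u)
        κ : ℕ
        κ = p ^ i * q ^ (j + suc b)
        -- As `κ` is `p ^ i * qᵗ`, adding `pˢ` to `u` changes `κ * u` by `p ^ i * n`, a multiple of
        -- `n`. It also keeps `u` modulo `p`, and turns 0 modulo `q` into a unit.
        multiple : ℤ.+ (p ^ i) ℤ.* ℤ.+ n ≡ ℤ.+ κ ℤ.* (u ℤ.+ ℤ.+ pˢ) ℤ.- ℤ.+ κ ℤ.* u
        multiple =
          trans (sym (ℤₚ.pos-* (p ^ i) n)) (trans (cong ℤ.+_ products) (trans (ℤₚ.pos-* κ pˢ) (identity (ℤ.+ κ) u (ℤ.+ pˢ))))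
          where
          products : p ^ i * n ≡ κ * pˢ
          products =
            trans (cong (λ z → p ^ i * (pˢ * q ^ z)) (sym (ℕₚ.+-suc j b))) (rearrange (p ^ i) pˢ (q ^ (j + suc b)))
            where
            rearrange : ∀ x y z → x * (y * z) ≡ (x * z) * y
            rearrange = solve-∀
          identity : ∀ κ u z → κ ℤ.* z ≡ κ ℤ.* (u ℤ.+ z) ℤ.- κ ℤ.* u
          identity = ℤ-Solver.solve-∀

      more : u ≈ 0ℤ ⟨ q ⟩ → c ≈ 0ℤ ⟨ q ^ suc e ⟩
      more u≈0 = Mod.trans (Mod.reflexive c≡) (subst (ℤ.+ (q ^ e) ℤ.* u ≈ 0ℤ ⟨_⟩) (sym (q*qᵉ≡ e))
        (Mod.trans (scale (q ^ e) u≈0) (Mod.reflexive (ℤₚ.*-zeroʳ (ℤ.+ (q ^ e))))))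

      by-cases : Dec (u ≈ 0ℤ ⟨ q ⟩) → Coset (rep σ (j + e)) (ℤ.+ D ℤ.* c)
      by-cases (no u≉0)  = classified⇒coset σ (j + e) u (u≉0 , Pu) (Mod.reflexive Dc≡)
      by-cases (yes u≈0) = capped u≈0 (ℕₚ.≤-antisym e≤ (ℕₚ.≮⇒≥ (λ e< → not-more e< (more u≈0))))

    instance
      n≢0 : NonZero n
      n≢0 = ℕₚ.m*n≢0 pˢ qᵗ {{ℕₚ.m^n≢0 p (suc (i + a))}} {{ℕₚ.m^n≢0 q (suc (j + b))}}

    coset-resp : ∀ κ {x y} → x ≈ y ⟨ n ⟩ → Coset κ x → Coset κ y
    coset-resp κ x≈y (r , x≈) = r , Mod.trans (Mod.sym x≈y) x≈

    coset? : ∀ κ x → Dec (Coset κ x)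
    coset? κ x = map′ to from (inCoset? l n κ residue)
      where
      residue : Fin n
      residue = fromℕ< (n%ℕd<d x n)
      x≈ : x ≈ ℤ.+ toℕ residue ⟨ n ⟩
      x≈ = subst (λ k → x ≈ ℤ.+ k ⟨ n ⟩) (sym (Finₚ.toℕ-fromℕ< (n%ℕd<d x n))) (%ℕ-≈ x n)
      to : InCoset l n κ residue → Coset κ x
      to (r , eq) = r , Mod.trans x≈ (fromMod _ _ eq)
      from : Coset κ x → InCoset l n κ residue
      from (r , eq) = r , toMod (Mod.trans (Mod.sym x≈) eq)

    I : Sign → ℕ → ℤ → ℕ
    I σ m x = ⟦ coset? (rep σ m) x ⟧

    I-residue : ∀ σ m (α : Fin n) → I σ m (ℤ.+ toℕ α) ≡ ⟦ inCoset? l n (rep σ m) α ⟧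
    I-residue σ m α = ⟦⟧-cong _ _ (λ (r , eq) → r , toMod eq) (λ (r , eq) → r , fromMod _ _ eq)

    I-periodic : ∀ σ m → Periodic n (I σ m)
    I-periodic σ m x≈y = ⟦⟧-cong _ _ (coset-resp (rep σ m) x≈y) (coset-resp (rep σ m) (Mod.sym x≈y))

    I-nonmultiple : ∀ σ e {x} → ¬ (x ≈ 0ℤ ⟨ D ⟩) → I σ (j + e) x ≡ 0
    I-nonmultiple σ e {x} x≉0 = ⟦⟧-no (coset? (rep σ (j + e)) x) (x≉0 ∘ coset⇒multiple σ e)

    ⟦⟧-× : ∀ {A B : Set} (d : Dec A) (d′ : Dec B) → ⟦ d ×-dec d′ ⟧ ≡ ⟦ d ⟧ * ⟦ d′ ⟧
    ⟦⟧-× d@(yes a) d′@(yes b) = trans (⟦⟧-yes (d ×-dec d′) (a , b)) (sym (cong₂ _*_ (⟦⟧-yes d a) (⟦⟧-yes d′ b)))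
    ⟦⟧-× d@(yes a) d′@(no ¬b) =
      trans (⟦⟧-no (d ×-dec d′) (¬b ∘ proj₂)) (sym (trans (cong (⟦ d ⟧ *_) (⟦⟧-no d′ ¬b)) (ℕₚ.*-zeroʳ ⟦ d ⟧)))
    ⟦⟧-× d@(no ¬a) d′         = trans (⟦⟧-no (d ×-dec d′) (¬a ∘ proj₁)) (sym (cong (_* ⟦ d′ ⟧) (⟦⟧-no d ¬a)))

    ⊙-⊙-* : ∀ η σ x y → (η Sign.* σ) ⊙ (x ℤ.* y) ≡ (η ⊙ x) ℤ.* (σ ⊙ y)
    ⊙-⊙-* Sign.+ Sign.+ x y = refl
    ⊙-⊙-* Sign.+ Sign.- x y = ℤₚ.neg-distribʳ-* x y
    ⊙-⊙-* Sign.- Sign.+ x y = ℤₚ.neg-distribˡ-* x y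
    ⊙-⊙-* Sign.- Sign.- x y = identity x y
      where
      identity : ∀ x y → x ℤ.* y ≡ ℤ.- x ℤ.* ℤ.- y
      identity = ℤ-Solver.solve-∀

    -- The sign `η` is that of `q ^ e` relative to `P`. Since `(η * σ) ⊙ (q ^ e * c)` is the product
    -- of `η ⊙ q ^ e` and `σ ⊙ c`, membership depends on `σ ⊙ c` alone. This is where the quadratic
    -- character of `q` enters.
    I-multiple : ∀ η σ {e} → e ≤ suc b → P (η ⊙ ℤ.+ (q ^ e)) → ∀ c →
                 I (η Sign.* σ) (j + e) (ℤ.+ D ℤ.* c) ≡ ⟦ exact? e c ⟧ * ⟦ P? (σ ⊙ c) ⟧
    I-multiple η σ {e} e≤ Pη c = trans
      (⟦⟧-cong _ (exact? e c ×-dec P? (σ ⊙ c)) (to ∘ coset⇒exact (η Sign.* σ) e≤ c) from)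
      (⟦⟧-× (exact? e c) (P? (σ ⊙ c)))
      where
      to : Exact e c × P ((η Sign.* σ) ⊙ (ℤ.+ (q ^ e) ℤ.* c)) → Exact e c × P (σ ⊙ c)
      to (exact , Pc) =
        exact , P-cancelˡ {η ⊙ ℤ.+ (q ^ e)} {σ ⊙ c} Pη (P-resp (Mod.reflexive (⊙-⊙-* η σ (ℤ.+ (q ^ e)) c)) Pc)
      from : Exact e c × P (σ ⊙ c) → Coset (rep (η Sign.* σ) (j + e)) (ℤ.+ D ℤ.* c)
      from (exact , Pc) =
        exact⇒coset (η Sign.* σ) e≤ c exact (P-resp (Mod.reflexive (sym (⊙-⊙-* η σ (ℤ.+ (q ^ e)) c))) (P-* Pη Pc))

    I-j : ∀ σ c → I σ j (ℤ.+ D ℤ.* c) ≡ ⟦ P? (σ ⊙ c) ⟧ * ⟦ unit? q c ⟧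
    I-j σ c = trans (cong (λ m → I σ m (ℤ.+ D ℤ.* c)) (sym (ℕₚ.+-identityʳ j)))
      (trans (I-multiple Sign.+ σ ℕ.z≤n P-1 c) (trans (ℕₚ.*-comm ⟦ exact? 0 c ⟧ ⟦ P? (σ ⊙ c) ⟧)
        (cong (⟦ P? (σ ⊙ c) ⟧ *_) (⟦⟧-cong (exact? 0 c) (unit? q c) to from))))
      where
      to : Exact 0 c → ¬ (c ≈ 0ℤ ⟨ q ⟩)
      to (_ , not-more) c≈0 = not-more ℕ.z<s (subst (c ≈ 0ℤ ⟨_⟩) (sym (ℕₚ.*-identityʳ q)) c≈0)
      from : ¬ (c ≈ 0ℤ ⟨ q ⟩) → Exact 0 c
      from c≉0 = congruent c (trans (ℤₚ.*-identityʳ c) (sym (ℤₚ.+-identityʳ c))) ,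
        λ _ c≈0 → c≉0 (subst (c ≈ 0ℤ ⟨_⟩) (ℕₚ.*-identityʳ q) c≈0)

    -- The classes sort the multiples of `q` by their q-part: each consists of the multiples of
    -- `q ^ suc e` that are not multiples of the next power, and the last, capped class keeps all
    -- multiples of `q ^ suc b`.
    sum-exact : ∀ c → sum {suc b} (λ e → ⟦ exact? (suc (toℕ e)) c ⟧) ≡ ⟦ c ≈? 0ℤ ⟨ q ⟩ ⟧
    sum-exact c = trans
      (sum-telescope (λ e → ⟦ exact? (suc e) c ⟧) (λ e → ⟦ c ≈? 0ℤ ⟨ q ^ suc e ⟩ ⟧) b step last)
      (⟦⟧-cong _ _ (subst (c ≈ 0ℤ ⟨_⟩) (ℕₚ.*-identityʳ q)) (subst (c ≈ 0ℤ ⟨_⟩) (sym (ℕₚ.*-identityʳ q))))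
      where
      last : ⟦ exact? (suc b) c ⟧ ≡ ⟦ c ≈? 0ℤ ⟨ q ^ suc b ⟩ ⟧
      last = ⟦⟧-cong _ _ proj₁ (λ c≈0 → c≈0 , λ b<b → contradiction b<b (ℕₚ.<-irrefl refl))
      step : ∀ e → e < b → ⟦ exact? (suc e) c ⟧ + ⟦ c ≈? 0ℤ ⟨ q ^ suc (suc e) ⟩ ⟧ ≡ ⟦ c ≈? 0ℤ ⟨ q ^ suc e ⟩ ⟧
      step e e<b = by-cases (toSum (c ≈? 0ℤ ⟨ q ^ suc (suc e) ⟩))
        where
        by-cases : (c ≈ 0ℤ ⟨ q ^ suc (suc e) ⟩) ⊎ ¬ (c ≈ 0ℤ ⟨ q ^ suc (suc e) ⟩) →
                   ⟦ exact? (suc e) c ⟧ + ⟦ c ≈? 0ℤ ⟨ q ^ suc (suc e) ⟩ ⟧ ≡ ⟦ c ≈? 0ℤ ⟨ q ^ suc e ⟩ ⟧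
        by-cases (inj₁ c≈0) = trans
          (cong₂ _+_ (⟦⟧-no (exact? (suc e) c) (λ (_ , not-more) → not-more (ℕ.s≤s e<b) c≈0)) (⟦⟧-yes (c ≈? 0ℤ ⟨ q ^ suc (suc e) ⟩) c≈0))
          (sym (⟦⟧-yes (c ≈? 0ℤ ⟨ q ^ suc e ⟩) (coarsen (q^-∣ (ℕₚ.n≤1+n (suc e))) c≈0)))
        by-cases (inj₂ c≉0) = trans (cong (⟦ exact? (suc e) c ⟧ +_) (⟦⟧-no (c ≈? 0ℤ ⟨ q ^ suc (suc e) ⟩) c≉0))
          (trans (ℕₚ.+-identityʳ _) (⟦⟧-cong _ _ proj₁ (λ c≈0 → c≈0 , λ _ → c≉0)))

    above-sum : (ℕ → ℤ → ℕ) → ℤ → ℕ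
    -- With `t = suc (j + b)`, the number of terms is `t + 1`, so `m = t` is included.
    above-sum F x = sum {suc (suc (j + b))} (λ m → ⟦ j ℕₚ.<? toℕ m ⟧ * F (toℕ m) x)

    above-sum-shift : ∀ F x → above-sum F x ≡ sum {suc b} (λ e → F (j + suc (toℕ e)) x)
    above-sum-shift F x =
      trans (split (cong suc (sym (ℕₚ.+-suc j b)))) (trans (sum-++ (suc j) {suc b} f) (cong₂ _+_ below above))
      where
      f : ℕ → ℕ
      f m = ⟦ j ℕₚ.<? m ⟧ * F m x
      split : ∀ {k k′} → k ≡ k′ → sum {k} (f ∘ toℕ) ≡ sum {k′} (f ∘ toℕ)
      split refl = refl
      below : sum {suc j} (f ∘ toℕ) ≡ 0
      below =
        trans (sum-cong-≋ {suc j} (λ m → cong (_* F (toℕ m) x) (⟦⟧-no (j ℕₚ.<? toℕ m) (ℕₚ.≤⇒≯ (ℕₚ.≤-pred (Finₚ.toℕ<n m))))))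
        (sum-replicate-zero (suc j))
      above : sum {suc b} (λ e → f (suc j + toℕ e)) ≡ sum {suc b} (λ e → F (j + suc (toℕ e)) x)
      above =
        sum-cong-≋ {suc b} (λ e → trans (cong (_* F (suc j + toℕ e) x) (⟦⟧-yes (j ℕₚ.<? (suc j + toℕ e)) (ℕ.s≤s (ℕₚ.m≤m+n j (toℕ e)))))
        (trans (ℕₚ.*-identityˡ _) (cong (λ m → F m x) (sym (ℕₚ.+-suc j (toℕ e))))))

    -- F m is the indicator of the one of χ i m and χ* i m whose elements
    -- p ^ i q ^ j c satisfy P (σ ⊙ c).
    record Family (σ : Sign) (F : ℕ → ℤ → ℕ) : Set where
      field
        multiple    : ∀ e → e ≤ suc b → ∀ c → F (j + e) (ℤ.+ D ℤ.* c) ≡ ⟦ exact? e c ⟧ * ⟦ P? (σ ⊙ c) ⟧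
        nonmultiple : ∀ e {x} → ¬ (x ≈ 0ℤ ⟨ D ⟩) → F (j + e) x ≡ 0

    module _ {σ : Sign} {F : ℕ → ℤ → ℕ} (family : Family σ F) where

      open Family family

      above-sum-multiple : ∀ c → above-sum F (ℤ.+ D ℤ.* c) ≡ ⟦ c ≈? 0ℤ ⟨ q ⟩ ⟧ * ⟦ P? (σ ⊙ c) ⟧
      above-sum-multiple c = trans (above-sum-shift F (ℤ.+ D ℤ.* c)) (trans
        (sum-cong-≋ {suc b} (λ e → multiple (suc (toℕ e)) (Finₚ.toℕ<n e) c))
        (trans (sym (*-distribʳ-sum {suc b} ⟦ P? (σ ⊙ c) ⟧ (λ e → ⟦ exact? (suc (toℕ e)) c ⟧)))
          (cong (_* ⟦ P? (σ ⊙ c) ⟧) (sum-exact c))))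

      above-sum-nonmultiple : ∀ {x} → ¬ (x ≈ 0ℤ ⟨ D ⟩) → above-sum F x ≡ 0
      above-sum-nonmultiple {x} x≉0 = trans (above-sum-shift F x) (trans
        (sum-cong-≋ {suc b} (λ e → nonmultiple (suc (toℕ e)) x≉0)) (sum-replicate-zero (suc b)))

    residue-family : P (ℤ.+ q) → ∀ σ → Family σ (I σ)
    residue-family Pq σ = record
      { multiple    = λ e e≤ c → I-multiple Sign.+ σ e≤ (P-q^ e) c
      ; nonmultiple = λ e → I-nonmultiple σ e
      }
      where
      P-q^ : ∀ e → P (ℤ.+ (q ^ e))
      P-q^ zero    = P-1
      P-q^ (suc e) = P-resp (Mod.reflexive (sym (ℤₚ.pos-* q (q ^ e)))) (P-* Pq (P-q^ e))

    -- When `-q` lies in `P`, the power `q ^ e` has sign (-1) ^ e. So for odd `e = m - j` the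
    -- elements with `P (σ ⊙ c)` make up the coset of the opposite sign.
    alternating : Sign → ℕ → ℤ → ℕ
    alternating σ m x = ⟦ ¬? (2 ∣? (m ∸ j)) ⟧ * I (Sign.- Sign.* σ) m x + ⟦ 2 ∣? (m ∸ j) ⟧ * I σ m x

    nonresidue-family : P (ℤ.- (ℤ.+ q)) → ∀ σ → Family σ (alternating σ)
    nonresidue-family P-q σ = record { multiple = multiple ; nonmultiple = nonmultiple }
      where
      P-[-q]^ : ∀ e → P ((ℤ.- (ℤ.+ q)) ℤ.^ e)
      P-[-q]^ zero    = P-1
      P-[-q]^ (suc e) = P-* P-q (P-[-q]^ e)

      pos-^ : ∀ e → (ℤ.+ q) ℤ.^ e ≡ ℤ.+ (q ^ e)
      pos-^ zero    = refl
      pos-^ (suc e) = trans (cong (ℤ.+ q ℤ.*_) (pos-^ e)) (sym (ℤₚ.pos-* q (q ^ e)))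

      P-even : ∀ {e} → 2 ∣ e → P (ℤ.+ (q ^ e))
      P-even (divides k refl) = P-resp (Mod.reflexive (trans (cong ((ℤ.- (ℤ.+ q)) ℤ.^_) (ℕₚ.*-comm k 2))
        (trans (neg-^-even (ℤ.+ q) k) (trans (cong ((ℤ.+ q) ℤ.^_) (ℕₚ.*-comm 2 k)) (pos-^ (k * 2)))))) (P-[-q]^ (k * 2))

      odd-form : ∀ e → ¬ (2 ∣ e) → Odd e
      odd-form e 2∤e =
        e / 2 , trans (ℕ/.m≡m%n+[m/n]*n e 2) (cong₂ _+_ (remainder (e % 2) refl (ℕ/.m%n<n e 2)) (ℕₚ.*-comm (e / 2) 2))
        where
        remainder : ∀ r → e % 2 ≡ r → r < 2 → r ≡ 1
        remainder 0 eq _ = contradiction (divides (e / 2) (trans (ℕ/.m≡m%n+[m/n]*n e 2) (cong (_+ e / 2 * 2) eq))) 2∤e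
        remainder 1 _  _ = refl
        remainder (suc (suc r)) _ (ℕ.s≤s (ℕ.s≤s ()))

      P-odd : ∀ {e} → Odd e → P (ℤ.- (ℤ.+ (q ^ e)))
      P-odd (k , refl) =
        P-resp (Mod.reflexive (trans (neg-^-odd (ℤ.+ q) k) (cong ℤ.-_ (pos-^ (suc (2 * k)))))) (P-[-q]^ (suc (2 * k)))

      nonmultiple : ∀ e {x} → ¬ (x ≈ 0ℤ ⟨ D ⟩) → alternating σ (j + e) x ≡ 0
      nonmultiple e x≉0 = cong₂ _+_
        (trans (cong (⟦ ¬? (2 ∣? (j + e ∸ j)) ⟧ *_) (I-nonmultiple (Sign.- Sign.* σ) e x≉0)) (ℕₚ.*-zeroʳ ⟦ ¬? (2 ∣? (j + e ∸ j)) ⟧))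
        (trans (cong (⟦ 2 ∣? (j + e ∸ j) ⟧ *_) (I-nonmultiple σ e x≉0)) (ℕₚ.*-zeroʳ ⟦ 2 ∣? (j + e ∸ j) ⟧))

      multiple : ∀ e → e ≤ suc b → ∀ c → alternating σ (j + e) (ℤ.+ D ℤ.* c) ≡ ⟦ exact? e c ⟧ * ⟦ P? (σ ⊙ c) ⟧
      multiple e e≤ c =
        trans (cong (λ z → ⟦ ¬? (2 ∣? z) ⟧ * I⁻ + ⟦ 2 ∣? z ⟧ * I⁺) (ℕₚ.m+n∸m≡n j e)) (by-cases (toSum (2 ∣? e)))
        where
        I⁺ I⁻ : ℕ
        I⁺ = I σ (j + e) (ℤ.+ D ℤ.* c)
        I⁻ = I (Sign.- Sign.* σ) (j + e) (ℤ.+ D ℤ.* c)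
        by-cases : 2 ∣ e ⊎ ¬ (2 ∣ e) → ⟦ ¬? (2 ∣? e) ⟧ * I⁻ + ⟦ 2 ∣? e ⟧ * I⁺ ≡ ⟦ exact? e c ⟧ * ⟦ P? (σ ⊙ c) ⟧
        by-cases (inj₁ 2∣e) =
          trans (cong₂ (λ u v → u * I⁻ + v * I⁺) (⟦⟧-no (¬? (2 ∣? e)) (λ 2∤e → 2∤e 2∣e)) (⟦⟧-yes (2 ∣? e) 2∣e))
          (trans (ℕₚ.*-identityˡ I⁺) (I-multiple Sign.+ σ e≤ (P-even 2∣e) c))
        by-cases (inj₂ 2∤e) = trans (cong₂ (λ u v → u * I⁻ + v * I⁺) (⟦⟧-yes (¬? (2 ∣? e)) 2∤e) (⟦⟧-no (2 ∣? e) 2∤e))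
          (trans (ℕₚ.+-identityʳ _) (trans (ℕₚ.*-identityˡ I⁻) (I-multiple Sign.- σ e≤ (P-odd (odd-form e 2∤e)) c)))

    convolution : ℤ → ℕ
    convolution x = Σ n (λ y → I Sign.+ j y * I Sign.+ j (x ℤ.- y))

    I-j-nonmultiple : ∀ σ {x} → ¬ (x ≈ 0ℤ ⟨ D ⟩) → I σ j x ≡ 0
    I-j-nonmultiple σ {x} x≉0 = trans (cong (λ m → I σ m x) (sym (ℕₚ.+-identityʳ j))) (I-nonmultiple σ 0 x≉0)

    -- Only multiples of `D` contribute, which leaves `M = p ^ a * q ^ b * (p * q)` values of the
    -- variable, that is `p ^ a * q ^ b` periods of the summand.
    convolution-multiple : ∀ c → convolution (ℤ.+ D ℤ.* c) ≡ (p ^ a * q ^ b) * (sums c * unit-sums q c)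
    convolution-multiple c = begin
      convolution (ℤ.+ D ℤ.* c)
        ≡⟨ cong (λ k → Σ k F) (trans n≡D*M (ℕₚ.*-comm D M)) ⟩
      Σ (M * D) F
        ≡⟨ Σ-multiples M D F (λ y y≉0 → cong (_* I Sign.+ j (ℤ.+ D ℤ.* c ℤ.- y)) (I-j-nonmultiple Sign.+ y≉0)) ⟩
      Σ M (λ y → F (ℤ.+ D ℤ.* y))
        ≡⟨ Σ-cong M (λ y → cong₂ _*_ (I-j Sign.+ y) (trans (cong (I Sign.+ j) (distrib (ℤ.+ D) c y)) (I-j Sign.+ (c ℤ.- y)))) ⟩
      Σ M (λ y → (⟦ P? y ⟧ * ⟦ unit? q y ⟧) * (⟦ P? (c ℤ.- y) ⟧ * ⟦ unit? q (c ℤ.- y) ⟧))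
        ≡⟨ cong (λ k → Σ k (λ y → (⟦ P? y ⟧ * ⟦ unit? q y ⟧) * (⟦ P? (c ℤ.- y) ⟧ * ⟦ unit? q (c ℤ.- y) ⟧))) (M-split p (p ^ a) q (q ^ b)) ⟩
      Σ (p ^ a * q ^ b * (p * q)) (λ y → (⟦ P? y ⟧ * ⟦ unit? q y ⟧) * (⟦ P? (c ℤ.- y) ⟧ * ⟦ unit? q (c ℤ.- y) ⟧))
        ≡⟨ residue-unit-sums P-residues (proj₁ q-inverse) (proj₂ q-inverse) (p ^ a * q ^ b) c ⟩
      (p ^ a * q ^ b) * (sums c * unit-sums q c) ∎
      where
      open ≡.≡-Reasoning
      F : ℤ → ℕ
      F y = I Sign.+ j y * I Sign.+ j (ℤ.+ D ℤ.* c ℤ.- y)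
      q-inverse : ∃ λ x → ℤ.+ q ℤ.* x ≈ 1ℤ ⟨ p ⟩
      q-inverse = coprime-inverse (Coprimality.sym p⊥q)
      distrib : ∀ d c y → d ℤ.* c ℤ.- d ℤ.* y ≡ d ℤ.* (c ℤ.- y)
      distrib = ℤ-Solver.solve-∀
      M-split : ∀ p pᵃ q qᵇ → (p * pᵃ) * (q * qᵇ) ≡ pᵃ * qᵇ * (p * q)
      M-split = solve-∀

    convolution-nonmultiple : ∀ {x} → ¬ (x ≈ 0ℤ ⟨ D ⟩) → convolution x ≡ 0
    convolution-nonmultiple {x} x≉0 = Σ-0 n (λ y → by-cases y (toSum (y ≈? 0ℤ ⟨ D ⟩)))
      where
      by-cases : ∀ y → (y ≈ 0ℤ ⟨ D ⟩) ⊎ ¬ (y ≈ 0ℤ ⟨ D ⟩) → I Sign.+ j y * I Sign.+ j (x ℤ.- y) ≡ 0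
      by-cases y (inj₂ y≉0) = cong (_* I Sign.+ j (x ℤ.- y)) (I-j-nonmultiple Sign.+ y≉0)
      by-cases y (inj₁ y≈0) =
        trans (cong (I Sign.+ j y *_) (I-j-nonmultiple Sign.+ (λ x-y≈0 → x≉0 (Mod.trans (fromMod x y (≈0⇒∣ x-y≈0)) y≈0))))
        (ℕₚ.*-zeroʳ (I Sign.+ j y))

    module _ {F⁺ F⁻ : ℕ → ℤ → ℕ} (family⁺ : Family Sign.+ F⁺) (family⁻ : Family Sign.- F⁻) where

      -- The coefficients of the right-hand side; `q ^ b * (q ∸ 1)` is φ(q ^ (t - j)), since `t - j`
      -- is `suc b`.
      coefficients : ℤ → ℕ
      coefficients x =
        ((p ∸ 3) / 4 * p ^ a) * (((q ∸ 2) * q ^ b) * I Sign.+ j x + (q ^ b * (q ∸ 1)) * above-sum F⁺ x) +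
        (suc p / 4 * p ^ a) * (((q ∸ 2) * q ^ b) * I Sign.- j x + (q ^ b * (q ∸ 1)) * above-sum F⁻ x)

      coefficients-multiple : ∀ c → convolution (ℤ.+ D ℤ.* c) ≡ coefficients (ℤ.+ D ℤ.* c)
      coefficients-multiple c = begin
        convolution (ℤ.+ D ℤ.* c)
          ≡⟨ convolution-multiple c ⟩
        (p ^ a * q ^ b) * (sums c * unit-sums q c)
          ≡⟨ cong₂ (λ u v → (p ^ a * q ^ b) * (u * v)) (sums-formula c) (unit-sums-formula q (ℕ.nonTrivial⇒n>1 q {{prime⇒nonTrivial q-prime}}) c) ⟩
        (p ^ a * q ^ b) * ((sums 1ℤ * π⁺ + suc (sums 1ℤ) * π⁻) * ((q ∸ 2) * υ + (q ∸ 1) * ζ))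
          ≡⟨ cong₂ (λ u v → (p ^ a * q ^ b) * ((u * π⁺ + v * π⁻) * ((q ∸ 2) * υ + (q ∸ 1) * ζ))) A⁺≡ A⁻≡ ⟨
        (p ^ a * q ^ b) * (((p ∸ 3) / 4 * π⁺ + suc p / 4 * π⁻) * ((q ∸ 2) * υ + (q ∸ 1) * ζ))
          ≡⟨ expand (p ^ a) (q ^ b) ((p ∸ 3) / 4) (suc p / 4) (q ∸ 2) (q ∸ 1) π⁺ π⁻ υ ζ ⟩
        ((p ∸ 3) / 4 * p ^ a) * (((q ∸ 2) * q ^ b) * (π⁺ * υ) + (q ^ b * (q ∸ 1)) * (ζ * π⁺)) +
        (suc p / 4 * p ^ a) * (((q ∸ 2) * q ^ b) * (π⁻ * υ) + (q ^ b * (q ∸ 1)) * (ζ * π⁻))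
          ≡⟨ cong₂ (λ u v → ((p ∸ 3) / 4 * p ^ a) * u + (suc p / 4 * p ^ a) * v)
               (cong₂ (λ u v → ((q ∸ 2) * q ^ b) * u + (q ^ b * (q ∸ 1)) * v) (I-j Sign.+ c) (above-sum-multiple family⁺ c))
               (cong₂ (λ u v → ((q ∸ 2) * q ^ b) * u + (q ^ b * (q ∸ 1)) * v) (I-j Sign.- c) (above-sum-multiple family⁻ c)) ⟨
        coefficients (ℤ.+ D ℤ.* c) ∎
        where
        open ≡.≡-Reasoning
        π⁺ π⁻ υ ζ : ℕ
        π⁺ = ⟦ P? c ⟧
        π⁻ = ⟦ P? (ℤ.- c) ⟧
        υ = ⟦ unit? q c ⟧
        ζ = ⟦ c ≈? 0ℤ ⟨ q ⟩ ⟧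
        -- The divisions by 4 are exact: `p≡4a+3` makes the two constants `sums 1ℤ` and its
        -- successor.
        A⁺≡ : (p ∸ 3) / 4 ≡ sums 1ℤ
        A⁺≡ =
          trans (cong (λ p → (p ∸ 3) / 4) p≡4a+3) (trans (cong (_/ 4) (trans (ℕₚ.m+n∸n≡m (4 * sums 1ℤ) 3) (ℕₚ.*-comm 4 (sums 1ℤ)))) (ℕ/.m*n/n≡m (sums 1ℤ) 4))
        A⁻≡ : suc p / 4 ≡ suc (sums 1ℤ)
        A⁻≡ =
          trans (cong (λ p → suc p / 4) p≡4a+3) (trans (cong (_/ 4) (identity (sums 1ℤ))) (ℕ/.m*n/n≡m (suc (sums 1ℤ)) 4))
          where
          identity : ∀ a → suc (4 * a + 3) ≡ suc a * 4
          identity = solve-∀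
        expand : ∀ P Q A B u v π⁺ π⁻ υ ζ → (P * Q) * ((A * π⁺ + B * π⁻) * (u * υ + v * ζ)) ≡
                 (A * P) * ((u * Q) * (π⁺ * υ) + (Q * v) * (ζ * π⁺)) + (B * P) * ((u * Q) * (π⁻ * υ) + (Q * v) * (ζ * π⁻))
        expand = solve-∀

      coefficients-nonmultiple : ∀ {x} → ¬ (x ≈ 0ℤ ⟨ D ⟩) → coefficients x ≡ 0
      coefficients-nonmultiple {x} x≉0 = cong₂ _+_
        (vanish ((p ∸ 3) / 4 * p ^ a) {I Sign.+ j x} {above-sum F⁺ x} (I-j-nonmultiple Sign.+ x≉0) (above-sum-nonmultiple family⁺ x≉0))
        (vanish (suc p / 4 * p ^ a) {I Sign.- j x} {above-sum F⁻ x} (I-j-nonmultiple Sign.- x≉0) (above-sum-nonmultiple family⁻ x≉0))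
        where
        vanish : ∀ A {u v} → u ≡ 0 → v ≡ 0 → A * (((q ∸ 2) * q ^ b) * u + (q ^ b * (q ∸ 1)) * v) ≡ 0
        vanish A refl refl =
          trans (cong (A *_) (cong₂ _+_ (ℕₚ.*-zeroʳ ((q ∸ 2) * q ^ b)) (ℕₚ.*-zeroʳ (q ^ b * (q ∸ 1))))) (ℕₚ.*-zeroʳ A)

      convolution≡coefficients : ∀ x → convolution x ≡ coefficients x
      convolution≡coefficients x = [ multiple , nonmultiple ]′ (toSum (x ≈? 0ℤ ⟨ D ⟩))
        where
        nonmultiple : ¬ (x ≈ 0ℤ ⟨ D ⟩) → convolution x ≡ coefficients x
        nonmultiple x≉0 = trans (convolution-nonmultiple {x} x≉0) (sym (coefficients-nonmultiple {x} x≉0))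

        transport : ∀ y z → y ≡ z → convolution y ≡ coefficients y → convolution z ≡ coefficients z
        transport y z refl eq = eq

        multiple : x ≈ 0ℤ ⟨ D ⟩ → convolution x ≡ coefficients x
        multiple (congruent c cD≡x) = transport (ℤ.+ D ℤ.* c) x
          (trans (ℤₚ.*-comm (ℤ.+ D) c) (trans cD≡x (ℤₚ.+-identityʳ x))) (coefficients-multiple c)

    open CosetSums p q l (suc (i + a)) (suc (j + b)) g hiding (n; _≈_)
    open Expand (cyclicRing n l) using (Ψ; Ψ-residues; Ψ-filter; Ψ-partition; Ψ-square)

    private module Q = CommutativeRing (𝔽[X]/⟨X^ n -1⟩ l)

    sums-Ψ : ∀ σ m → cosetSum (rep σ m) Q.≈ Ψ (I σ m)
    sums-Ψ σ m = Ψ-residues (inCoset? l n (rep σ m)) (λ α → Polynomial.X^_ (ℤ/ l) (toℕ α)) (I σ m)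
      (λ α → X^-residue n l (toℕ α)) (I-residue σ m)

    square : ∀ {S⁺ S⁻ F⁺ F⁻} → Family Sign.+ F⁺ → Family Sign.- F⁻ →
             S⁺ Q.≈ Ψ (above-sum F⁺) → S⁻ Q.≈ Ψ (above-sum F⁻) →
             Square p q l (suc (i + a)) (suc (j + b)) g i j a b (q ^ b * (q ∸ 1)) S⁺ S⁻
    square {S⁺} {S⁻} {F⁺} {F⁻} family⁺ family⁻ S⁺≈ S⁻≈ =
      Ψ-square ((p ∸ 3) / 4 * p ^ a) (suc p / 4 * p ^ a) ((q ∸ 2) * q ^ b) (q ^ b * (q ∸ 1))
        (I Sign.+ j) (I Sign.- j) (above-sum F⁺) (above-sum F⁻)
        (sums-Ψ Sign.+ j) (sums-Ψ Sign.- j) S⁺≈ S⁻≈ (I-periodic Sign.+ j) (convolution≡coefficients family⁺ family⁻)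

    square-residue : QuadraticResidue (ℤ.+ q) p → Square p q l (suc (i + a)) (suc (j + b)) g i j a b (q ^ b * (q ∸ 1)) (∑ (above j) (χ i)) (∑ (above j) (χ* i))
    square-residue q-residue =
      square (residue-family Pq Sign.+) (residue-family Pq Sign.-) (sum-Ψ Sign.+) (sum-Ψ Sign.-)
      where
      Pq : P (ℤ.+ q)
      Pq = residue⇒P q-residue
      sum-Ψ : ∀ σ → ∑ (above j) (λ m → cosetSum (rep σ m)) Q.≈ Ψ (above-sum (I σ))
      sum-Ψ σ = Ψ-filter (j ℕₚ.<?_) (suc (suc (j + b))) (λ m → cosetSum (rep σ m)) (I σ) (sums-Ψ σ)

    square-nonresidue : QuadraticNonresidue (ℤ.+ q) p →
      Square p q l (suc (i + a)) (suc (j + b)) g i j a b (q ^ b * (q ∸ 1)) (∑ (above-odd j) (χ* i) ⊕ ∑ (above-even j) (χ i)) (∑ (above-odd j) (χ i) ⊕ ∑ (above-even j) (χ* i))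
    square-nonresidue q-nonresidue =
      square (nonresidue-family P-q Sign.+) (nonresidue-family P-q Sign.-) (sum-Ψ Sign.+) (sum-Ψ Sign.-)
      where
      P-q : P (ℤ.- (ℤ.+ q))
      P-q = nonresidue⇒P q-nonresidue
      sum-Ψ : ∀ σ → ∑ (above-odd j) (λ m → cosetSum (rep (Sign.- Sign.* σ) m)) ⊕ ∑ (above-even j) (λ m → cosetSum (rep σ m)) Q.≈
                    Ψ (above-sum (alternating σ))
      sum-Ψ σ = Ψ-partition (j ℕₚ.<?_) (λ m → 2 ∣? (m ∸ j)) (suc (suc (j + b)))
        (λ m → cosetSum (rep (Sign.- Sign.* σ) m)) (λ m → cosetSum (rep σ m)) (I (Sign.- Sign.* σ)) (I σ)
        (sums-Ψ (Sign.- Sign.* σ)) (sums-Ψ σ)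

open import Data.Integer using (ℤ; +_)
open import Data.Nat using (ℕ; suc; _+_; _*_; _∸_; _^_; _/_; _%_; _≤_; _<_)
open import Data.Nat.Divisibility using (_∤_)
open import Data.Nat.GCD using (gcd)
open import Data.Nat.Primality using (Prime)
open import Data.Product using (_×_)
open import Relation.Binary.PropositionalEquality using (_≡_; _≢_; refl; sym; trans)

-- Return to the parameters s and t of the statement.

-- The witnesses are `s - i - 1` and `t - j - 1`. Matching on their equations replaces `s` and `t`
-- by `suc (i + a)` and `suc (j + b)`, so the truncated subtractions are reconciled only once, in
-- `renumber`.
squares : ∀ s t p q l g i j → (∃ λ a → suc i + a ≡ s) → (∃ λ b → suc j + b ≡ t) →
  Prime p → Prime q → p ≢ q → p % 4 ≡ 3 →
  HasOrder (p ^ s) (+ l) (φ (p ^ s) / 2) → HasOrder (q ^ t) (+ l) (φ (q ^ t)) →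
  gcd (φ (p ^ s)) (φ (q ^ t)) ≡ 2 → IsPrimitiveRoot g (p ^ s) → IsPrimitiveRoot g (q ^ t) →
  let open CosetSums p q l s t g
      Squareᵢⱼ = Square p q l s t g i j (s ∸ i ∸ 1) (t ∸ j ∸ 1) (φ (q ^ (t ∸ j)))
  in (QuadraticResidue (+ q) p → Squareᵢⱼ (∑ (above j) (χ i)) (∑ (above j) (χ* i))) ×
     (QuadraticNonresidue (+ q) p →
       Squareᵢⱼ (∑ (above-odd j) (χ* i) ⊕ ∑ (above-even j) (χ i)) (∑ (above-odd j) (χ i) ⊕ ∑ (above-even j) (χ* i)))
squares s t p q l g i j (a , refl) (b , refl) p-prime q-prime p≢q p%4≡3 l-order-p l-order-q gcd≡2 g-order-p g-order-q =
  (λ q-residue → renumber _ _ (S.square-residue q-residue)) ,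
  (λ q-nonresidue → renumber _ _ (S.square-nonresidue q-nonresidue))
  where
  φp-form : Remainders.Odd (φ (p ^ suc (i + a)) / 2) × φ (p ^ suc (i + a)) ≡ 2 * (φ (p ^ suc (i + a)) / 2)
  φp-form = Remainders.half-φ-odd {p} (i + a) p%4≡3 (Orders.φ-prime-power p-prime (i + a))

  module S = CosetSquares.Squares {i} {j} {a} {b} {p} {q} {φ (p ^ suc (i + a)) / 2} {φ (q ^ suc (j + b))} {l} {g}
    p-prime q-prime p≢q (proj₁ φp-form)
    (Remainders.odd-coprime (proj₁ φp-form) (subst (λ d → gcd d (φ (q ^ suc (j + b))) ≡ 2) (proj₂ φp-form) gcd≡2))
    (Remainders.1≉-1 p%4≡3) l-order-p l-order-q
    (subst (HasOrder (p ^ suc (i + a)) g) (proj₂ φp-form) g-order-p) g-order-q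
    (λ {x} order → Orders.primitive-root-generates p-prime (i + a) (subst (HasOrder (p ^ suc (i + a)) x) (sym (proj₂ φp-form)) order))
    (λ order → Orders.primitive-root-generates q-prime (j + b) order)

  difference : ∀ i a → suc (i + a) ∸ i ≡ suc a
  difference i a = trans (cong (_∸ i) (sym (ℕₚ.+-suc i a))) (ℕₚ.m+n∸m≡n i (suc a))

  renumber : ∀ S⁺ S⁻ → Square p q l (suc (i + a)) (suc (j + b)) g i j a b (q ^ b * (q ∸ 1)) S⁺ S⁻ →
             Square p q l (suc (i + a)) (suc (j + b)) g i j (suc (i + a) ∸ i ∸ 1) (suc (j + b) ∸ j ∸ 1) (φ (q ^ (suc (j + b) ∸ j))) S⁺ S⁻
  renumber S⁺ S⁻ = along (cong (_∸ 1) (sym (difference i a))) (cong (_∸ 1) (sym (difference j b)))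
    (trans (sym (Orders.φ-prime-power q-prime b)) (cong (λ e → φ (q ^ e)) (sym (difference j b))))
    where
    along : ∀ {u u′ v v′ w w′} → u ≡ u′ → v ≡ v′ → w ≡ w′ →
            Square p q l (suc (i + a)) (suc (j + b)) g i j u v w S⁺ S⁻ →
            Square p q l (suc (i + a)) (suc (j + b)) g i j u′ v′ w′ S⁺ S⁻
    along refl refl refl eq = eq

theorem4p1 : ∀ (s t p q l : ℕ) (g : ℤ) →
    1 ≤ s → 1 ≤ t →
    Prime p → Prime q → Prime l →
    p ≢ q → p ≢ l → q ≢ l →
    2 ∤ p → 2 ∤ q →
    p % 4 ≡ 3 →
    HasOrder (p ^ s) (+ l) (φ (p ^ s) / 2) →
    HasOrder (q ^ t) (+ l) (φ (q ^ t)) →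
    gcd (φ (p ^ s)) (φ (q ^ t)) ≡ 2 →
    IsPrimitiveRoot g (p ^ s) → IsPrimitiveRoot g (q ^ t) →
    ∀ (i j : ℕ) → i < s → j < t →
    let open CosetSums p q l s t g in
    ( QuadraticResidue (+ q) p →
    χ i j ⊗ χ i j ≈
    ((p ∸ 3) / 4 * p ^ (s ∸ i ∸ 1)) ·
    ( ((q ∸ 2) * q ^ (t ∸ j ∸ 1)) · χ i j
    ⊕ φ (q ^ (t ∸ j)) · ∑ (above j) (χ i) )
    ⊕ (suc p / 4 * p ^ (s ∸ i ∸ 1)) ·
    ( ((q ∸ 2) * q ^ (t ∸ j ∸ 1)) · χ* i j
    ⊕ φ (q ^ (t ∸ j)) · ∑ (above j) (χ* i) ) )
    ×
    ( QuadraticNonresidue (+ q) p →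
    χ i j ⊗ χ i j ≈
    ((p ∸ 3) / 4 * p ^ (s ∸ i ∸ 1)) ·
    ( ((q ∸ 2) * q ^ (t ∸ j ∸ 1)) · χ i j
    ⊕ φ (q ^ (t ∸ j)) ·
    (∑ (above-odd j) (χ* i) ⊕ ∑ (above-even j) (χ i)) )
    ⊕ (suc p / 4 * p ^ (s ∸ i ∸ 1)) ·
    ( ((q ∸ 2) * q ^ (t ∸ j ∸ 1)) · χ* i j
    ⊕ φ (q ^ (t ∸ j)) ·
    (∑ (above-odd j) (χ i) ⊕ ∑ (above-even j) (χ* i)) ) )
theorem4p1 s t p q l g _ _ p-prime q-prime _ p≢q _ _ _ _ p%4≡3 l-order-p l-order-q gcd≡2 g-order-p g-order-q i j i<s j<t =
  squares s t p q l g i j (ℕₚ.m≤n⇒∃[o]m+o≡n i<s) (ℕₚ.m≤n⇒∃[o]m+o≡n j<t)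
    p-prime q-prime p≢q p%4≡3 l-order-p l-order-q gcd≡2 g-order-p g-order-q
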